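{- Let $G$ be a finite nonempty simple graph with no isolated vertices. Then the matching complex $M(G)$ is a two-dimensional Buchsbaum complex if and only if $G$ is (up to isomorphism) one of the following graphs: (a) a member of one of the families $\mathcal{B}_{C_7}$, $\mathcal{B}_P$, or $\mathcal{B}_i$ for some $i\in\{1,\dots,9\}$; (b) one of the two exceptional graphs $E_1$ and $E_2$; (c) a disconnected graph such that either (i) $G$ has exactly three connected components, each of which is either $K_3$ or a star graph, or (ii) $G$ has exactly two connected components, one of which is $K_3$ or a star graph and the other of which is either the bowtie graph $B$ or a graph in one of the families $\mathcal{G}_1,\mathcal{G}_2,\mathcal{G}_3$.
   Context: A matching in $G$ is a set of edges no two of which share an endpoint. $M(G)$ is the simplicial complex whose faces are all matchings of $G$ (its vertices are the edges of $G$). A two-dimensional simplicial complex $\Delta$ is Buchsbaum if for every vertex $v$ of $\Delta$, $\mathrm{link}_\Delta v=\{\tau\in\Delta: v\notin\tau,\ \tau\cup\{v\}\in\Delta\}$ is a connected graph (1-dimensional complex) with at least one edge. The star graph $S_n$ ($n\ge 1$) has $n+1$ vertices: one center joined to $n$ leaves. Subgraphs are not necessarily induced. Each family below is taken up to isomorphism and given by: vertices, required edges, optional edges (any subset of these may be included), and a set $U$ of vertices ("unfilled"; possibly empty). One may moreover add any finite number (possibly zero) of new vertices, each joined to some nonempty subset of $U$ (new vertices have no other neighbors). $\mathcal{G}_1$: vertices $1,\dots,5$; required $12,23,34,45$; optional $14,25$; $U=\{2,4\}$. $\mathcal{G}_2$: vertices $1,\dots,5$; required $12,23,13,34,45$;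 optional $14,24$; $U=\{4\}$. $\mathcal{G}_3$: vertices $1,\dots,5$; required $12,23,34,45,51$; optional $13,35,25,24,14$; $U=\emptyset$. Bowtie graph $B$: vertices $1,\dots,5$, edges $12,23,13,34,45,35$. $\mathcal{B}_1$: vertices $g_1,g_2,g_3,v_1,v_2,v_3$; required $g_1v_1,g_2v_2,g_3v_3$; no optional edges; $U=\{g_1,g_2,g_3\}$. $\mathcal{B}_2$: vertices $g_1,g_2,g_3,v_1,\dots,v_4$; required $g_1v_1,g_1v_3,g_2v_1,g_2v_2,g_2v_3,g_2v_4,g_3v_2,g_3v_4$; no optional edges; $U=\{g_1,g_2,g_3\}$. $\mathcal{B}_3$: vertices $g_1,g_2,g_3,v_1,\dots,v_4$; required $g_1v_2,v_2g_2,g_2v_3,v_3g_3,g_3v_4,v_4g_1,v_1g_1,v_1g_2,v_1g_3$; optional $g_1v_3,g_2v_4,g_3v_2$; $U=\{g_1,g_2,g_3\}$. $\mathcal{B}_4$: vertices $g_1,g_2,g_3,v_1,\dots,v_5$; required $g_1v_2,v_2g_2,g_2v_3,v_3g_3,g_3v_4,v_4g_1,g_1v_5,g_2v_1,g_3v_1$; optional $g_1v_3,g_2v_4,g_3v_2$; $U=\{g_1,g_2,g_3\}$. $\mathcal{B}_5$: vertices $g_1,g_2,g_3,v_1,\dots,v_5$; required $g_1v_1,g_1v_2,g_1v_3,g_2v_1,g_2v_3,g_2v_5,g_3v_3,g_3v_4,g_3v_5$; optional $g_2v_2,g_2v_4,g_1v_5,g_3v_1$; $U=\{g_1,g_2,g_3\}$.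 $\mathcal{B}_6$: vertices $g_1,g_2,g_3,v_1,\dots,v_5$; required $g_1v_1,g_1v_2,g_2v_2,g_2v_3,g_2v_5,g_3v_5,g_3v_4$; optional $g_3v_2,g_3v_3,g_2v_4$; $U=\{g_1,g_2,g_3\}$. $\mathcal{B}_7$: vertices $g,v_1,\dots,v_7$; required $v_1v_2,v_2v_3,v_1v_3,gv_1,gv_4,v_4v_5,v_5v_6,v_4v_6,gv_7$; optional $gv_2,gv_3,gv_5,gv_6$; $U=\{g\}$. $\mathcal{B}_8$: vertices $g_1,g_2,v_1,\dots,v_6$; required $v_1v_2,v_2v_3,v_1v_3,g_1v_1,g_1v_4,g_1v_5,g_2v_4,g_2v_6$; optional $g_1v_2,g_1v_3,g_2v_5,g_1v_6$; $U=\{g_1,g_2\}$. $\mathcal{B}_9$: vertices $g_1,g_2,v_1,\dots,v_6$; required $v_1v_2,v_2v_3,v_1v_3,g_1v_1,g_2v_1,g_1v_6,g_2v_6,g_1v_4,g_2v_5$; optional $g_2v_4,g_1v_5$; $U=\{g_1,g_2\}$. $E_1$: two copies of $K_4$ sharing exactly one vertex (7 vertices, 12 edges). $E_2$: a $K_4$ and a 4-cycle $C_4$ sharing exactly one vertex (7 vertices, 10 edges). $\mathcal{B}_{C_7}$: the family of all graphs $G$ (without isolated vertices) containing the 7-cycle $C_7$ as a subgraph such that $M(G)$ is a two-dimensional Buchsbaum complex. $\mathcal{B}_P$ (petal graphs): graphs formed from three graphs, each either $K_3$ or a star graph with at least two edges, by gluing them together at a single vertex; for each star the gluing vertex must be a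 non-central vertex (leaf; for $S_2$ the center is the vertex of degree 2). -}

module Defs where

open import Data.Fin using (Fin; zero; suc; toℕ; _≟_)
import Data.Fin as Fin
open import Data.Fin.Patterns
open import Data.Fin.Properties using (toℕ<n)
open import Data.List using (List; []; _∷_; length)
open import Data.List.Membership.Propositional using (_∈_; _∉_)
open import Data.List.Relation.Binary.Subset.Propositional using (_⊆_)
open import Data.List.Relation.Binary.Subset.Propositional.Properties using (∷⁺ʳ)
open import Data.List.Relation.Unary.Unique.Propositional using (Unique)
open import Data.Nat using (ℕ; zero; suc; _+_; _≤_)
import Data.Nat as ℕ
open import Data.Nat.DivMod using (_%_; m<n⇒m%n≡m; n%n≡0)
open import Data.Nat.Properties using (m≤n⇒m<n∨m≡n; 1+n≢n)
open import Data.Product using (_×_; _,_; ∃; proj₁)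
open import Data.Sum using (_⊎_; inj₁; inj₂; swap)
open import Data.Vec using (Vec; []; _∷_; lookup)
open import Function using (_∘_; _↔_; _⇔_; Inverse)
open import Function.Definitions using (Injective; Surjective)
open import Level using (0ℓ)
open import Relation.Binary using (Rel; Symmetric; Irreflexive; Decidable)
open import Relation.Binary.Construct.Closure.ReflexiveTransitive using (Star)
open import Relation.Binary.PropositionalEquality
  using (_≡_; _≢_; refl; sym; trans; cong)
open import Relation.Nullary using (¬_)
open import Relation.Nullary.Decidable using (¬?; _⊎-dec_; _×-dec_)
open import Relation.Unary using (Pred)

record Graph (V : Set) : Set₁ where
  infix 4 _~_
  field
    _~_      : Rel V 0ℓ
    ~-sym    : Symmetric _~_
    ~-irrefl : Irreflexive _≡_ _~_
    _~?_     : Decidable _~_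

NoIsolatedVertices : ∀ {V} → Graph V → Set
NoIsolatedVertices G = ∀ v → ∃ λ w → v ~ w
  where open Graph G

record _≅_ {V W} (G : Graph V) (H : Graph W) : Set where
  field
    bijection : V ↔ W
  open Inverse bijection using (to)
  field
    adjacency : ∀ u v → Graph._~_ G u v ⇔ Graph._~_ H (to u) (to v)

infix 4 _≅_

record _Contains_ {V W} (G : Graph V) (H : Graph W) : Set where
  field
    embed           : W → V
    embed-injective : Injective _≡_ _≡_ embed
    embed-adjacent  : ∀ {a b} → Graph._~_ H a b → Graph._~_ G (embed a) (embed b)

infix 4 _Contains_

-- The subgraph induced on the vertices satisfying P.  It is only used with
-- predicates P all of whose proofs are equal, so that ∃ P is a subset of V.
induced : ∀ {V} → Graph V → (P : Pred V 0ℓ) → Graph (∃ P)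
induced G P = record
  { _~_      = λ u v → proj₁ u ~ proj₁ v
  ; ~-sym    = ~-sym
  ; ~-irrefl = λ u≡v → ~-irrefl (cong proj₁ u≡v)
  ; _~?_     = λ u v → proj₁ u ~? proj₁ v
  }
  where open Graph G

Connected : ∀ {V} → Graph V → Set
Connected G = ∀ u v → Star (Graph._~_ G) u v

-- A witness that G has exactly k connected components: a numbering of the
-- classes of the reachability relation by Fin k.
record Components {V} (G : Graph V) (k : ℕ) : Set where
  open Graph G
  field
    label            : V → Fin k
    label-surjective : Surjective _≡_ _≡_ label
    label-reachable  : ∀ u v → label u ≡ label v ⇔ Star _~_ u v

  component : (i : Fin k) → Graph (∃ λ v → label v ≡ i)
  component i = induced G (λ v → label v ≡ i)

K : ∀ n → Graph (Fin n)
K n = record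
  { _~_      = _≢_
  ; ~-sym    = λ u≢v → u≢v ∘ sym
  ; ~-irrefl = λ u≡v u≢v → u≢v u≡v
  ; _~?_     = λ u v → ¬? (u ≟ v)
  }

-- The star with n edges; the centre is zero and the leaves are suc i.
S : ∀ n → Graph (Fin (suc n))
S n = record
  { _~_      = λ u v → (u ≡ zero × v ≢ zero) ⊎ (v ≡ zero × u ≢ zero)
  ; ~-sym    = swap
  ; ~-irrefl = λ { refl (inj₁ (p , q)) → q p ; refl (inj₂ (p , q)) → q p }
  ; _~?_     = λ u v → ((u ≟ zero) ×-dec ¬? (v ≟ zero))
                   ⊎-dec ((v ≟ zero) ×-dec ¬? (u ≟ zero))
  }

-- The cycle with 3 + k vertices.
C₃₊ : ∀ k → Graph (Fin (3 + k))
C₃₊ k = record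
  { _~_      = λ u v → Next u v ⊎ Next v u
  ; ~-sym    = swap
  ; ~-irrefl = λ { refl (inj₁ p) → noLoop p ; refl (inj₂ p) → noLoop p }
  ; _~?_     = λ u v → (toℕ v ℕ.≟ _) ⊎-dec (toℕ u ℕ.≟ _)
  }
  where
  Next : Rel (Fin (3 + k)) 0ℓ
  Next u v = toℕ v ≡ suc (toℕ u) % (3 + k)

  noLoop : ∀ {u} → ¬ Next u u
  noLoop {u} u≡ with m≤n⇒m<n∨m≡n (toℕ<n u)
  ... | inj₁ 1+u<n = 1+n≢n (sym (trans u≡ (m<n⇒m%n≡m 1+u<n)))
  ... | inj₂ 1+u≡n with trans u≡ (trans (cong (_% (3 + k)) 1+u≡n) (n%n≡0 (3 + k)))
  ...   | u≡0 with trans (sym 1+u≡n) (cong suc u≡0)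
  ...     | ()

C₄ : Graph (Fin 4)
C₄ = C₃₊ 1

C₇ : Graph (Fin 7)
C₇ = C₃₊ 4

-- A finite set of vertices is given by a list enumerating it, in any order
-- and possibly with repetitions.  Closure under list inclusion makes Face
-- depend on the underlying set only.  Elements of V need not be vertices of
-- the complex (links have fewer vertices).
record SimplicialComplex (V : Set) : Set₁ where
  field
    Face       : Pred (List V) 0ℓ
    downClosed : ∀ {σ τ} → σ ⊆ τ → Face τ → Face σ

  IsVertex : V → Set
  IsVertex v = Face (v ∷ [])

open SimplicialComplex using (Face; IsVertex)

HasDimension : ∀ {V} → SimplicialComplex V → ℕ → Set
HasDimension Δ d =
  (∃ λ σ → Face Δ σ × Unique σ × length σ ≡ suc d) ×
  (∀ σ → Face Δ σ → Unique σ → length σ ≤ suc d)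

ConnectedComplex : ∀ {V} → SimplicialComplex V → Set
ConnectedComplex Δ =
  ∀ u v → IsVertex Δ u → IsVertex Δ v → Star (λ a b → Face Δ (a ∷ b ∷ [])) u v

link : ∀ {V} → SimplicialComplex V → V → SimplicialComplex V
link Δ v = record
  { Face       = λ τ → Face Δ τ × v ∉ τ × Face Δ (v ∷ τ)
  ; downClosed = λ { σ⊆τ (τ∈Δ , v∉τ , vτ∈Δ) →
      downClosed σ⊆τ τ∈Δ , v∉τ ∘ σ⊆τ , downClosed (∷⁺ʳ v σ⊆τ) vτ∈Δ }
  }
  where open SimplicialComplex Δ using (downClosed)

-- HasDimension 1 contains the requirement that the link has an edge.
TwoDimensionalBuchsbaum : ∀ {V} → SimplicialComplex V → Set
TwoDimensionalBuchsbaum Δ =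
  HasDimension Δ 2 ×
  (∀ v → IsVertex Δ v → HasDimension (link Δ v) 1 × ConnectedComplex (link Δ v))

-- Unordered edges, each listed once with its smaller endpoint first; as the
-- last two fields are irrelevant, an edge is determined by its endpoints.
record Edge {n} (G : Graph (Fin n)) : Set where
  field
    source     : Fin n
    target     : Fin n
    .ordered   : source Fin.< target
    .adjacent  : Graph._~_ G source target

module _ {n} {G : Graph (Fin n)} where

  IsEndpointOf : Fin n → Edge G → Set
  IsEndpointOf u e = u ≡ Edge.source e ⊎ u ≡ Edge.target e

  ShareEndpoint : Rel (Edge G) 0ℓ
  ShareEndpoint e f = ∃ λ u → IsEndpointOf u e × IsEndpointOf u f

  IsMatching : Pred (List (Edge G)) 0ℓ
  IsMatching σ = ∀ {e f} → e ∈ σ → f ∈ σ → e ≢ f → ¬ ShareEndpoint e f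

M : ∀ {n} (G : Graph (Fin n)) → SimplicialComplex (Edge G)
M G = record
  { Face       = IsMatching
  ; downClosed = λ σ⊆τ τ-matching e∈σ f∈σ → τ-matching (σ⊆τ e∈σ) (σ⊆τ f∈σ)
  }

record Template : Set where
  field
    order    : ℕ
    required : List (Fin order × Fin order)
    optional : List (Fin order × Fin order)
    unfilled : List (Fin order)

Joins : ∀ {A : Set} → List (A × A) → Rel A 0ℓ
Joins es a b = (a , b) ∈ es ⊎ (b , a) ∈ es

record _∈ᶠ_ {V} (G : Graph V) (𝓣 : Template) : Set where
  open Graph G
  open Template 𝓣
  field
    extra    : ℕ
    vertices : (Fin order ⊎ Fin extra) ↔ V

  core : Fin order → V
  core = Inverse.to vertices ∘ inj₁

  new : Fin extra → V
  new = Inverse.to vertices ∘ inj₂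

  field
    core-required : ∀ a b → Joins required a b → core a ~ core b
    core-allowed  : ∀ a b → core a ~ core b → Joins required a b ⊎ Joins optional a b
    new-new       : ∀ i j → ¬ new i ~ new j
    new-core      : ∀ i a → new i ~ core a → a ∈ unfilled
    new-joined    : ∀ i → ∃ λ a → new i ~ core a

infix 4 _∈ᶠ_

module _ where
  private
    pattern x₁ = 0F
    pattern x₂ = 1F
    pattern x₃ = 2F
    pattern x₄ = 3F
    pattern x₅ = 4F

  𝓖₁ 𝓖₂ 𝓖₃ : Template
  𝓖₁ = record
    { order    = 5
    ; required = (x₁ , x₂) ∷ (x₂ , x₃) ∷ (x₃ , x₄) ∷ (x₄ , x₅) ∷ []
    ; optional = (x₁ , x₄) ∷ (x₂ , x₅) ∷ []
    ; unfilled = x₂ ∷ x₄ ∷ []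
    }
  𝓖₂ = record
    { order    = 5
    ; required = (x₁ , x₂) ∷ (x₂ , x₃) ∷ (x₁ , x₃) ∷ (x₃ , x₄) ∷ (x₄ , x₅) ∷ []
    ; optional = (x₁ , x₄) ∷ (x₂ , x₄) ∷ []
    ; unfilled = x₄ ∷ []
    }
  𝓖₃ = record
    { order    = 5
    ; required = (x₁ , x₂) ∷ (x₂ , x₃) ∷ (x₃ , x₄) ∷ (x₄ , x₅) ∷ (x₅ , x₁) ∷ []
    ; optional = (x₁ , x₃) ∷ (x₃ , x₅) ∷ (x₂ , x₅) ∷ (x₂ , x₄) ∷ (x₁ , x₄) ∷ []
    ; unfilled = []
    }

  -- Without optional edges and unfilled vertices the family consists of a
  -- single graph up to isomorphism.
  bowtie : Template
  bowtie = record
    { order    = 5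
    ; required = (x₁ , x₂) ∷ (x₂ , x₃) ∷ (x₁ , x₃) ∷ (x₃ , x₄) ∷ (x₄ , x₅) ∷ (x₃ , x₅) ∷ []
    ; optional = []
    ; unfilled = []
    }

module _ where
  private
    pattern g₁ = 0F
    pattern g₂ = 1F
    pattern g₃ = 2F
    pattern v₁ = 3F
    pattern v₂ = 4F
    pattern v₃ = 5F
    pattern v₄ = 6F
    pattern v₅ = 7F

  𝓑₁ 𝓑₂ 𝓑₃ 𝓑₄ 𝓑₅ 𝓑₆ : Template
  𝓑₁ = record
    { order    = 6
    ; required = (g₁ , v₁) ∷ (g₂ , v₂) ∷ (g₃ , v₃) ∷ []
    ; optional = []
    ; unfilled = g₁ ∷ g₂ ∷ g₃ ∷ []
    }
  𝓑₂ = record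
    { order    = 7
    ; required = (g₁ , v₁) ∷ (g₁ , v₃) ∷ (g₂ , v₁) ∷ (g₂ , v₂) ∷
                 (g₂ , v₃) ∷ (g₂ , v₄) ∷ (g₃ , v₂) ∷ (g₃ , v₄) ∷ []
    ; optional = []
    ; unfilled = g₁ ∷ g₂ ∷ g₃ ∷ []
    }
  𝓑₃ = record
    { order    = 7
    ; required = (g₁ , v₂) ∷ (v₂ , g₂) ∷ (g₂ , v₃) ∷ (v₃ , g₃) ∷ (g₃ , v₄) ∷
                 (v₄ , g₁) ∷ (v₁ , g₁) ∷ (v₁ , g₂) ∷ (v₁ , g₃) ∷ []
    ; optional = (g₁ , v₃) ∷ (g₂ , v₄) ∷ (g₃ , v₂) ∷ []
    ; unfilled = g₁ ∷ g₂ ∷ g₃ ∷ []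
    }
  𝓑₄ = record
    { order    = 8
    ; required = (g₁ , v₂) ∷ (v₂ , g₂) ∷ (g₂ , v₃) ∷ (v₃ , g₃) ∷ (g₃ , v₄) ∷
                 (v₄ , g₁) ∷ (g₁ , v₅) ∷ (g₂ , v₁) ∷ (g₃ , v₁) ∷ []
    ; optional = (g₁ , v₃) ∷ (g₂ , v₄) ∷ (g₃ , v₂) ∷ []
    ; unfilled = g₁ ∷ g₂ ∷ g₃ ∷ []
    }
  𝓑₅ = record
    { order    = 8
    ; required = (g₁ , v₁) ∷ (g₁ , v₂) ∷ (g₁ , v₃) ∷ (g₂ , v₁) ∷ (g₂ , v₃) ∷
                 (g₂ , v₅) ∷ (g₃ , v₃) ∷ (g₃ , v₄) ∷ (g₃ , v₅) ∷ []
    ; optional = (g₂ , v₂) ∷ (g₂ , v₄) ∷ (g₁ , v₅) ∷ (g₃ , v₁) ∷ []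
    ; unfilled = g₁ ∷ g₂ ∷ g₃ ∷ []
    }
  𝓑₆ = record
    { order    = 8
    ; required = (g₁ , v₁) ∷ (g₁ , v₂) ∷ (g₂ , v₂) ∷ (g₂ , v₃) ∷
                 (g₂ , v₅) ∷ (g₃ , v₅) ∷ (g₃ , v₄) ∷ []
    ; optional = (g₃ , v₂) ∷ (g₃ , v₃) ∷ (g₂ , v₄) ∷ []
    ; unfilled = g₁ ∷ g₂ ∷ g₃ ∷ []
    }

module _ where
  private
    pattern g  = 0F
    pattern v₁ = 1F
    pattern v₂ = 2F
    pattern v₃ = 3F
    pattern v₄ = 4F
    pattern v₅ = 5F
    pattern v₆ = 6F
    pattern v₇ = 7F

  𝓑₇ : Template
  𝓑₇ = record
    { order    = 8
    ; required = (v₁ , v₂) ∷ (v₂ , v₃) ∷ (v₁ , v₃) ∷ (g , v₁) ∷ (g , v₄) ∷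
                 (v₄ , v₅) ∷ (v₅ , v₆) ∷ (v₄ , v₆) ∷ (g , v₇) ∷ []
    ; optional = (g , v₂) ∷ (g , v₃) ∷ (g , v₅) ∷ (g , v₆) ∷ []
    ; unfilled = g ∷ []
    }

module _ where
  private
    pattern g₁ = 0F
    pattern g₂ = 1F
    pattern v₁ = 2F
    pattern v₂ = 3F
    pattern v₃ = 4F
    pattern v₄ = 5F
    pattern v₅ = 6F
    pattern v₆ = 7F

  𝓑₈ 𝓑₉ : Template
  𝓑₈ = record
    { order    = 8
    ; required = (v₁ , v₂) ∷ (v₂ , v₃) ∷ (v₁ , v₃) ∷ (g₁ , v₁) ∷
                 (g₁ , v₄) ∷ (g₁ , v₅) ∷ (g₂ , v₄) ∷ (g₂ , v₆) ∷ []
    ; optional = (g₁ , v₂) ∷ (g₁ , v₃) ∷ (g₂ , v₅) ∷ (g₁ , v₆) ∷ []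
    ; unfilled = g₁ ∷ g₂ ∷ []
    }
  𝓑₉ = record
    { order    = 8
    ; required = (v₁ , v₂) ∷ (v₂ , v₃) ∷ (v₁ , v₃) ∷ (g₁ , v₁) ∷ (g₂ , v₁) ∷
                 (g₁ , v₆) ∷ (g₂ , v₆) ∷ (g₁ , v₄) ∷ (g₂ , v₅) ∷ []
    ; optional = (g₂ , v₄) ∷ (g₁ , v₅) ∷ []
    ; unfilled = g₁ ∷ g₂ ∷ []
    }

-- The index is shifted: 𝓑 i is the (i + 1)-st of the families above.
𝓑 : Fin 9 → Template
𝓑 = lookup (𝓑₁ ∷ 𝓑₂ ∷ 𝓑₃ ∷ 𝓑₄ ∷ 𝓑₅ ∷ 𝓑₆ ∷ 𝓑₇ ∷ 𝓑₈ ∷ 𝓑₉ ∷ [])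

record PointedGraph : Set₁ where
  constructor pointed
  field
    {Vertex} : Set
    graph    : Graph Vertex
    point    : Vertex

-- G is, up to isomorphism, obtained from the disjoint union of the graphs in
-- Hs by identifying their points (and nothing else).
record IsGluing {V k} (Hs : Vec PointedGraph k) (G : Graph V) : Set where
  open Graph G
  private
    module H (i : Fin k) = PointedGraph (lookup Hs i)
  field
    base          : V
    embed         : ∀ i → H.Vertex i → V
    embed-inj     : ∀ i → Injective _≡_ _≡_ (embed i)
    embed-point   : ∀ i → embed i (H.point i) ≡ base
    embed-overlap : ∀ i j a b → i ≢ j → embed i a ≡ embed j b → embed i a ≡ base
    embed-cover   : ∀ v → ∃ λ i → ∃ λ a → embed i a ≡ v
    adjacency     : ∀ u v → u ~ v ⇔
      (∃ λ i → ∃ λ a → ∃ λ b →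
        embed i a ≡ u × embed i b ≡ v × Graph._~_ (H.graph i) a b)

-- K₄ and C₄ are vertex-transitive, so the choice of the point is immaterial.
E₁ E₂ : ∀ {V} → Graph V → Set
E₁ = IsGluing (pointed (K 4) zero ∷ pointed (K 4) zero ∷ [])
E₂ = IsGluing (pointed (K 4) zero ∷ pointed C₄ zero ∷ [])

data Petal : Set where
  triangle : Fin 3 → Petal
  star     : (n : ℕ) → 2 ≤ n → (leaf : Fin n) → Petal

petal : Petal → PointedGraph
petal (triangle v)    = pointed (K 3) v
petal (star n _ leaf) = pointed (S n) (suc leaf)

𝓑-P : ∀ {V} → Graph V → Set
𝓑-P G = ∃ λ p → ∃ λ q → ∃ λ r → IsGluing (petal p ∷ petal q ∷ petal r ∷ []) G

𝓑-C₇ : ∀ {n} → Graph (Fin n) → Set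
𝓑-C₇ G = NoIsolatedVertices G × G Contains C₇ × TwoDimensionalBuchsbaum (M G)

TriangleOrStar : ∀ {V} → Graph V → Set
TriangleOrStar G = G ≅ K 3 ⊎ ∃ λ n → 1 ≤ n × G ≅ S n

BowtieOr𝓖 : ∀ {V} → Graph V → Set
BowtieOr𝓖 G = G ∈ᶠ bowtie ⊎ G ∈ᶠ 𝓖₁ ⊎ G ∈ᶠ 𝓖₂ ⊎ G ∈ᶠ 𝓖₃

ThreeSmallComponents : ∀ {V} → Graph V → Set
ThreeSmallComponents G = ∃ λ (c : Components G 3) →
  ∀ i → TriangleOrStar (Components.component c i)

-- Components may be numbered in either order, so which one comes first is no
-- restriction.
SmallAndLargeComponent : ∀ {V} → Graph V → Set
SmallAndLargeComponent G = ∃ λ (c : Components G 2) →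
  TriangleOrStar (Components.component c 0F) × BowtieOr𝓖 (Components.component c 1F)

{-# OPTIONS --safe #-}
module Submission where

-- The link of an edge e in M G is one-dimensional and connected iff every matching
-- containing e extends to three edges, none has more, and the edges disjoint from
-- e do not all lie on the four vertices of a 4-cycle: two edges of the link
-- without a path between them, together with edges disjoint from them, would form
-- such a 4-cycle.
--
-- If these conditions hold, start from a 3-matching, whose complement is an
-- independent set, and ask successively whether given vertices are adjacent and
-- whether they have neighbours not yet considered.  After finitely many questions
-- one condition is violated, a 7-cycle has appeared, or G is known up to optional
-- edges and further vertices joined to unfilled ones, and belongs to a family.
-- This case distinction, found by a computer search, is the derivation below; that
-- it is correct and complete is checked by evaluation.
--
-- Conversely, in a member of a family the conditions depend on the core only and
-- are checked by evaluation.  In petal graphs and graphs with three components, two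
-- edges in the same triangle or star always meet, and no 4-cycle exists.

open import Defs
open import Axiom.UniquenessOfIdentityProofs using (module Decidable⇒UIP)
open import Data.Bool using (Bool; true; false; _∧_; _∨_; not; T)
open import Data.Bool.ListAction using (all; any)
open import Data.Bool.Properties using (T-∧; T-∨; T-irrelevant)
open import Data.Empty using (⊥; ⊥-elim)
open import Data.Fin using (Fin; zero; suc; toℕ; _↑ˡ_; _↑ʳ_)
import Data.Fin as Fin
open import Data.Fin.Patterns
import Data.Fin.Properties as Fin
open import Data.List using (List; []; _∷_; length; map; allFin; upTo; filterᵇ; _++_; cartesianProduct)
import Data.List as List
open import Data.List.Membership.DecPropositional using () renaming (_∈?_ to member?)
open import Data.List.Membership.Propositional using (_∈_; _∉_; find)
import Data.List.Membership.Propositional.Properties as ∈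
import Data.List.Properties as List
open import Data.List.Relation.Unary.All as All using (All; []; _∷_)
import Data.List.Relation.Unary.All.Properties as All
open import Data.List.Relation.Unary.AllPairs as AllPairs using (AllPairs; []; _∷_)
import Data.List.Relation.Unary.AllPairs.Properties as AllPairs
open import Data.List.Relation.Unary.Any as Any using (Any; here; there)
open import Data.List.Relation.Unary.Unique.Propositional using (Unique)
open import Data.Maybe using (Maybe; just; nothing)
open import Data.Nat using (ℕ; zero; suc; _+_; _≤_; _<_; z≤n; s≤s; _≡ᵇ_; _<ᵇ_; NonZero)
import Data.Nat as ℕ
open import Data.Nat.DivMod using (_/_; _%_)
import Data.Nat.Properties as ℕ
open import Data.Product using (_×_; _,_; ∃; proj₁; proj₂; swap; uncurry)
import Data.Product as Product
import Data.Product.Properties as Product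
open import Data.Sum using (_⊎_; inj₁; inj₂; [_,_]′)
import Data.Sum as Sum
open import Data.Unit using (tt)
open import Data.Vec using (Vec; []; _∷_; lookup)
open import Function using (_∘_; id; _∋_; _⇔_; mk⇔; _↔_; mk↔ₛ′; Inverse; Equivalence; Injective)
open import Function.Properties.Inverse using (↔-sym; ↔-trans)
open import Level using (0ℓ)
open import Relation.Binary using (Rel; Symmetric; tri<; tri≈; tri>; DecidableEquality)
open import Relation.Binary.Construct.Closure.ReflexiveTransitive using (Star; ε; _◅_; _◅◅_)
import Relation.Binary.Construct.Closure.ReflexiveTransitive as Star
open import Relation.Binary.PropositionalEquality
  using (_≡_; _≢_; refl; sym; trans; cong; cong₂; subst; subst₂; ≢-sym)
open import Relation.Nullary using (¬_; Dec; yes; no)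
open import Relation.Nullary.Decidable
  using (⌊_⌋; True; False; map′; toWitness; fromWitness; toWitnessFalse; fromWitnessFalse; T?; recompute;
         decidable-stable; ¬?; _×-dec_; _⊎-dec_; _→-dec_)
open import Relation.Unary using (Pred; Irrelevant; Decidable)

-- Matchings

-- The families are infinite in two directions, and each half of the proof makes them finite in its
-- own way. In the derivation `closed` and `separate` speak about all unnamed vertices at once; as
-- the complement of a 3-matching is independent, facts about finitely many names then control every
-- edge. In the converse all further vertices share one trace, and the edges left beside a matching
-- are only bounded, by the required edges from below and the possible edges from above. The checks
-- are monotone in these bounds, so one evaluation covers every choice of optional edges and further
-- vertices. A 7-cycle may end a branch because `𝓑-C₇` is itself defined by the Buchsbaum property.
-- The conditions are stated for lists of vertex pairs over any vertex type and for any `d`, because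
-- they are also needed for a single component: its vertices form a subset, and there `d` is 2,
-- since the small component supplies the third edge.

Disjoint : ∀ {V : Set} → Rel (V × V) 0ℓ
Disjoint (a , b) (c , d) = (a ≢ c × a ≢ d) × (b ≢ c × b ≢ d)

disjoint-sym : ∀ {V : Set} → Symmetric (Disjoint {V})
disjoint-sym ((p , q) , (r , s)) = (≢-sym p , ≢-sym r) , (≢-sym q , ≢-sym s)

disjoint-swapˡ : ∀ {V : Set} {e f : V × V} → Disjoint e f → Disjoint (swap e) f
disjoint-swapˡ = swap

disjoint-swapʳ : ∀ {V : Set} {e f : V × V} → Disjoint e f → Disjoint e (swap f)
disjoint-swapʳ (p , q) = swap p , swap q

disjoint? : ∀ {V : Set} → DecidableEquality V → (e f : V × V) → Dec (Disjoint e f)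
disjoint? _≟_ (a , b) (c , d) =
  (¬? (a ≟ c) ×-dec ¬? (a ≟ d)) ×-dec (¬? (b ≟ c) ×-dec ¬? (b ≟ d))

data Ends {V : Set} : V → V → V × V → Set where
  fwd : ∀ {a b} → Ends a b (a , b)
  bwd : ∀ {a b} → Ends b a (a , b)

ends-unique : ∀ {V : Set} {e : V × V} {x y x′ y′} → Ends x y e → Ends x′ y′ e → x ≡ x′ ⊎ x ≡ y′
ends-unique fwd fwd = inj₁ refl
ends-unique fwd bwd = inj₂ refl
ends-unique bwd fwd = inj₂ refl
ends-unique bwd bwd = inj₁ refl

ends-disjoint : ∀ {V : Set} {e f : V × V} {x y z w} → Ends x y e → Ends z w f → Disjoint e f → Disjoint (x , y) (z , w)
ends-disjoint fwd fwd d = d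
ends-disjoint fwd bwd d = disjoint-swapʳ d
ends-disjoint bwd fwd d = disjoint-swapˡ d
ends-disjoint bwd bwd d = disjoint-swapˡ (disjoint-swapʳ d)

ends-swap : ∀ {V : Set} {e : V × V} {x y} → Ends x y e → Ends y x e
ends-swap fwd = bwd
ends-swap bwd = fwd

ends-reverse : ∀ {V : Set} {e : V × V} {x y} → Ends x y e → Ends (proj₁ e) (proj₂ e) (x , y)
ends-reverse fwd = fwd
ends-reverse bwd = bwd

avoid-ends : ∀ {V : Set} {u x y : V} e → Ends x y e → u ≢ x → u ≢ y → u ≢ proj₁ e × u ≢ proj₂ e
avoid-ends _ fwd p q = p , q
avoid-ends _ bwd p q = q , p

common : ∀ {V : Set} → DecidableEquality V → {e f : V × V} → ¬ Disjoint e f →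
         ∃ λ x → ∃ λ y → ∃ λ z → Ends x y e × Ends x z f
common _≟_ {a , b} {c , d} ¬# with a ≟ c | a ≟ d | b ≟ c | b ≟ d
... | yes refl | _ | _ | _ = _ , _ , _ , fwd , fwd
... | _ | yes refl | _ | _ = _ , _ , _ , fwd , bwd
... | _ | _ | yes refl | _ = _ , _ , _ , bwd , fwd
... | _ | _ | _ | yes refl = _ , _ , _ , bwd , bwd
... | no p | no q | no r | no s = ⊥-elim (¬# ((p , q) , (r , s)))

module _ {V : Set} (G : Graph V) where
  open Graph G

  Adjacent : Pred (V × V) 0ℓ
  Adjacent (a , b) = a ~ b

  Matching : Pred (List (V × V)) 0ℓ
  Matching es = All Adjacent es × AllPairs Disjoint es

  -- Neighbours are distinct by irreflexivity; the two disjointness fields add `a ≢ c` and `b ≢ d`,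
  -- in the form in which matchings use them.
  record FourCycle (a b c d : V) : Set where
    constructor fourCycle
    field
      ab : a ~ b
      bc : b ~ c
      cd : c ~ d
      da : d ~ a
      ab#cd : Disjoint (a , b) (c , d)
      bc#da : Disjoint (b , c) (d , a)

  -- For d = 3 this says that M G is a two-dimensional Buchsbaum complex: the
  -- link of an edge is pure of dimension one, and such a matching complex is
  -- disconnected only if all its edges lie on the four vertices of a 4-cycle.
  record Buchsbaum (d : ℕ) : Set where
    field
      bounded : ∀ es → Matching es → length es ≤ d
      extend  : ∀ es → Matching es → length es < d → ∃ λ f → Matching (f ∷ es)
      escape  : ∀ es → Matching es → 2 + length es ≡ d →
                ∀ {a b c d} → FourCycle a b c d →
                All (Disjoint (a , b)) es → All (Disjoint (c , d)) es →
                ∃ λ u → ∃ λ v → u ~ v × All (Disjoint (u , v)) es ×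
                  (u ≢ a × u ≢ b) × (u ≢ c × u ≢ d)

  ends-adjacent : ∀ {x y e} → Ends x y e → Adjacent e → x ~ y
  ends-adjacent fwd = λ a → a
  ends-adjacent bwd = ~-sym

  ~⇒≢ : ∀ {u v} → u ~ v → u ≢ v
  ~⇒≢ u~v u≡v = ~-irrefl u≡v u~v

-- Faces of `M G` as matchings of vertex pairs

module EdgeMatchings {n} (G : Graph (Fin n)) where
  open Graph G
  open Edge

  -- The field `adjacent` is irrelevant, so a usable proof has to be recomputed from the
  -- decidability of `_~_`.
  source~target : (e : Edge G) → source e ~ target e
  source~target record { source = s ; target = t ; adjacent = a } = recompute (s ~? t) a

  endpoints : Edge G → Fin n × Fin n
  endpoints e = source e , target e

  _≟ᵉ_ : (e f : Edge G) → Dec (e ≡ f)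
  e ≟ᵉ f with source e Fin.≟ source f | target e Fin.≟ target f
  ... | yes refl | yes refl = yes refl
  ... | no s≢    | _        = no (s≢ ∘ cong source)
  ... | _        | no t≢    = no (t≢ ∘ cong target)

  Disjointᵉ : Rel (Edge G) 0ℓ
  Disjointᵉ e f = Disjoint (endpoints e) (endpoints f)

  disjoint⇒¬share : ∀ e f → Disjointᵉ e f → ¬ ShareEndpoint e f
  disjoint⇒¬share e f ((p , q) , (r , s)) (u , inj₁ refl , inj₁ x) = p x
  disjoint⇒¬share e f ((p , q) , (r , s)) (u , inj₁ refl , inj₂ x) = q x
  disjoint⇒¬share e f ((p , q) , (r , s)) (u , inj₂ refl , inj₁ x) = r x
  disjoint⇒¬share e f ((p , q) , (r , s)) (u , inj₂ refl , inj₂ x) = s x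

  ¬share⇒disjoint : ∀ e f → ¬ ShareEndpoint e f → Disjointᵉ e f
  ¬share⇒disjoint e f ¬s =
    ((λ p → ¬s (_ , inj₁ refl , inj₁ p)) , (λ p → ¬s (_ , inj₁ refl , inj₂ p))) ,
    ((λ p → ¬s (_ , inj₂ refl , inj₁ p)) , (λ p → ¬s (_ , inj₂ refl , inj₂ p)))

  disjoint⇒≢ : ∀ e f → Disjointᵉ e f → e ≢ f
  disjoint⇒≢ e f ((p , _) , _) refl = p refl

  private
    variable
      σ : List (Edge G)

  disjoint⇒isMatching : AllPairs Disjointᵉ σ → IsMatching σ
  disjoint⇒isMatching (e# ∷ #s) (here refl) (here refl) e≢e = ⊥-elim (e≢e refl)
  disjoint⇒isMatching (e# ∷ #s) {e} {f} (here refl) (there f∈) _ =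
    disjoint⇒¬share e f (All.lookup e# f∈)
  disjoint⇒isMatching (e# ∷ #s) {e} {f} (there e∈) (here refl) _ =
    disjoint⇒¬share e f (disjoint-sym (All.lookup e# e∈))
  disjoint⇒isMatching (e# ∷ #s) (there e∈) (there f∈) = disjoint⇒isMatching #s e∈ f∈

  isMatching⇒disjoint : Unique σ → IsMatching σ → AllPairs Disjointᵉ σ
  isMatching⇒disjoint [] _ = []
  isMatching⇒disjoint {e ∷ _} (e≢ ∷ u) m =
    All.tabulate (λ {f} f∈ → ¬share⇒disjoint e f (m (here refl) (there f∈) (All.lookup e≢ f∈))) ∷
    isMatching⇒disjoint u (λ p q → m (there p) (there q))

  disjoint⇒unique : AllPairs Disjointᵉ σ → Unique σ
  disjoint⇒unique = AllPairs.map (λ {e} {f} → disjoint⇒≢ e f)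

  pairs-matching : AllPairs Disjointᵉ σ → Matching G (map endpoints σ)
  pairs-matching {σ} #s = All.map⁺ (All.universal source~target σ) , AllPairs.map⁺ #s

  record EdgeOn (u v : Fin n) : Set where
    field
      edge     : Edge G
      oriented : Ends u v (endpoints edge)

  edgeOn : ∀ {u v} → u ~ v → EdgeOn u v
  edgeOn {u} {v} u~v with Fin.<-cmp u v
  ... | tri< u<v _ _ = record
    { edge = record { source = u ; target = v ; ordered = u<v ; adjacent = u~v } ; oriented = fwd }
  ... | tri≈ _ u≡v _ = ⊥-elim (~⇒≢ G u~v u≡v)
  ... | tri> _ _ v<u = record
    { edge = record { source = v ; target = u ; ordered = v<u ; adjacent = ~-sym u~v } ; oriented = bwd }

  disjoint-edgeOn : ∀ {u v} f (o : EdgeOn u v) → Disjoint (u , v) f → Disjoint (endpoints (EdgeOn.edge o)) f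
  disjoint-edgeOn f o = ends-disjoint (ends-reverse (EdgeOn.oriented o)) fwd

  disjoint-edgeOn⁻ : ∀ {u v} f (o : EdgeOn u v) → Disjoint (endpoints (EdgeOn.edge o)) f → Disjoint (u , v) f
  disjoint-edgeOn⁻ f o = ends-disjoint (EdgeOn.oriented o) fwd

  -- The last component strengthens the induction: it carries disjointness from the remaining pairs
  -- over to the edges already chosen on them.
  edgesOn : ∀ {es} → Matching G es →
            ∃ λ σ → length σ ≡ length es × AllPairs Disjointᵉ σ ×
              (∀ {f} → All (Disjoint f) es → All (λ e → Disjoint f (endpoints e)) σ)
  edgesOn {[]} _ = [] , refl , [] , λ _ → []
  edgesOn {(u , v) ∷ es} (u~v ∷ a , d ∷ ds) with edgesOn (a , ds) | edgeOn u~v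
  ... | σ , len , #s , lift | o =
    EdgeOn.edge o ∷ σ , cong suc len ,
    All.map (λ {f} → disjoint-edgeOn (endpoints f) o) (lift d) ∷ #s ,
    λ { {f} (p ∷ ps) → disjoint-sym (disjoint-edgeOn f o (disjoint-sym p)) ∷ lift ps }

  Link : Edge G → Rel (Edge G) 0ℓ
  Link e f g = SimplicialComplex.Face (link (M G) e) (f ∷ g ∷ [])

  -- Faces may repeat an edge, so every vertex of the link is linked to itself; hence the proviso
  -- `f ≢ g`.
  link-disjoint : ∀ e f g → Link e f g →
    Disjointᵉ e f × Disjointᵉ e g × (f ≢ g → Disjointᵉ f g)
  link-disjoint e f g (fg , e∉ , efg) =
    ¬share⇒disjoint e f (efg (here refl) (there (here refl)) (λ { refl → e∉ (here refl) })) ,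
    ¬share⇒disjoint e g (efg (here refl) (there (there (here refl))) (λ { refl → e∉ (there (here refl)) })) ,
    λ f≢g → ¬share⇒disjoint f g (fg (here refl) (there (here refl)) f≢g)

  disjoint-link : ∀ e f g → Disjointᵉ e f → Disjointᵉ e g → Disjointᵉ f g → Link e f g
  disjoint-link e f g e#f e#g f#g =
    disjoint⇒isMatching ((f#g ∷ []) ∷ [] ∷ []) ,
    (λ { (here refl) → disjoint⇒≢ e f e#f refl ; (there (here refl)) → disjoint⇒≢ e g e#g refl }) ,
    disjoint⇒isMatching ((e#f ∷ e#g ∷ []) ∷ (f#g ∷ []) ∷ [] ∷ [])

  vertex-disjoint : ∀ e f → SimplicialComplex.IsVertex (link (M G) e) f → Disjointᵉ e f
  vertex-disjoint e f (_ , e∉ , ef) =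
    ¬share⇒disjoint e f (ef (here refl) (there (here refl)) (λ { refl → e∉ (here refl) }))

  disjoint-vertex : ∀ e f → Disjointᵉ e f → SimplicialComplex.IsVertex (link (M G) e) f
  disjoint-vertex e f e#f =
    disjoint⇒isMatching ([] ∷ []) , (λ { (here refl) → disjoint⇒≢ e f e#f refl }) ,
    disjoint⇒isMatching ((e#f ∷ []) ∷ [] ∷ [])

  isVertex : ∀ e → SimplicialComplex.IsVertex (M G) e
  isVertex e = disjoint⇒isMatching ([] ∷ [])

  -- Because of the loops in `Link` a path can stay at `f` for some steps; these are skipped.
  first-step : ∀ {e f g} → Star (Link e) f g → f ≢ g → ∃ λ h → Link e f h × f ≢ h
  first-step ε f≢g = ⊥-elim (f≢g refl)
  first-step {f = f} (_◅_ {j = h} s ss) f≢g with f ≟ᵉ h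
  ... | yes refl = first-step ss f≢g
  ... | no f≢h   = h , s , f≢h

module _ {n} (G : Graph (Fin n)) where
  open Graph G
  open EdgeMatchings G
  open Edge

  private
    _#?_ : (e f : Fin n × Fin n) → Dec (Disjoint e f)
    _#?_ = disjoint? Fin._≟_

  -- Necessity of the conditions

  module FromComplex (Δ : TwoDimensionalBuchsbaum (M G)) where

    bounded : ∀ es → Matching G es → length es ≤ 3
    bounded es m with edgesOn m
    ... | σ , len , #s , _ = subst (_≤ 3) len (proj₂ (proj₁ Δ) σ (disjoint⇒isMatching #s) (disjoint⇒unique #s))

    link-edge : (e : Edge G) → ∃ λ g → ∃ λ h → Disjointᵉ e g × Disjointᵉ e h × Disjointᵉ g h
    link-edge e with proj₁ (proj₁ (proj₂ Δ e (isVertex e)))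
    ... | g ∷ h ∷ [] , face , (g≢h ∷ []) ∷ _ , refl with link-disjoint e g h face
    ...   | e#g , e#h , g#h = g , h , e#g , e#h , g#h g≢h

    link-connected : ∀ e f g → Disjointᵉ e f → Disjointᵉ e g → Star (Link e) f g
    link-connected e f g e#f e#g =
      proj₂ (proj₂ Δ e (isVertex e)) f g (disjoint-vertex e f e#f) (disjoint-vertex e g e#g)

    -- Purity follows from connectedness: the link of `e` has an edge, hence a vertex other than
    -- `f`, and a path from `f` to it must leave `f` along an edge of the link.
    third : ∀ e f → Disjointᵉ e f → ∃ λ g → Disjointᵉ e g × Disjointᵉ f g
    third e f e#f with link-edge e
    ... | g , h , e#g , e#h , g#h = from-step (other (f ≟ᵉ g))
      where
      other : Dec (f ≡ g) → ∃ λ k → Disjointᵉ e k × f ≢ k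
      other (yes refl) = h , e#h , disjoint⇒≢ g h g#h
      other (no f≢g)   = g , e#g , f≢g

      from-step : (∃ λ k → Disjointᵉ e k × f ≢ k) → ∃ λ k → Disjointᵉ e k × Disjointᵉ f k
      from-step (k , e#k , f≢k) with first-step (link-connected e f k e#f e#k) f≢k
      ... | l , fl , f≢l with link-disjoint e f l fl
      ...   | _ , e#l , f#l = l , e#l , f#l f≢l

    extend : ∀ es → Matching G es → length es < 3 → ∃ λ f → Matching G (f ∷ es)
    extend [] _ _ with proj₁ (proj₁ Δ)
    ... | e ∷ _ , _ = endpoints e , source~target e ∷ [] , [] ∷ []
    extend ((u , v) ∷ []) (u~v ∷ [] , _) _ with edgeOn u~v
    ... | o with link-edge (EdgeOn.edge o)
    ...   | g , _ , e#g , _ =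
      endpoints g , source~target g ∷ u~v ∷ [] ,
      (disjoint-sym (disjoint-edgeOn⁻ (endpoints g) o e#g) ∷ []) ∷ [] ∷ []
    extend ((u , v) ∷ (w , x) ∷ []) (u~v ∷ w~x ∷ [] , (uv#wx ∷ []) ∷ _) _ with edgeOn u~v | edgeOn w~x
    ... | o | p with third (EdgeOn.edge o) (EdgeOn.edge p)
                       (disjoint-edgeOn (endpoints (EdgeOn.edge p)) o
                         (disjoint-sym (disjoint-edgeOn (u , v) p (disjoint-sym uv#wx))))
    ...   | g , e#g , f#g =
      endpoints g , source~target g ∷ u~v ∷ w~x ∷ [] ,
      (disjoint-sym (disjoint-edgeOn⁻ (endpoints g) o e#g) ∷
       disjoint-sym (disjoint-edgeOn⁻ (endpoints g) p f#g) ∷ []) ∷ (uv#wx ∷ []) ∷ [] ∷ []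
    extend (_ ∷ _ ∷ _ ∷ _) _ (s≤s (s≤s (s≤s ())))

    Escape : Fin n × Fin n → (a b c d u v : Fin n) → Set
    Escape e a b c d u v = u ~ v × All (Disjoint (u , v)) (e ∷ []) × (u ≢ a × u ≢ b) × (u ≢ c × u ≢ d)

    escape? : ∀ e a b c d → Dec (∃ λ u → ∃ λ v → Escape e a b c d u v)
    escape? e a b c d = Fin.any? λ u → Fin.any? λ v →
      (u ~? v) ×-dec All.all? ((u , v) #?_) (e ∷ []) ×-dec
      ((¬? (u Fin.≟ a) ×-dec ¬? (u Fin.≟ b)) ×-dec (¬? (u Fin.≟ c) ×-dec ¬? (u Fin.≟ d)))

    -- Without an escaping edge, the only neighbour of ab in the link is cd and
    -- vice versa, so no path leads from ab to bc.
    module Trapped {e : Edge G} {a b c d} (cyc : FourCycle G a b c d)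
      (trapped : ¬ ∃ λ u → ∃ λ v → Escape (endpoints e) a b c d u v) where
      open FourCycle cyc

      OnCycle : Fin n → Set
      OnCycle u = (u ≡ a ⊎ u ≡ b) ⊎ (u ≡ c ⊎ u ≡ d)

      onCycle : ∀ {u v} → u ~ v → Disjoint (u , v) (endpoints e) → OnCycle u
      onCycle {u} {v} u~v uv#e with (u Fin.≟ a ⊎-dec u Fin.≟ b) ⊎-dec (u Fin.≟ c ⊎-dec u Fin.≟ d)
      ... | yes p = p
      ... | no ¬p = ⊥-elim (trapped (u , v , u~v , uv#e ∷ [] ,
              (¬p ∘ inj₁ ∘ inj₁ , ¬p ∘ inj₁ ∘ inj₂) , (¬p ∘ inj₂ ∘ inj₁ , ¬p ∘ inj₂ ∘ inj₂)))

      Side : Fin n × Fin n → Set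
      Side f = Ends a b f ⊎ Ends c d f

      same-side : ∀ {x y u v} → u ~ v → u ≡ x ⊎ u ≡ y → v ≡ x ⊎ v ≡ y → Ends x y (u , v)
      same-side u~v (inj₁ refl) (inj₁ refl) = ⊥-elim (~⇒≢ G u~v refl)
      same-side u~v (inj₁ refl) (inj₂ refl) = fwd
      same-side u~v (inj₂ refl) (inj₁ refl) = bwd
      same-side u~v (inj₂ refl) (inj₂ refl) = ⊥-elim (~⇒≢ G u~v refl)

      off-side : ∀ {x y u : Fin n} f → Ends x y f → u ≢ proj₁ f × u ≢ proj₂ f → ¬ (u ≡ x ⊎ u ≡ y)
      off-side _ fwd (p , q) = [ p , q ]′
      off-side _ bwd (p , q) = [ q , p ]′

      opposite : ∀ {f u v} → Side f → u ~ v → Disjoint (u , v) f → OnCycle u → OnCycle v → Side (u , v)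
      opposite s u~v _ (inj₁ p) (inj₁ q) = inj₁ (same-side u~v p q)
      opposite s u~v _ (inj₂ p) (inj₂ q) = inj₂ (same-side u~v p q)
      opposite {f} (inj₁ ab⁺) _ (u# , _) (inj₁ p) (inj₂ _) = ⊥-elim (off-side f ab⁺ u# p)
      opposite {f} (inj₁ ab⁺) _ (_ , v#) (inj₂ _) (inj₁ q) = ⊥-elim (off-side f ab⁺ v# q)
      opposite {f} (inj₂ cd⁺) _ (_ , v#) (inj₁ _) (inj₂ q) = ⊥-elim (off-side f cd⁺ v# q)
      opposite {f} (inj₂ cd⁺) _ (u# , _) (inj₂ p) (inj₁ _) = ⊥-elim (off-side f cd⁺ u# p)

      side-step : ∀ f g → Side (endpoints f) → Link e f g → Side (endpoints g)
      side-step f g s fg with f ≟ᵉ g | link-disjoint e f g fg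
      ... | yes refl | _ = s
      ... | no f≢g | _ , e#g , f#g = opposite s (source~target g) (disjoint-sym (f#g f≢g))
              (onCycle (source~target g) (disjoint-sym e#g))
              (onCycle (~-sym (source~target g)) (disjoint-swapˡ (disjoint-sym e#g)))

      side-path : ∀ {f g} → Star (Link e) f g → Side (endpoints f) → Side (endpoints g)
      side-path ε s = s
      side-path {f} (_◅_ {j = h} st sts) s = side-path sts (side-step f h s st)

      ¬side-bc : ∀ {f} → Ends b c f → ¬ Side f
      ¬side-bc bc⁺ (inj₁ ab⁺) = [ ~⇒≢ G ab , proj₁ (proj₁ ab#cd) ]′ (ends-unique ab⁺ bc⁺)
      ¬side-bc bc⁺ (inj₂ cd⁺) = [ ≢-sym (proj₂ (proj₂ ab#cd)) , ≢-sym (~⇒≢ G cd) ]′ (ends-unique (ends-swap cd⁺) bc⁺)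

      contradiction : All (Disjoint (a , b)) (endpoints e ∷ []) → All (Disjoint (c , d)) (endpoints e ∷ []) → ⊥
      contradiction (((a≢s , a≢t) , (b≢s , b≢t)) ∷ []) (((c≢s , c≢t) , _) ∷ []) = finish (edgeOn ab) (edgeOn bc)
        where
        finish : EdgeOn a b → EdgeOn b c → ⊥
        finish o p = ¬side-bc (EdgeOn.oriented p)
          (side-path (link-connected e (EdgeOn.edge o) (EdgeOn.edge p)
            (disjoint-sym (disjoint-edgeOn (endpoints e) o ((a≢s , a≢t) , (b≢s , b≢t))))
            (disjoint-sym (disjoint-edgeOn (endpoints e) p ((b≢s , b≢t) , (c≢s , c≢t)))))
            (inj₁ (EdgeOn.oriented o)))

    buchsbaum : Buchsbaum G 3
    buchsbaum = record { bounded = bounded ; extend = extend ; escape = escape }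
      where
      escape : ∀ es → Matching G es → 2 + length es ≡ 3 →
               ∀ {a b c d} → FourCycle G a b c d →
               All (Disjoint (a , b)) es → All (Disjoint (c , d)) es →
               ∃ λ u → ∃ λ v → u ~ v × All (Disjoint (u , v)) es × (u ≢ a × u ≢ b) × (u ≢ c × u ≢ d)
      escape ((x , y) ∷ []) (x~y ∷ [] , _) refl {a} {b} {c} {d} cyc (ab# ∷ []) (cd# ∷ [])
        with escape? (x , y) a b c d
      ... | yes p = p
      ... | no trapped = ⊥-elim (Trapped.contradiction {e = EdgeOn.edge o} cyc trapped′
              (disjoint-sym (disjoint-edgeOn (a , b) o (disjoint-sym ab#)) ∷ [])
              (disjoint-sym (disjoint-edgeOn (c , d) o (disjoint-sym cd#)) ∷ []))
        where
        o : EdgeOn x y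
        o = edgeOn x~y

        trapped′ : ¬ ∃ λ u → ∃ λ v → Escape (endpoints (EdgeOn.edge o)) a b c d u v
        trapped′ (u , v , u~v , uv#e ∷ [] , out) =
          trapped (u , v , u~v , disjoint-sym (disjoint-edgeOn⁻ (u , v) o (disjoint-sym uv#e)) ∷ [] , out)

  -- Sufficiency of the conditions

  module ToComplex (B : Buchsbaum G 3) where
    open Buchsbaum B

    extendᵉ : ∀ σ → AllPairs Disjointᵉ σ → length σ < 3 → ∃ λ f → AllPairs Disjointᵉ (f ∷ σ)
    extendᵉ σ #s len with extend (map endpoints σ) (pairs-matching #s) (subst (_< 3) (sym (List.length-map endpoints σ)) len)
    ... | (u , v) , u~v ∷ _ , uv# ∷ _ = EdgeOn.edge (edgeOn u~v) ,
      All.map (λ {e} → disjoint-edgeOn (endpoints e) (edgeOn u~v)) (All.map⁻ uv#) ∷ #s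

    bounded′ : ∀ σ → IsMatching σ → Unique σ → length σ ≤ 3
    bounded′ σ m u = subst (_≤ 3) (List.length-map endpoints σ)
      (bounded (map endpoints σ) (pairs-matching (isMatching⇒disjoint u m)))

    three : ∃ λ σ → IsMatching σ × Unique σ × length σ ≡ 3
    three with extendᵉ [] [] (s≤s z≤n)
    ... | e , p with extendᵉ (e ∷ []) p (s≤s (s≤s z≤n))
    ...   | f , q with extendᵉ (f ∷ e ∷ []) q (s≤s (s≤s (s≤s z≤n)))
    ...     | g , r = g ∷ f ∷ e ∷ [] , disjoint⇒isMatching r , disjoint⇒unique r , refl

    third : ∀ e f → Disjointᵉ e f → ∃ λ g → Disjointᵉ g e × Disjointᵉ g f
    third e f e#f with extendᵉ (e ∷ f ∷ []) ((e#f ∷ []) ∷ [] ∷ []) (s≤s (s≤s (s≤s z≤n)))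
    ... | g , (g#e ∷ g#f ∷ []) ∷ _ = g , g#e , g#f

    link-dimension : ∀ e → HasDimension (link (M G) e) 1
    link-dimension e with extendᵉ (e ∷ []) ([] ∷ []) (s≤s (s≤s z≤n))
    ... | f , (f#e ∷ []) ∷ _ with third e f (disjoint-sym f#e)
    ...   | g , g#e , g#f =
      (f ∷ g ∷ [] , disjoint-link e f g (disjoint-sym f#e) (disjoint-sym g#e) (disjoint-sym g#f) ,
       disjoint⇒unique ((disjoint-sym g#f ∷ []) ∷ [] ∷ []) , refl) ,
      λ σ (_ , e∉σ , eσ) u → ℕ.≤-pred (bounded′ (e ∷ σ) eσ (All.tabulate (λ f∈ → λ { refl → e∉σ f∈ }) ∷ u))

    module Connectivity (e : Edge G) where

      Linked : Rel (Edge G) 0ℓ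
      Linked = Star (Link e)

      step : ∀ f g → Disjointᵉ e f → Disjointᵉ e g → Disjointᵉ f g → Linked f g
      step f g e#f e#g f#g = disjoint-link e f g e#f e#g f#g ◅ ε

      -- f and f′ are disjoint, so an edge with one end outside f ∪ f′ misses one of them.
      miss : ∀ f f′ {u v} → Disjointᵉ f f′ →
             (u ≢ source f × u ≢ target f) × (u ≢ source f′ × u ≢ target f′) →
             Disjoint (u , v) (endpoints f) ⊎ Disjoint (u , v) (endpoints f′)
      miss f f′ {u} {v} f#f′ (u∉f , u∉f′) with v Fin.≟ source f | v Fin.≟ target f
      ... | no v≢s   | no v≢t   = inj₁ (u∉f , (v≢s , v≢t))
      ... | yes refl | _        = inj₂ (u∉f′ , proj₁ f#f′)
      ... | no _     | yes refl = inj₂ (u∉f′ , proj₂ f#f′)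

      module _ (f g f′ g′ : Edge G)
        (e#f : Disjointᵉ e f) (e#g : Disjointᵉ e g) (e#f′ : Disjointᵉ e f′) (e#g′ : Disjointᵉ e g′)
        (f#f′ : Disjointᵉ f f′) (g#g′ : Disjointᵉ g g′) where

        through-h : ∀ h → Disjointᵉ e h →
          Disjoint (endpoints h) (endpoints f) ⊎ Disjoint (endpoints h) (endpoints f′) →
          Disjoint (endpoints h) (endpoints g) ⊎ Disjoint (endpoints h) (endpoints g′) → Linked f g
        through-h h e#h p q = from-f p ◅◅ to-g q
          where
          from-f : Disjointᵉ h f ⊎ Disjointᵉ h f′ → Linked f h
          from-f (inj₁ h#f)  = step f h e#f e#h (disjoint-sym h#f)
          from-f (inj₂ h#f′) = step f f′ e#f e#f′ f#f′ ◅◅ step f′ h e#f′ e#h (disjoint-sym h#f′)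

          to-g : Disjointᵉ h g ⊎ Disjointᵉ h g′ → Linked h g
          to-g (inj₁ h#g)  = step h g e#h e#g h#g
          to-g (inj₂ h#g′) = step h g′ e#h e#g′ h#g′ ◅◅ step g′ g e#g′ e#g (disjoint-sym g#g′)

        through-edge : ∀ {u v} → u ~ v → Disjoint (u , v) (endpoints e) →
          Disjoint (u , v) (endpoints f) ⊎ Disjoint (u , v) (endpoints f′) →
          Disjoint (u , v) (endpoints g) ⊎ Disjoint (u , v) (endpoints g′) → Linked f g
        through-edge u~v uv#e p q =
          through-h (EdgeOn.edge o) (disjoint-sym (disjoint-edgeOn (endpoints e) o uv#e)) (lift {f} {f′} p) (lift {g} {g′} q)
          where
          o : EdgeOn _ _
          o = edgeOn u~v
          lift : ∀ {k l} → Disjoint _ (endpoints k) ⊎ Disjoint _ (endpoints l) →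
                 Disjointᵉ (EdgeOn.edge o) k ⊎ Disjointᵉ (EdgeOn.edge o) l
          lift {k} (inj₁ d) = inj₁ (disjoint-edgeOn (endpoints k) o d)
          lift {_} {l} (inj₂ d) = inj₂ (disjoint-edgeOn (endpoints l) o d)

      -- Both edges have partners `f′` and `g′` in the link. If one of `f`, `f′` is disjoint from
      -- one of `g`, `g′`, a path of at most three steps results. Otherwise these edges are
      -- `f = pq`, `g = pr`, `f′ = rs` and `g′ = qs`, and `p`, `q`, `s`, `r` form a 4-cycle. The
      -- edge given by `escape` has one end off the cycle, so it misses one of `f`, `f′` and one of
      -- `g`, `g′`, and the path runs through it.
      linked : ∀ f g → Disjointᵉ e f → Disjointᵉ e g → Linked f g
      linked f g e#f e#g with third e f e#f | third e g e#g
      ... | f′ , f′#e , f′#f | g′ , g′#e , g′#g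
        with endpoints f #? endpoints g | endpoints f′ #? endpoints g
           | endpoints g′ #? endpoints f | endpoints f′ #? endpoints g′
      ... | yes f#g | _ | _ | _ = step f g e#f e#g f#g
      ... | _ | yes f′#g | _ | _ =
        step f f′ e#f (disjoint-sym f′#e) (disjoint-sym f′#f) ◅◅ step f′ g (disjoint-sym f′#e) e#g f′#g
      ... | _ | _ | yes g′#f | _ =
        step f g′ e#f (disjoint-sym g′#e) (disjoint-sym g′#f) ◅◅ step g′ g (disjoint-sym g′#e) e#g g′#g
      ... | _ | _ | _ | yes f′#g′ =
        step f f′ e#f (disjoint-sym f′#e) (disjoint-sym f′#f) ◅◅
        step f′ g′ (disjoint-sym f′#e) (disjoint-sym g′#e) f′#g′ ◅◅
        step g′ g (disjoint-sym g′#e) e#g g′#g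
      ... | no f∩g | no f′∩g | no g′∩f | no f′∩g′ with common Fin._≟_ f∩g
      ...   | p , q , r , fpq , gpr = around
              (second f fpq f′#f gpr (common Fin._≟_ f′∩g)) (second g gpr g′#g fpq (common Fin._≟_ g′∩f))
        where
        second : ∀ f {f′ g p q r} → Ends p q (endpoints f) → Disjoint f′ (endpoints f) → Ends p r g →
                 (∃ λ x → ∃ λ y → ∃ λ z → Ends x y f′ × Ends x z g) → ∃ λ s → Ends r s f′
        second f fpq f′#f gpr (x , s , y , f′xs , gxy) with ends-unique gxy gpr
        ... | inj₁ refl = ⊥-elim (proj₁ (proj₁ (ends-disjoint f′xs fpq f′#f)) refl)
        ... | inj₂ refl = s , f′xs

        around : (∃ λ s → Ends r s (endpoints f′)) → (∃ λ t → Ends q t (endpoints g′)) → Linked f g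
        around (s , f′rs) (t , g′qt) with common Fin._≟_ f′∩g′
        ... | x , y , z , f′xy , g′xz with ends-unique f′xy f′rs | ends-unique g′xz g′qt
        ...   | inj₁ refl | _ = ⊥-elim (proj₂ (proj₁ (ends-disjoint g′xz gpr g′#g)) refl)
        ...   | _ | inj₁ refl = ⊥-elim (proj₂ (proj₁ (ends-disjoint f′xy fpq f′#f)) refl)
        ...   | inj₂ refl | inj₂ refl
          with escape (endpoints e ∷ []) (source~target e ∷ [] , [] ∷ []) refl
                 (fourCycle (ends-adjacent G fpq (source~target f)) (ends-adjacent G g′qt (source~target g′))
                   (~-sym (ends-adjacent G f′rs (source~target f′)))
                   (~-sym (ends-adjacent G gpr (source~target g)))
                   (disjoint-swapʳ (disjoint-sym (ends-disjoint f′rs fpq f′#f)))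
                   (disjoint-swapʳ (ends-disjoint g′qt gpr g′#g)))
                 (ends-disjoint fpq fwd (disjoint-sym e#f) ∷ [])
                 (disjoint-swapˡ (ends-disjoint f′rs fwd f′#e) ∷ [])
        ...     | u , v , u~v , uv#e ∷ [] , (u≢p , u≢q) , (u≢s , u≢r) =
          through-edge f g f′ g′ e#f e#g (disjoint-sym f′#e) (disjoint-sym g′#e)
            (disjoint-sym f′#f) (disjoint-sym g′#g) u~v uv#e
            (miss f f′ (disjoint-sym f′#f) (avoid-ends (endpoints f) fpq u≢p u≢q , avoid-ends (endpoints f′) f′rs u≢r u≢s))
            (miss g g′ (disjoint-sym g′#g) (avoid-ends (endpoints g) gpr u≢p u≢r , avoid-ends (endpoints g′) g′qt u≢q u≢s))

    twoDimensionalBuchsbaum : TwoDimensionalBuchsbaum (M G)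
    twoDimensionalBuchsbaum = (three , bounded′) , λ e _ →
      link-dimension e , λ f g fv gv → Connectivity.linked e f g (vertex-disjoint e f fv) (vertex-disjoint e g gv)

-- Derivations

infix 6 _separating_
-- A template allows a new vertex to be joined to any of the unfilled vertices. In disjoint unions
-- and in petal graphs a new vertex must not connect two parts, and `apart` lists the pairs that
-- would do so.
record Target : Set where
  constructor _separating_
  open Template
  field
    template : Template
    apart    : List (Fin (order template) × Fin (order template))

-- Membership in the family of a template, up to the choice of a numbering of
-- the new vertices; no new vertex is joined to both members of a pair in apart.
record Fits {V : Set} (G : Graph V) (𝓣 : Target) : Set where
  open Graph G
  open Target 𝓣
  open Template template
  field
    core          : Fin order → V
    core-inj      : Injective _≡_ _≡_ core
    core-required : ∀ a b → Joins required a b → core a ~ core b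
    core-allowed  : ∀ a b → core a ~ core b → Joins required a b ⊎ Joins optional a b

  Fresh : V → Set
  Fresh w = ∀ a → core a ≢ w

  field
    fresh-core  : ∀ {w} → Fresh w → ∀ a → w ~ core a → a ∈ unfilled
    fresh-fresh : ∀ {w x} → Fresh w → Fresh x → ¬ w ~ x
    separated   : ∀ {w} → Fresh w → All (λ (a , b) → w ~ core a → ¬ w ~ core b) apart

-- A fact about named vertices 0, 1, …: closed u says that all neighbours of u
-- are named, and separate u v that no unnamed vertex is adjacent to both.
data Fact : Set where
  edge nonedge separate : ℕ → ℕ → Fact
  closed                : ℕ → Fact

-- A derivation that every graph with Buchsbaum G 3 satisfying certain facts
-- contains a 7-cycle or fits a target.  A vertex found by outer? or common?, an
-- unnamed neighbour of u or of both u and v, gets the next name.  The leaf stuck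
-- contradicts extend (e and f do not extend to a 3-matching), and square
-- contradicts escape (all edges disjoint from e lie on the 4-cycle a b c d).  The
-- 3-matching m at a leaf shows that unnamed vertices are pairwise nonadjacent.
data Tree : Set where
  edge?     : (u v : ℕ) (if-yes if-no : Tree) → Tree
  outer?    : (u : ℕ) (if-yes if-no : Tree) → Tree
  common?   : (u v : ℕ) (if-yes if-no : Tree) → Tree
  matching₄ : List (ℕ × ℕ) → Tree
  cycle₇    : List ℕ → Tree
  stuck     : (e f : ℕ × ℕ) (m : List (ℕ × ℕ)) → Tree
  square    : (e : ℕ × ℕ) (a b c d : ℕ) (m : List (ℕ × ℕ)) → Tree
  fits      : (t : ℕ) (names : List ℕ) (m : List (ℕ × ℕ)) → Tree
  lemma     : (i : ℕ) (names : List ℕ) → Tree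

-- A situation that recurs up to renaming is derived once. It may mention fewer names than the place
-- where it is applied.
record Lemma : Set where
  constructor ⟨_,_⟩⊢_
  field
    size  : ℕ
    facts : List Fact
    proof : Tree

_==_ : Fact → Fact → Bool
edge u v     == edge u′ v′     = (u ≡ᵇ u′) ∧ (v ≡ᵇ v′)
nonedge u v  == nonedge u′ v′  = (u ≡ᵇ u′) ∧ (v ≡ᵇ v′)
separate u v == separate u′ v′ = (u ≡ᵇ u′) ∧ (v ≡ᵇ v′)
closed u     == closed u′      = u ≡ᵇ u′
_            == _              = false

flip : Fact → Fact
flip (edge u v)     = edge v u
flip (nonedge u v)  = nonedge v u
flip (separate u v) = separate v u
flip (closed u)     = closed u

_⊢_ : List Fact → Fact → Bool
Γ ⊢ f = any (λ g → (g == f) ∨ (g == flip f)) Γ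

infix 7 _⊢_

member : ℕ → List ℕ → Bool
member i = any (i ≡ᵇ_)

nth : ∀ {A : Set} → A → List A → ℕ → A
nth d []       _       = d
nth d (x ∷ xs) zero    = x
nth d (x ∷ xs) (suc i) = nth d xs i

distinct : List ℕ → Bool
distinct []       = true
distinct (x ∷ xs) = not (member x xs) ∧ distinct xs

renames : ℕ → ℕ → List ℕ → Bool
renames m k φ = (length φ ≡ᵇ m) ∧ distinct φ ∧ all (_<ᵇ k) φ

outsideOf : ℕ → List ℕ → List ℕ
outsideOf k φ = filterᵇ (λ i → not (member i φ)) (upTo k)

indexDisjoint : ℕ × ℕ → ℕ × ℕ → Bool
indexDisjoint (a , b) (c , d) = (not (a ≡ᵇ c) ∧ not (a ≡ᵇ d)) ∧ (not (b ≡ᵇ c) ∧ not (b ≡ᵇ d))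

matching : List Fact → List (ℕ × ℕ) → Bool
matching Γ []             = true
matching Γ ((u , v) ∷ es) = Γ ⊢ edge u v ∧ all (indexDisjoint (u , v)) es ∧ matching Γ es

-- All edges between the complements of ys and of ys ++ xs are excluded.
noEdge : ℕ → List Fact → (ys xs : List ℕ) → Bool
noEdge k Γ ys xs = all (λ j → Γ ⊢ closed j ∧
  all (λ i → (i ≡ᵇ j) ∨ (Γ ⊢ nonedge i j)) (outsideOf k (ys ++ xs))) (outsideOf k ys)

-- Restricting the names to `φ` turns the omitted ones into unnamed vertices, so these have to be
-- excluded as neighbours one by one.
closedFor : ℕ → List Fact → List ℕ → ℕ → Bool
closedFor k Γ φ u = Γ ⊢ closed u ∧ all (λ e → Γ ⊢ nonedge e u) (outsideOf k φ)

separateFor : ℕ → List Fact → List ℕ → ℕ → ℕ → Bool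
separateFor k Γ φ u v = Γ ⊢ separate u v ∧
  all (λ e → (Γ ⊢ nonedge e u) ∨ (Γ ⊢ nonedge e v)) (outsideOf k φ)

transfers : ℕ → List Fact → List ℕ → ℕ → Fact → Bool
transfers k Γ φ m (edge u v)     = ((u <ᵇ m) ∧ (v <ᵇ m)) ∧ (Γ ⊢ edge (nth 0 φ u) (nth 0 φ v))
transfers k Γ φ m (nonedge u v)  = ((u <ᵇ m) ∧ (v <ᵇ m)) ∧ (Γ ⊢ nonedge (nth 0 φ u) (nth 0 φ v))
transfers k Γ φ m (separate u v) = ((u <ᵇ m) ∧ (v <ᵇ m)) ∧ separateFor k Γ φ (nth 0 φ u) (nth 0 φ v)
transfers k Γ φ m (closed u)     = (u <ᵇ m) ∧ closedFor k Γ φ (nth 0 φ u)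

applies : ℕ → List Fact → ℕ → List ℕ → List Lemma → Bool
applies k Γ i       φ []       = false
applies k Γ zero    φ (L ∷ Ls) = renames (Lemma.size L) k φ ∧ all (transfers k Γ φ (Lemma.size L)) (Lemma.facts L)
applies k Γ (suc i) φ (L ∷ Ls) = applies k Γ i φ Ls

joined : ∀ {m} → List (Fin m × Fin m) → Fin m → Fin m → Bool
joined es a b = any (λ (c , d) → (⌊ a Fin.≟ c ⌋ ∧ ⌊ b Fin.≟ d ⌋) ∨ (⌊ a Fin.≟ d ⌋ ∧ ⌊ b Fin.≟ c ⌋)) es

module _ (𝓣 : Target) (k : ℕ) (Γ : List Fact) (φ : List ℕ) (m : List (ℕ × ℕ)) where
  open Target 𝓣 renaming (apart to separations)
  open Template template

  private
    name : Fin order → ℕ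
    name = nth 0 φ ∘ toℕ

  fitsTarget : Bool
  fitsTarget =
    (renames order k φ ∧ (length m ≡ᵇ 3) ∧ matching Γ m ∧
     -- The 3-matching must lie inside the core: then an edge between two vertices off the core,
     -- named or not, would be a fourth matching edge.
     all (λ (u , v) → member u φ ∧ member v φ) m) ∧
    all (λ (a , b) → Γ ⊢ edge (name a) (name b)) required ∧
    all (λ a → all (λ b → ⌊ a Fin.≟ b ⌋ ∨ joined required a b ∨ joined optional a b ∨
                          (Γ ⊢ nonedge (name a) (name b))) (allFin order)) (allFin order) ∧
    all (λ a → any (λ c → ⌊ a Fin.≟ c ⌋) unfilled ∨ closedFor k Γ φ (name a)) (allFin order) ∧
    all (λ (a , b) → separateFor k Γ φ (name a) (name b)) separations

fitsNth : ℕ → List Fact → ℕ → List ℕ → List (ℕ × ℕ) → List Target → Bool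
fitsNth k Γ t       φ m []       = false
fitsNth k Γ zero    φ m (𝓣 ∷ 𝓣s) = fitsTarget 𝓣 k Γ φ m
fitsNth k Γ (suc t) φ m (𝓣 ∷ 𝓣s) = fitsNth k Γ t φ m 𝓣s

cycleEdges : List ℕ → List (ℕ × ℕ)
cycleEdges φ = map (λ i → nth 0 φ i , nth 0 φ (suc i % 7)) (upTo 7)

-- Naming a vertex leaves fewer unnamed ones, so all facts persist. A closed vertex is moreover not
-- adjacent to the new one; what `separate` says about the new vertex is a disjunction, which is not
-- a `Fact`.
name-next : ℕ → List Fact → List Fact
name-next k []             = []
name-next k (closed c ∷ Γ) = closed c ∷ nonedge c k ∷ name-next k Γ
name-next k (f ∷ Γ)        = f ∷ name-next k Γ

module _ (𝓣s : List Target) where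

  check : List Lemma → ℕ → List Fact → Tree → Bool
  check Ls k Γ (edge? u v y n)   =
    ((u <ᵇ k) ∧ (v <ᵇ k)) ∧ check Ls k (edge u v ∷ Γ) y ∧ check Ls k (nonedge u v ∷ Γ) n
  check Ls k Γ (outer? u y n)    =
    (u <ᵇ k) ∧ check Ls (suc k) (edge u k ∷ name-next k Γ) y ∧ check Ls k (closed u ∷ Γ) n
  check Ls k Γ (common? u v y n) =
    ((u <ᵇ k) ∧ (v <ᵇ k)) ∧ check Ls (suc k) (edge u k ∷ edge v k ∷ name-next k Γ) y ∧
    check Ls k (separate u v ∷ Γ) n
  check Ls k Γ (matching₄ m)     = (3 <ᵇ length m) ∧ matching Γ m
  check Ls k Γ (cycle₇ φ)        = renames 7 k φ ∧ all (λ (u , v) → Γ ⊢ edge u v) (cycleEdges φ)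
  check Ls k Γ (stuck e f m)     =
    matching Γ (e ∷ f ∷ []) ∧ ((length m ≡ᵇ 3) ∧ matching Γ m) ∧
    noEdge k Γ (proj₁ e ∷ proj₂ e ∷ proj₁ f ∷ proj₂ f ∷ []) []
  check Ls k Γ (square e a b c d m) =
    (matching Γ (e ∷ (a , b) ∷ (c , d) ∷ []) ∧ matching Γ ((b , c) ∷ (d , a) ∷ [])) ∧
    ((length m ≡ᵇ 3) ∧ matching Γ m) ∧
    noEdge k Γ (proj₁ e ∷ proj₂ e ∷ []) (a ∷ b ∷ c ∷ d ∷ [])
  check Ls k Γ (fits t φ m)      = fitsNth k Γ t φ m 𝓣s
  check Ls k Γ (lemma i φ)       = applies k Γ i φ Ls

  -- The lemmas already verified are listed backwards, so that lemma 0 is the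
  -- preceding one.
  verify : List Lemma → List Lemma → ℕ → List Fact → Tree → Bool
  verify Ls []        k Γ t = check Ls k Γ t
  verify Ls (L ∷ Ls′) k Γ t =
    check Ls (Lemma.size L) (Lemma.facts L) (Lemma.proof L) ∧ verify (L ∷ Ls) Ls′ k Γ t

-- Soundness of derivations

∧⁻ : ∀ {x y} → T (x ∧ y) → T x × T y
∧⁻ = Equivalence.to T-∧

∨⁻ : ∀ {x y} → T (x ∨ y) → T x ⊎ T y
∨⁻ = Equivalence.to T-∨

not⁻ : ∀ {x} → T (not x) → ¬ T x
not⁻ {false} _ ()

all⁻ : ∀ {A : Set} (p : A → Bool) xs → T (all p xs) → All (T ∘ p) xs
all⁻ p []       _ = []
all⁻ p (x ∷ xs) t = proj₁ (∧⁻ {p x} t) ∷ all⁻ p xs (proj₂ (∧⁻ {p x} t))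

any⁻ : ∀ {A : Set} (p : A → Bool) xs → T (any p xs) → Any (T ∘ p) xs
any⁻ p (x ∷ xs) t = [ here , there ∘ any⁻ p xs ]′ (∨⁻ {p x} t)

any⁺ : ∀ {A : Set} (p : A → Bool) {xs} → Any (T ∘ p) xs → T (any p xs)
any⁺ p {x ∷ xs} (here px) = Equivalence.from (T-∨ {p x}) (inj₁ px)
any⁺ p {x ∷ xs} (there a) = Equivalence.from (T-∨ {p x}) (inj₂ (any⁺ p a))

≡ᵇ⇒≢ : ∀ {i j} → T (not (i ≡ᵇ j)) → i ≢ j
≡ᵇ⇒≢ {i} t refl = not⁻ t (ℕ.≡⇒≡ᵇ i i refl)

in-range : ∀ {u v k} → T ((u <ᵇ k) ∧ (v <ᵇ k)) → u < k × v < k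
in-range {u} {v} {k} t with ∧⁻ {u <ᵇ k} t
... | u< , v< = ℕ.<ᵇ⇒< u k u< , ℕ.<ᵇ⇒< v k v<

==⇒≡ : ∀ f g → T (f == g) → f ≡ g
==⇒≡ (edge u v) (edge u′ v′) t with ∧⁻ {u ≡ᵇ u′} t
... | p , q = cong₂ edge (ℕ.≡ᵇ⇒≡ u u′ p) (ℕ.≡ᵇ⇒≡ v v′ q)
==⇒≡ (nonedge u v) (nonedge u′ v′) t with ∧⁻ {u ≡ᵇ u′} t
... | p , q = cong₂ nonedge (ℕ.≡ᵇ⇒≡ u u′ p) (ℕ.≡ᵇ⇒≡ v v′ q)
==⇒≡ (separate u v) (separate u′ v′) t with ∧⁻ {u ≡ᵇ u′} t
... | p , q = cong₂ separate (ℕ.≡ᵇ⇒≡ u u′ p) (ℕ.≡ᵇ⇒≡ v v′ q)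
==⇒≡ (closed u) (closed u′) t = cong closed (ℕ.≡ᵇ⇒≡ u u′ t)

member⁻ : ∀ i xs → T (member i xs) → i ∈ xs
member⁻ i xs t = Any.map (λ {x} → ℕ.≡ᵇ⇒≡ i x) (any⁻ (i ≡ᵇ_) xs t)

member⁺ : ∀ {i xs} → i ∈ xs → T (member i xs)
member⁺ {i} i∈ = any⁺ (i ≡ᵇ_) (Any.map (λ {x} → ℕ.≡⇒≡ᵇ i x) i∈)

∈-outsideOf : ∀ {k xs i} → i < k → i ∉ xs → i ∈ outsideOf k xs
∈-outsideOf {k} {xs} {i} i<k i∉xs =
  ∈.∈-filter⁺ (λ i → T? (not (member i xs))) (∈.∈-upTo⁺ i<k) (notMember (member i xs) refl)
  where
  notMember : ∀ b → member i xs ≡ b → T (not b)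
  notMember false _ = tt
  notMember true  p = ⊥-elim (i∉xs (member⁻ i xs (subst T (sym p) tt)))

nth-∈ : ∀ {A : Set} {d : A} xs {i} → i < length xs → nth d xs i ∈ xs
nth-∈ (x ∷ xs) {zero}  _         = here refl
nth-∈ (x ∷ xs) {suc i} (s≤s i<n) = there (nth-∈ xs i<n)

nth-injective : ∀ {A : Set} {d : A} {xs} → AllPairs _≢_ xs → ∀ {i j} → i < length xs → j < length xs →
                nth d xs i ≡ nth d xs j → i ≡ j
nth-injective (_ ∷ _) {zero} {zero} _ _ _ = refl
nth-injective {xs = _ ∷ xs} (x≢ ∷ _) {zero}  {suc j} _ (s≤s j<n) p = ⊥-elim (All.lookup x≢ (nth-∈ xs j<n) p)
nth-injective {xs = _ ∷ xs} (x≢ ∷ _) {suc i} {zero}  (s≤s i<n) _ p = ⊥-elim (All.lookup x≢ (nth-∈ xs i<n) (sym p))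
nth-injective (_ ∷ ≢s) {suc i} {suc j} (s≤s i<n) (s≤s j<n) p = cong suc (nth-injective ≢s i<n j<n p)

distinct⁻ : ∀ xs → T (distinct xs) → AllPairs _≢_ xs
distinct⁻ [] _ = []
distinct⁻ (x ∷ xs) t with ∧⁻ {not (member x xs)} t
... | x∉ , ds = All.tabulate (λ { y∈ refl → not⁻ x∉ (member⁺ y∈) }) ∷ distinct⁻ xs ds

∈-nth : ∀ {φ x} → x ∈ φ → ∃ λ i → i < length φ × nth 0 φ i ≡ x
∈-nth (here refl) = 0 , s≤s z≤n , refl
∈-nth (there x∈) with ∈-nth x∈
... | i , i<n , eq = suc i , s≤s i<n , eq

record Renaming (m k : ℕ) (φ : List ℕ) : Set where
  field
    size      : length φ ≡ m
    bounded   : ∀ {i} → i < m → nth 0 φ i < k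
    injective : ∀ {i j} → i < m → j < m → nth 0 φ i ≡ nth 0 φ j → i ≡ j
    covers    : ∀ {x} → x ∈ φ → ∃ λ i → i < m × nth 0 φ i ≡ x

renames⁻ : ∀ {m k} φ → T (renames m k φ) → Renaming m k φ
renames⁻ {m} {k} φ t with ∧⁻ {length φ ≡ᵇ m} t
... | len , t′ with ∧⁻ {distinct φ} t′ | ℕ.≡ᵇ⇒≡ (length φ) m len
...   | dis , bnd | refl = record
  { size      = refl
  ; bounded   = λ i<m → ℕ.<ᵇ⇒< _ k (All.lookup (all⁻ (_<ᵇ k) φ bnd) (nth-∈ φ i<m))
  ; injective = nth-injective (distinct⁻ φ dis)
  ; covers    = ∈-nth
  }

joined⁻ : ∀ {m} (es : List (Fin m × Fin m)) a b → T (joined es a b) → Joins es a b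
joined⁻ ((c , d) ∷ es) a b t with ∨⁻ {(⌊ a Fin.≟ c ⌋ ∧ ⌊ b Fin.≟ d ⌋) ∨ (⌊ a Fin.≟ d ⌋ ∧ ⌊ b Fin.≟ c ⌋)} t
... | inj₂ t′ = Sum.map there there (joined⁻ es a b t′)
... | inj₁ t′ with ∨⁻ {⌊ a Fin.≟ c ⌋ ∧ ⌊ b Fin.≟ d ⌋} t′
...   | inj₁ p = inj₁ (here (cong₂ _,_ (toWitness (proj₁ (∧⁻ {⌊ a Fin.≟ c ⌋} p))) (toWitness (proj₂ (∧⁻ {⌊ a Fin.≟ c ⌋} p)))))
...   | inj₂ p = inj₂ (here (cong₂ _,_ (toWitness (proj₂ (∧⁻ {⌊ a Fin.≟ d ⌋} p))) (toWitness (proj₁ (∧⁻ {⌊ a Fin.≟ d ⌋} p)))))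

module Soundness {n} (G : Graph (Fin n)) (B : Buchsbaum G 3) (𝓣s : List Target) where
  open Graph G
  open Buchsbaum B

  private
    V : Set
    V = Fin n

  Conclusion : Set
  Conclusion = G Contains C₇ ⊎ Any (Fits G) 𝓣s

  module _ (k : ℕ) (ρ : ℕ → V) where

    Named Unnamed : V → Set
    Named w   = ∃ λ i → i < k × ρ i ≡ w
    Unnamed w = ¬ Named w

    -- The assignment `ρ` is total and its value at `k` is overwritten when the next vertex is
    -- named, so every fact carries the bounds on its names.
    ⟦_⟧ : Fact → Set
    ⟦ edge u v ⟧     = (u < k × v < k) × ρ u ~ ρ v
    ⟦ nonedge u v ⟧  = (u < k × v < k) × ¬ ρ u ~ ρ v
    ⟦ separate u v ⟧ = (u < k × v < k) × (∀ w → Unnamed w → w ~ ρ u → ¬ w ~ ρ v)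
    ⟦ closed u ⟧     = u < k × (∀ w → Unnamed w → ¬ w ~ ρ u)

    Injectiveρ : Set
    Injectiveρ = ∀ {i j} → i < k → j < k → ρ i ≡ ρ j → i ≡ j

  Valid : ℕ → List Fact → Set
  Valid k Γ = ∀ ρ → Injectiveρ k ρ → All ⟦ k , ρ ⟧′ Γ → Conclusion
    where
    ⟦_,_⟧′ : (k : ℕ) (ρ : ℕ → V) → Fact → Set
    ⟦ k , ρ ⟧′ = ⟦_⟧ k ρ

  ValidLemma : Lemma → Set
  ValidLemma L = Valid (Lemma.size L) (Lemma.facts L)

  module State (k : ℕ) (ρ : ℕ → V) (inj : Injectiveρ k ρ) {Γ : List Fact} (Γ-true : All (⟦_⟧ k ρ) Γ) where

    named? : ∀ w → Dec (Named k ρ w)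
    named? w = ℕ.anyUpTo? (λ i → ρ i Fin.≟ w) k

    name : ℕ × ℕ → V × V
    name = Product.map ρ ρ

    flip-true : ∀ f → ⟦_⟧ k ρ (flip f) → ⟦_⟧ k ρ f
    flip-true (edge u v)     ((p , q) , r) = (q , p) , ~-sym r
    flip-true (nonedge u v)  ((p , q) , r) = (q , p) , r ∘ ~-sym
    flip-true (separate u v) ((p , q) , r) = (q , p) , λ w o wu wv → r w o wv wu
    flip-true (closed u)     r             = r

    ⊢⇒true : ∀ {f} → T (Γ ⊢ f) → ⟦_⟧ k ρ f
    ⊢⇒true {f} t with Any.lookup (any⁻ _ Γ t) | All.lookupAny Γ-true (any⁻ _ Γ t)
    ... | g | tg , t′ = from {g} tg (∨⁻ {g == f} t′)
      where
      from : ∀ {g} → ⟦_⟧ k ρ g → T (g == f) ⊎ T (g == flip f) → ⟦_⟧ k ρ f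
      from {g} tg (inj₁ p) = subst (⟦_⟧ k ρ) (==⇒≡ g f p) tg
      from {g} tg (inj₂ p) = flip-true f (subst (⟦_⟧ k ρ) (==⇒≡ g (flip f) p) tg)

    apart-disjoint : ∀ {a b c d} → a < k → b < k → c < k → d < k → T (indexDisjoint (a , b) (c , d)) →
                     Disjoint (ρ a , ρ b) (ρ c , ρ d)
    apart-disjoint {a} {b} {c} {d} a< b< c< d< t with ∧⁻ {not (a ≡ᵇ c) ∧ not (a ≡ᵇ d)} t
    ... | p , q with ∧⁻ {not (a ≡ᵇ c)} p | ∧⁻ {not (b ≡ᵇ c)} q
    ...   | ac , ad | bc , bd =
      (≡ᵇ⇒≢ ac ∘ inj a< c< , ≡ᵇ⇒≢ {a} ad ∘ inj a< d<) , (≡ᵇ⇒≢ bc ∘ inj b< c< , ≡ᵇ⇒≢ {b} bd ∘ inj b< d<)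

    matching-sound : ∀ m → T (matching Γ m) → Matching G (map name m) × All (λ (u , v) → u < k × v < k) m
    matching-sound [] _ = ([] , []) , []
    matching-sound ((u , v) ∷ m) t with ∧⁻ {Γ ⊢ edge u v} t
    ... | uv , t′ with ∧⁻ {all (indexDisjoint (u , v)) m} t′
    ...   | ap , t″ with matching-sound m t″ | ⊢⇒true uv
    ...     | (adj , dis) , bnd | (u< , v<) , u~v =
      (u~v ∷ adj , All.map⁺ (All.zipWith (λ { ((x< , y<) , p) → apart-disjoint u< v< x< y< p })
                              (bnd , all⁻ (indexDisjoint (u , v)) m ap)) ∷ dis) ,
      (u< , v<) ∷ bnd

    -- An edge avoiding all ends of a 3-matching would contradict `bounded`.
    off-matching : ∀ m → length m ≡ 3 → T (matching Γ m) → ∀ {w x} →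
      All (λ (u , v) → (w ≢ ρ u × w ≢ ρ v) × (x ≢ ρ u × x ≢ ρ v)) m → ¬ w ~ x
    off-matching m len t {w} {x} off w~x with matching-sound m t
    ... | (adj , dis) , _ = ℕ.<-irrefl refl
      (subst (λ l → suc l ≤ 3) (trans (List.length-map name m) len)
        (bounded ((w , x) ∷ map name m) (w~x ∷ adj , All.map⁺ off ∷ dis)))

    unnamed-apart : ∀ m → T ((length m ≡ᵇ 3) ∧ matching Γ m) → ∀ {w x} →
      Unnamed k ρ w → Unnamed k ρ x → ¬ w ~ x
    unnamed-apart m t {w} {x} ow ox with ∧⁻ {length m ≡ᵇ 3} t
    ... | len , t′ = off-matching m (ℕ.≡ᵇ⇒≡ (length m) 3 len) t′
      (All.map (λ { (u< , v<) → (fresh ow u< , fresh ow v<) , (fresh ox u< , fresh ox v<) })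
               (proj₂ (matching-sound m t′)))
      where
      fresh : ∀ {w i} → Unnamed k ρ w → i < k → w ≢ ρ i
      fresh o i< refl = o (_ , i< , refl)

    -- Two unnamed ends are excluded by the 3-matching, an edge with one named end because that end
    -- is closed, and only pairs of named ends need an explicit nonedge.
    noEdge-sound : ∀ m → T ((length m ≡ᵇ 3) ∧ matching Γ m) → ∀ ys xs → T (noEdge k Γ ys xs) →
      ∀ {u v} → All (λ i → u ≢ ρ i) (ys ++ xs) → All (λ i → v ≢ ρ i) ys → ¬ u ~ v
    noEdge-sound m tm ys xs t {u} {v} u∉ v∉ u~v with named? u | named? v
    ... | no ou | no ov = unnamed-apart m tm ou ov u~v
    ... | yes (i , i< , refl) | no ov =
      proj₂ (⊢⇒true (proj₁ (∧⁻ (All.lookup (all⁻ _ (outsideOf k ys) t)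
        (∈-outsideOf {xs = ys} i< (λ i∈ → All.lookup u∉ (∈.∈-++⁺ˡ {xs = ys} {ys = xs} i∈) refl)))))) v ov (~-sym u~v)
    ... | no ou | yes (j , j< , refl) =
      proj₂ (⊢⇒true (proj₁ (∧⁻ (All.lookup (all⁻ _ (outsideOf k ys) t)
        (∈-outsideOf j< (λ j∈ → All.lookup v∉ j∈ refl)))))) u ou u~v
    ... | yes (i , i< , refl) | yes (j , j< , refl)
      with ∨⁻ {i ≡ᵇ j} (All.lookup (all⁻ _ (outsideOf k (ys ++ xs))
             (proj₂ (∧⁻ {Γ ⊢ closed j} (All.lookup (all⁻ _ (outsideOf k ys) t)
               (∈-outsideOf j< (λ j∈ → All.lookup v∉ j∈ refl))))))
             (∈-outsideOf i< (λ i∈ → All.lookup u∉ i∈ refl)))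
    ...   | inj₁ i≡j = ~⇒≢ G u~v (cong ρ (ℕ.≡ᵇ⇒≡ i j i≡j))
    ...   | inj₂ ne  = proj₂ (⊢⇒true ne) u~v

    matching₄-sound : ∀ m → T ((3 <ᵇ length m) ∧ matching Γ m) → ⊥
    matching₄-sound m t with ∧⁻ {3 <ᵇ length m} t
    ... | len , t′ = ℕ.<-irrefl refl (ℕ.≤-trans (ℕ.<ᵇ⇒< 3 (length m) len)
      (subst (_≤ 3) (List.length-map name m) (bounded (map name m) (proj₁ (matching-sound m t′)))))

    stuck-sound : ∀ e f m → T (matching Γ (e ∷ f ∷ []) ∧ ((length m ≡ᵇ 3) ∧ matching Γ m) ∧
      noEdge k Γ (proj₁ e ∷ proj₂ e ∷ proj₁ f ∷ proj₂ f ∷ []) []) → ⊥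
    stuck-sound e f m t with ∧⁻ {matching Γ (e ∷ f ∷ [])} t
    ... | te , t′ with ∧⁻ {(length m ≡ᵇ 3) ∧ matching Γ m} t′
                     | extend _ (proj₁ (matching-sound (e ∷ f ∷ []) te)) (s≤s (s≤s (s≤s z≤n)))
    ...   | tm , tn | (u , v) , u~v ∷ _ , (((p , q) , (r , s)) ∷ ((p′ , q′) , (r′ , s′)) ∷ []) ∷ _ =
      noEdge-sound m tm _ [] tn (p ∷ q ∷ p′ ∷ q′ ∷ []) (r ∷ s ∷ r′ ∷ s′ ∷ []) u~v

    square-sound : ∀ e a b c d m →
      T ((matching Γ (e ∷ (a , b) ∷ (c , d) ∷ []) ∧ matching Γ ((b , c) ∷ (d , a) ∷ [])) ∧
         ((length m ≡ᵇ 3) ∧ matching Γ m) ∧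
         noEdge k Γ (proj₁ e ∷ proj₂ e ∷ []) (a ∷ b ∷ c ∷ d ∷ [])) → ⊥
    square-sound e a b c d m t
      with ∧⁻ {matching Γ (e ∷ (a , b) ∷ (c , d) ∷ []) ∧ matching Γ ((b , c) ∷ (d , a) ∷ [])} t
    ... | te , t′ with ∧⁻ {matching Γ (e ∷ (a , b) ∷ (c , d) ∷ [])} te | ∧⁻ {(length m ≡ᵇ 3) ∧ matching Γ m} t′
    ...   | t₁ , t₂ | tm , tn
      with proj₁ (matching-sound (e ∷ (a , b) ∷ (c , d) ∷ []) t₁)
         | proj₁ (matching-sound ((b , c) ∷ (d , a) ∷ []) t₂)
    ...     | adj-e ∷ ab ∷ cd ∷ [] , (e#ab ∷ e#cd ∷ []) ∷ (ab#cd ∷ []) ∷ _ | bc ∷ da ∷ [] , (bc#da ∷ []) ∷ _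
      with escape (name e ∷ []) (adj-e ∷ [] , [] ∷ []) refl (fourCycle ab bc cd da ab#cd bc#da)
             (disjoint-sym e#ab ∷ []) (disjoint-sym e#cd ∷ [])
    ...       | u , v , u~v , ((p , q) , (r , s)) ∷ [] , (ua , ub) , (uc , ud) =
      noEdge-sound m tm _ (a ∷ b ∷ c ∷ d ∷ []) tn (p ∷ q ∷ ua ∷ ub ∷ uc ∷ ud ∷ []) (r ∷ s ∷ []) u~v

    cycle₇-sound : ∀ φ → T (renames 7 k φ ∧ all (λ (u , v) → Γ ⊢ edge u v) (cycleEdges φ)) → G Contains C₇
    cycle₇-sound φ t with ∧⁻ {renames 7 k φ} t
    ... | tr , te = record
      { embed           = at
      ; embed-injective = λ {a} {b} p → Fin.toℕ-injective
          (injective (Fin.toℕ<n a) (Fin.toℕ<n b) (inj (bnd (Fin.toℕ<n a)) (bnd (Fin.toℕ<n b)) p))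
      ; embed-adjacent  = λ { {a} {b} (inj₁ p) → next a b p ; {a} {b} (inj₂ p) → ~-sym (next b a p) }
      }
      where
      open Renaming (renames⁻ {7} {k} φ tr) renaming (bounded to bnd)
      at : Fin 7 → V
      at a = ρ (nth 0 φ (toℕ a))

      next : ∀ a b → toℕ b ≡ suc (toℕ a) % 7 → at a ~ at b
      next a b p = subst (λ j → at a ~ ρ (nth 0 φ j)) (sym p)
        (proj₂ (⊢⇒true {edge (nth 0 φ (toℕ a)) (nth 0 φ (suc (toℕ a) % 7))}
          (All.lookup (all⁻ (λ (u , v) → Γ ⊢ edge u v) (cycleEdges φ) te)
          (∈.∈-map⁺ (λ i → nth 0 φ i , nth 0 φ (suc i % 7)) (∈.∈-upTo⁺ (Fin.toℕ<n a))))))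

    module Subset {m φ} (r : Renaming m k φ) where
      open Renaming r renaming (bounded to bnd)

      ρ′ : ℕ → V
      ρ′ = ρ ∘ nth 0 φ

      ρ′-injective : Injectiveρ m ρ′
      ρ′-injective i< j< p = injective i< j< (inj (bnd i<) (bnd j<) p)

      unnamed-or-extra : ∀ {w} → Unnamed m ρ′ w → Unnamed k ρ w ⊎ (∃ λ e → e ∈ outsideOf k φ × ρ e ≡ w)
      unnamed-or-extra {w} o with named? w
      ... | no ow = inj₁ ow
      ... | yes (e , e< , refl) = inj₂ (e , ∈-outsideOf e< e∉ , refl)
        where
        e∉ : e ∉ φ
        e∉ e∈ with covers e∈
        ... | i , i< , refl = o (i , i< , refl)

      closedFor-sound : ∀ {u} → T (closedFor k Γ φ u) → ∀ w → Unnamed m ρ′ w → ¬ w ~ ρ u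
      closedFor-sound {u} t w o w~u with ∧⁻ {Γ ⊢ closed u} t | unnamed-or-extra o
      ... | tc , te | inj₁ ow = proj₂ (⊢⇒true tc) w ow w~u
      ... | tc , te | inj₂ (e , e∈ , refl) = proj₂ (⊢⇒true (All.lookup (all⁻ _ (outsideOf k φ) te) e∈)) w~u

      separateFor-sound : ∀ {u v} → T (separateFor k Γ φ u v) → ∀ w → Unnamed m ρ′ w → w ~ ρ u → ¬ w ~ ρ v
      separateFor-sound {u} {v} t w o w~u w~v with ∧⁻ {Γ ⊢ separate u v} t | unnamed-or-extra o
      ... | tc , te | inj₁ ow = proj₂ (⊢⇒true tc) w ow w~u w~v
      ... | tc , te | inj₂ (e , e∈ , refl) with ∨⁻ {Γ ⊢ nonedge e u} (All.lookup (all⁻ _ (outsideOf k φ) te) e∈)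
      ...   | inj₁ p = proj₂ (⊢⇒true p) w~u
      ...   | inj₂ p = proj₂ (⊢⇒true p) w~v

      transfer : ∀ f → T (transfers k Γ φ m f) → ⟦_⟧ m ρ′ f
      transfer (edge u v) t with ∧⁻ {(u <ᵇ m) ∧ (v <ᵇ m)} t
      ... | b , t′ = in-range {u} b , proj₂ (⊢⇒true t′)
      transfer (nonedge u v) t with ∧⁻ {(u <ᵇ m) ∧ (v <ᵇ m)} t
      ... | b , t′ = in-range {u} b , proj₂ (⊢⇒true t′)
      transfer (separate u v) t with ∧⁻ {(u <ᵇ m) ∧ (v <ᵇ m)} t
      ... | b , t′ = in-range {u} b , separateFor-sound t′
      transfer (closed u) t with ∧⁻ {u <ᵇ m} t
      ... | u< , t′ = ℕ.<ᵇ⇒< u m u< , closedFor-sound t′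

    applies-sound : ∀ i φ {Ls} → All ValidLemma Ls → T (applies k Γ i φ Ls) → Conclusion
    applies-sound zero φ {L ∷ Ls} (valid ∷ _) t with ∧⁻ {renames (Lemma.size L) k φ} t
    ... | tr , tf = valid (Subset.ρ′ r) (Subset.ρ′-injective r)
      (All.map (λ {f} → Subset.transfer r f) (all⁻ _ (Lemma.facts L) tf))
      where r = renames⁻ {Lemma.size L} {k} φ tr
    applies-sound (suc i) φ (_ ∷ valid) t = applies-sound i φ valid t

    fitsTarget-sound : ∀ 𝓣 φ m → T (fitsTarget 𝓣 k Γ φ m) → Fits G 𝓣
    fitsTarget-sound 𝓣 φ m t = record
      { core          = core
      ; core-inj      = λ {a} {b} p → Fin.toℕ-injective (ρ′-injective (Fin.toℕ<n a) (Fin.toℕ<n b) p)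
      ; core-required = λ { a b (inj₁ p) → req p ; a b (inj₂ p) → ~-sym (req p) }
      ; core-allowed  = allowed
      ; fresh-core    = λ {w} fw a w~a → unfilled′ fw a w~a
                          (∨⁻ (All.lookup (all⁻ _ (allFin order) t-unfilled) (∈.∈-allFin a)))
      ; fresh-fresh   = λ fw fx → off-matching m (ℕ.≡ᵇ⇒≡ (length m) 3 t-len) t-matching
                          (All.map (λ {e} t → off e fw t , off e fx t) (all⁻ _ m t-member))
      ; separated     = λ {w} fw → All.map (λ {e} t → separateFor-sound t w (unnamed fw)) (all⁻ _ separations t-apart)
      }
      where
      open Target 𝓣 renaming (apart to separations)
      open Template template

      part₁ part₂ : Bool
      part₁ = renames order k φ ∧ (length m ≡ᵇ 3) ∧ matching Γ m ∧ all (λ (u , v) → member u φ ∧ member v φ) m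
      part₂ = all (λ (a , b) → Γ ⊢ edge (nth 0 φ (toℕ a)) (nth 0 φ (toℕ b))) required

      ts₁ = ∧⁻ {part₁} t
      ts₂ = ∧⁻ {renames order k φ} (proj₁ ts₁)
      ts₃ = ∧⁻ {length m ≡ᵇ 3} (proj₂ ts₂)
      ts₄ = ∧⁻ {matching Γ m} (proj₂ ts₃)
      t-len = proj₁ ts₃
      t-matching = proj₁ ts₄
      t-member = proj₂ ts₄
      ts₅ = ∧⁻ {part₂} (proj₂ ts₁)
      t-required = proj₁ ts₅
      ts₆ = ∧⁻ {all (λ a → all (λ b → ⌊ a Fin.≟ b ⌋ ∨ joined required a b ∨ joined optional a b ∨
                  (Γ ⊢ nonedge (nth 0 φ (toℕ a)) (nth 0 φ (toℕ b)))) (allFin order)) (allFin order)} (proj₂ ts₅)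
      t-allowed = proj₁ ts₆
      ts₇ = ∧⁻ {all (λ a → any (λ c → ⌊ a Fin.≟ c ⌋) unfilled ∨ closedFor k Γ φ (nth 0 φ (toℕ a))) (allFin order)} (proj₂ ts₆)
      t-unfilled = proj₁ ts₇
      t-apart = proj₂ ts₇

      r = renames⁻ {order} {k} φ (proj₁ ts₂)
      open Subset r
      open Renaming r using (covers)

      core : Fin order → V
      core a = ρ′ (toℕ a)

      unnamed : ∀ {w} → (∀ a → core a ≢ w) → Unnamed order ρ′ w
      unnamed fw (i , i< , p) = fw (Fin.fromℕ< i<) (trans (cong ρ′ (Fin.toℕ-fromℕ< i<)) p)

      off : ∀ {w} e → (∀ a → core a ≢ w) → T (member (proj₁ e) φ ∧ member (proj₂ e) φ) →
            w ≢ ρ (proj₁ e) × w ≢ ρ (proj₂ e)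
      off {w} (u , v) fw t with ∧⁻ {member u φ} t
      ... | tu , tv = avoid (member⁻ u φ tu) , avoid (member⁻ v φ tv)
        where
        avoid : ∀ {x} → x ∈ φ → w ≢ ρ x
        avoid x∈ w≡ with covers x∈
        ... | i , i< , refl = unnamed fw (i , i< , sym w≡)

      req : ∀ {a b} → (a , b) ∈ required → core a ~ core b
      req ab∈ = proj₂ (⊢⇒true (All.lookup (all⁻ _ required t-required) ab∈))

      allowed : ∀ a b → core a ~ core b → Joins required a b ⊎ Joins optional a b
      allowed a b a~b with ∨⁻ {⌊ a Fin.≟ b ⌋} (All.lookup (all⁻ _ (allFin order)
                             (All.lookup (all⁻ _ (allFin order) t-allowed) (∈.∈-allFin a))) (∈.∈-allFin b))
      ... | inj₁ p = ⊥-elim (~⇒≢ G a~b (cong core (toWitness p)))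
      ... | inj₂ p with ∨⁻ {joined required a b} p
      ...   | inj₁ p = inj₁ (joined⁻ required a b p)
      ...   | inj₂ p with ∨⁻ {joined optional a b} p
      ...     | inj₁ p = inj₂ (joined⁻ optional a b p)
      ...     | inj₂ p = ⊥-elim (proj₂ (⊢⇒true p) a~b)

      unfilled′ : ∀ {w} → (∀ a → core a ≢ w) → ∀ a → w ~ core a →
                  T (any (λ c → ⌊ a Fin.≟ c ⌋) unfilled) ⊎ T (closedFor k Γ φ (nth 0 φ (toℕ a))) → a ∈ unfilled
      unfilled′ fw a w~a (inj₁ p) = Any.map toWitness (any⁻ _ unfilled p)
      unfilled′ fw a w~a (inj₂ p) = ⊥-elim (closedFor-sound p _ (unnamed fw) w~a)

    fitsNth-sound : ∀ t φ m 𝓣s → T (fitsNth k Γ t φ m 𝓣s) → Any (Fits G) 𝓣s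
    fitsNth-sound zero    φ m (𝓣 ∷ 𝓣s) t = here (fitsTarget-sound 𝓣 φ m t)
    fitsNth-sound (suc i) φ m (𝓣 ∷ 𝓣s) t = there (fitsNth-sound i φ m 𝓣s t)

  module Extend (k : ℕ) (ρ : ℕ → V) (inj : Injectiveρ k ρ) (w : V) (fresh : Unnamed k ρ w) where

    ρ⁺ : ℕ → V
    ρ⁺ i with i ℕ.≟ k
    ... | yes _ = w
    ... | no _  = ρ i

    ρ⁺-new : ρ⁺ k ≡ w
    ρ⁺-new with k ℕ.≟ k
    ... | yes _  = refl
    ... | no k≢k = ⊥-elim (k≢k refl)

    ρ⁺-old : ∀ {i} → i < k → ρ⁺ i ≡ ρ i
    ρ⁺-old {i} i<k with i ℕ.≟ k
    ... | yes refl = ⊥-elim (ℕ.<-irrefl refl i<k)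
    ... | no _     = refl

    ρ⁺-injective : Injectiveρ (suc k) ρ⁺
    ρ⁺-injective {i} {j} i< j< p with ℕ.m<1+n⇒m<n∨m≡n i< | ℕ.m<1+n⇒m<n∨m≡n j<
    ... | inj₁ i<k | inj₁ j<k = inj i<k j<k (trans (sym (ρ⁺-old i<k)) (trans p (ρ⁺-old j<k)))
    ... | inj₁ i<k | inj₂ refl = ⊥-elim (fresh (i , i<k , trans (sym (ρ⁺-old i<k)) (trans p ρ⁺-new)))
    ... | inj₂ refl | inj₁ j<k = ⊥-elim (fresh (j , j<k , trans (sym (ρ⁺-old j<k)) (trans (sym p) ρ⁺-new)))
    ... | inj₂ refl | inj₂ refl = refl

    unnamed⁻ : ∀ {x} → Unnamed (suc k) ρ⁺ x → Unnamed k ρ x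
    unnamed⁻ o (i , i< , p) = o (i , ℕ.m<n⇒m<1+n i< , trans (ρ⁺-old i<) p)

    new-edge : ∀ {u} → u < k → w ~ ρ u → ⟦_⟧ (suc k) ρ⁺ (edge u k)
    new-edge {u} u< w~u = (ℕ.m<n⇒m<1+n u< , ℕ.n<1+n k) ,
      ~-sym (subst (_~ ρ⁺ u) (sym ρ⁺-new) (subst (w ~_) (sym (ρ⁺-old u<)) w~u))

    keep : ∀ f → ⟦_⟧ k ρ f → ⟦_⟧ (suc k) ρ⁺ f
    keep (edge u v) ((u< , v<) , r) rewrite sym (ρ⁺-old u<) | sym (ρ⁺-old v<) = (ℕ.m<n⇒m<1+n u< , ℕ.m<n⇒m<1+n v<) , r
    keep (nonedge u v) ((u< , v<) , r) rewrite sym (ρ⁺-old u<) | sym (ρ⁺-old v<) = (ℕ.m<n⇒m<1+n u< , ℕ.m<n⇒m<1+n v<) , r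
    keep (separate u v) ((u< , v<) , r) = (ℕ.m<n⇒m<1+n u< , ℕ.m<n⇒m<1+n v<) ,
      λ x ox xu xv → r x (unnamed⁻ ox) (subst (x ~_) (ρ⁺-old u<) xu) (subst (x ~_) (ρ⁺-old v<) xv)
    keep (closed u) (u< , r) = ℕ.m<n⇒m<1+n u< , λ x ox xu → r x (unnamed⁻ ox) (subst (x ~_) (ρ⁺-old u<) xu)

    shut : ∀ {c} → ⟦_⟧ k ρ (closed c) → ⟦_⟧ (suc k) ρ⁺ (nonedge c k)
    shut {c} (c< , r) = (ℕ.m<n⇒m<1+n c< , ℕ.n<1+n k) ,
      λ e → r w fresh (~-sym (subst (_~ w) (ρ⁺-old c<) (subst (ρ⁺ c ~_) ρ⁺-new e)))

    name-next-true : ∀ {Γ} → All (⟦_⟧ k ρ) Γ → All (⟦_⟧ (suc k) ρ⁺) (name-next k Γ)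
    name-next-true {[]} [] = []
    name-next-true {edge u v ∷ _}     (t ∷ ts) = keep (edge u v) t ∷ name-next-true ts
    name-next-true {nonedge u v ∷ _}  (t ∷ ts) = keep (nonedge u v) t ∷ name-next-true ts
    name-next-true {separate u v ∷ _} (t ∷ ts) = keep (separate u v) t ∷ name-next-true ts
    name-next-true {closed u ∷ _}     (t ∷ ts) = keep (closed u) t ∷ shut t ∷ name-next-true ts

  -- Each question can be answered for the actual graph, since adjacency is decidable and the vertex
  -- set finite; the derivation is then followed along the branch of the answer.
  check-sound : ∀ {Ls} → All ValidLemma Ls → ∀ k Γ t → T (check 𝓣s Ls k Γ t) → Valid k Γ
  check-sound Ls! k Γ (edge? u v y n) t ρ inj Γ! with ∧⁻ {(u <ᵇ k) ∧ (v <ᵇ k)} t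
  ... | b , t′ with ∧⁻ t′ | ρ u ~? ρ v
  ...   | ty , _ | yes u~v = check-sound Ls! k _ y ty ρ inj ((in-range {u} b , u~v) ∷ Γ!)
  ...   | _ , tn | no u≁v  = check-sound Ls! k _ n tn ρ inj ((in-range {u} b , u≁v) ∷ Γ!)
  check-sound Ls! k Γ (outer? u y n) t ρ inj Γ! with ∧⁻ {u <ᵇ k} t
  ... | u< , t′ with ∧⁻ t′ | Fin.any? (λ w → ¬? (State.named? k ρ inj Γ! w) ×-dec (w ~? ρ u))
  ...   | ty , _ | yes (w , ow , w~u) =
    check-sound Ls! (suc k) _ y ty E.ρ⁺ E.ρ⁺-injective
      (E.new-edge (ℕ.<ᵇ⇒< u k u<) w~u ∷ E.name-next-true Γ!)
    where module E = Extend k ρ inj w ow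
  ...   | _ , tn | no ¬w =
    check-sound Ls! k _ n tn ρ inj ((ℕ.<ᵇ⇒< u k u< , λ w ow w~u → ¬w (w , ow , w~u)) ∷ Γ!)
  check-sound Ls! k Γ (common? u v y n) t ρ inj Γ! with ∧⁻ {(u <ᵇ k) ∧ (v <ᵇ k)} t
  ... | b , t′ with in-range {u} b | ∧⁻ t′
                  | Fin.any? (λ w → ¬? (State.named? k ρ inj Γ! w) ×-dec (w ~? ρ u) ×-dec (w ~? ρ v))
  ...   | u< , v< | ty , _ | yes (w , ow , w~u , w~v) =
    check-sound Ls! (suc k) _ y ty E.ρ⁺ E.ρ⁺-injective
      (E.new-edge u< w~u ∷ E.new-edge v< w~v ∷ E.name-next-true Γ!)
    where module E = Extend k ρ inj w ow
  ...   | u< , v< | _ , tn | no ¬w =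
    check-sound Ls! k _ n tn ρ inj
      (((u< , v<) , λ w ow w~u w~v → ¬w (w , ow , w~u , w~v)) ∷ Γ!)
  check-sound Ls! k Γ (matching₄ m) t ρ inj Γ! = ⊥-elim (State.matching₄-sound k ρ inj Γ! m t)
  check-sound Ls! k Γ (cycle₇ φ) t ρ inj Γ! = inj₁ (State.cycle₇-sound k ρ inj Γ! φ t)
  check-sound Ls! k Γ (stuck e f m) t ρ inj Γ! = ⊥-elim (State.stuck-sound k ρ inj Γ! e f m t)
  check-sound Ls! k Γ (square e a b c d m) t ρ inj Γ! = ⊥-elim (State.square-sound k ρ inj Γ! e a b c d m t)
  check-sound Ls! k Γ (fits i φ m) t ρ inj Γ! = inj₂ (State.fitsNth-sound k ρ inj Γ! i φ m 𝓣s t)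
  check-sound Ls! k Γ (lemma i φ) t ρ inj Γ! = State.applies-sound k ρ inj Γ! i φ Ls! t

  verify-sound : ∀ {Ls} → All ValidLemma Ls → ∀ Ls′ k Γ t → T (verify 𝓣s Ls Ls′ k Γ t) → Valid k Γ
  verify-sound Ls! [] k Γ t v = check-sound Ls! k Γ t v
  verify-sound Ls! (L ∷ Ls′) k Γ t v with ∧⁻ v
  ... | c , v′ = verify-sound (check-sound Ls! (Lemma.size L) (Lemma.facts L) (Lemma.proof L) c ∷ Ls!) Ls′ k Γ t v′

-- Templates

-- The stars with at least `m` edges: the centre is unfilled, so that all further leaves are new
-- vertices.
starᵀ : ℕ → Template
starᵀ m = record
  { order    = suc m
  ; required = List.map (λ i → zero , suc i) (allFin m)
  ; optional = []
  ; unfilled = zero ∷ []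
  }

triangleᵀ : Template
triangleᵀ = record
  { order    = 3
  ; required = (0F , 1F) ∷ (1F , 2F) ∷ (0F , 2F) ∷ []
  ; optional = []
  ; unfilled = []
  }

infixr 5 _⊎ᵀ_

-- A new vertex joined to unfilled vertices on both sides would merge two components, so all such
-- pairs are separated.
_⊎ᵀ_ : Template → Target → Target
S ⊎ᵀ (T separating apart) = record
  { order    = S.order + T.order
  ; required = List.map (Product.map left left) S.required ++ List.map (Product.map right right) T.required
  ; optional = List.map (Product.map left left) S.optional ++ List.map (Product.map right right) T.optional
  ; unfilled = List.map left S.unfilled ++ List.map right T.unfilled
  } separating
    (cartesianProduct (List.map left S.unfilled) (List.map right T.unfilled) ++
     List.map (Product.map right right) apart)
  where
  module S = Template S
  module T = Template T
  left : Fin S.order → Fin (S.order + T.order)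
  left = _↑ˡ T.order
  right : Fin T.order → Fin (S.order + T.order)
  right = S.order ↑ʳ_

-- The parts share the vertex `0F`. The index of a petal template counts its triangles; each other
-- petal is a path from `0F` over an unfilled centre to a second leaf.
E₁ᵀ E₂ᵀ petals₁ᵀ petals₂ᵀ petals₃ᵀ : Template
E₁ᵀ = record
  { order    = 7
  ; required = (0F , 1F) ∷ (0F , 2F) ∷ (0F , 3F) ∷ (1F , 2F) ∷ (1F , 3F) ∷ (2F , 3F) ∷
               (0F , 4F) ∷ (0F , 5F) ∷ (0F , 6F) ∷ (4F , 5F) ∷ (4F , 6F) ∷ (5F , 6F) ∷ []
  ; optional = []
  ; unfilled = []
  }
E₂ᵀ = record
  { order    = 7
  ; required = (0F , 1F) ∷ (0F , 2F) ∷ (0F , 3F) ∷ (1F , 2F) ∷ (1F , 3F) ∷ (2F , 3F) ∷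
               (0F , 4F) ∷ (4F , 5F) ∷ (5F , 6F) ∷ (6F , 0F) ∷ []
  ; optional = []
  ; unfilled = []
  }
petals₃ᵀ = record
  { order    = 7
  ; required = (0F , 1F) ∷ (0F , 2F) ∷ (1F , 2F) ∷ (0F , 3F) ∷ (0F , 4F) ∷ (3F , 4F) ∷
               (0F , 5F) ∷ (0F , 6F) ∷ (5F , 6F) ∷ []
  ; optional = []
  ; unfilled = []
  }
petals₂ᵀ = record
  { order    = 7
  ; required = (0F , 1F) ∷ (1F , 2F) ∷ (0F , 3F) ∷ (0F , 4F) ∷ (3F , 4F) ∷
               (0F , 5F) ∷ (0F , 6F) ∷ (5F , 6F) ∷ []
  ; optional = []
  ; unfilled = 1F ∷ []
  }
petals₁ᵀ = record
  { order    = 7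
  ; required = (0F , 1F) ∷ (1F , 2F) ∷ (0F , 3F) ∷ (3F , 4F) ∷
               (0F , 5F) ∷ (0F , 6F) ∷ (5F , 6F) ∷ []
  ; optional = []
  ; unfilled = 1F ∷ 3F ∷ []
  }

-- Three stars, disjoint or glued at leaves, need no target of their own: they
-- belong to 𝓑₁.
targets : List Target
targets =
  (𝓑₁ separating []) ∷ (𝓑₂ separating []) ∷ (𝓑₃ separating []) ∷ (𝓑₄ separating []) ∷
  (𝓑₅ separating []) ∷ (𝓑₆ separating []) ∷ (𝓑₇ separating []) ∷ (𝓑₈ separating []) ∷
  (𝓑₉ separating []) ∷
  (E₁ᵀ separating []) ∷ (E₂ᵀ separating []) ∷
  (petals₃ᵀ separating []) ∷ (petals₂ᵀ separating []) ∷ (petals₁ᵀ separating ((1F , 3F) ∷ [])) ∷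
  (triangleᵀ ⊎ᵀ triangleᵀ ⊎ᵀ triangleᵀ separating []) ∷
  (starᵀ 1 ⊎ᵀ triangleᵀ ⊎ᵀ triangleᵀ separating []) ∷
  (starᵀ 1 ⊎ᵀ starᵀ 1 ⊎ᵀ triangleᵀ separating []) ∷
  (triangleᵀ ⊎ᵀ bowtie separating []) ∷ (starᵀ 1 ⊎ᵀ bowtie separating []) ∷
  (triangleᵀ ⊎ᵀ 𝓖₁ separating []) ∷ (starᵀ 1 ⊎ᵀ 𝓖₁ separating []) ∷
  (triangleᵀ ⊎ᵀ 𝓖₂ separating []) ∷ (starᵀ 1 ⊎ᵀ 𝓖₂ separating []) ∷
  (triangleᵀ ⊎ᵀ 𝓖₃ separating []) ∷ (starᵀ 1 ⊎ᵀ 𝓖₃ separating []) ∷ []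

-- Fitting graphs

-- Components and petals have vertex types of the form `∃ P`, and their new vertices have to be
-- numbered too.
Finite : Set → Set
Finite W = ∃ λ m → Fin m ↔ W

∃-≡ : ∀ {A : Set} {P : Pred A 0ℓ} → Irrelevant P → {x y : ∃ P} → proj₁ x ≡ proj₁ y → x ≡ y
∃-≡ irr {x , p} {.x , q} refl = cong (x ,_) (irr p q)

finite-≟ : ∀ {W} → Finite W → DecidableEquality W
finite-≟ (m , f) x y = map′ (λ p → trans (sym (strictlyInverseˡ x)) (trans (cong to p) (strictlyInverseˡ y)))
                            (cong from) (from x Fin.≟ from y)
  where open Inverse f

finite-Fin : ∀ {n} → Finite (Fin n)
finite-Fin {n} = n , mk↔ₛ′ id id (λ _ → refl) (λ _ → refl)

finite-subset-Fin : ∀ n {P : Pred (Fin n) 0ℓ} → Decidable P → Irrelevant P → Finite (∃ P)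
finite-subset-Fin zero P? irr = 0 , mk↔ₛ′ (λ ()) (λ ()) (λ ()) (λ ())
finite-subset-Fin (suc n) {P} P? irr with P? zero | finite-subset-Fin n (P? ∘ suc) irr
... | no ¬p | m , f = m , mk↔ₛ′ (Product.map suc id ∘ to) g inv (λ i → strictlyInverseʳ i)
  where
  open Inverse f
  g : ∃ P → Fin m
  g (zero , p)  = ⊥-elim (¬p p)
  g (suc v , p) = from (v , p)
  inv : ∀ x → Product.map suc id (to (g x)) ≡ x
  inv (zero , p)  = ⊥-elim (¬p p)
  inv (suc v , p) = cong (Product.map suc id) (strictlyInverseˡ (v , p))
... | yes p₀ | m , f = suc m , mk↔ₛ′ h g inv inv′
  where
  open Inverse f
  h : Fin (suc m) → ∃ P
  h zero    = zero , p₀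
  h (suc i) = Product.map suc id (to i)
  g : ∃ P → Fin (suc m)
  g (zero , p)  = zero
  g (suc v , p) = suc (from (v , p))
  inv : ∀ x → h (g x) ≡ x
  inv (zero , p)  = cong (zero ,_) (irr p₀ p)
  inv (suc v , p) = cong (Product.map suc id) (strictlyInverseˡ (v , p))
  inv′ : ∀ i → g (h i) ≡ i
  inv′ zero    = refl
  inv′ (suc i) = cong suc (strictlyInverseʳ i)

finite-subset : ∀ {W} {P : Pred W 0ℓ} → Finite W → Decidable P → Irrelevant P → Finite (∃ P)
finite-subset {W} {P} (m , f) P? irr with finite-subset-Fin m (P? ∘ Inverse.to f) irr
... | l , g = l , ↔-trans g (mk↔ₛ′ forth back inv inv′)
  where
  open Inverse f
  forth : ∃ (P ∘ to) → ∃ P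
  forth (i , p) = to i , p
  back : ∃ P → ∃ (P ∘ to)
  back (w , p) = from w , subst P (sym (strictlyInverseˡ w)) p
  inv : ∀ x → forth (back x) ≡ x
  inv (w , p) = ∃-≡ irr (strictlyInverseˡ w)
  inv′ : ∀ x → back (forth x) ≡ x
  inv′ (i , p) = ∃-≡ irr (strictlyInverseʳ i)

module Complement {W : Set} (fin : Finite W) {k} (core : Fin k → W) (core-inj : Injective _≡_ _≡_ core) where

  isCore? : ∀ w → Dec (∃ λ a → core a ≡ w)
  isCore? w = Fin.any? λ a → finite-≟ fin (core a) w

  -- Stated through a Boolean so that all its proofs are equal.
  Other : Pred W 0ℓ
  Other w = False (isCore? w)

  other⁻ : ∀ {w} → Other w → ∀ a → core a ≢ w
  other⁻ o a p = toWitnessFalse o (a , p)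

  others : Finite (∃ Other)
  others = finite-subset fin (λ w → T? (not ⌊ isCore? w ⌋)) T-irrelevant

  extra : ℕ
  extra = proj₁ others

  new : Fin extra → W
  new = proj₁ ∘ Inverse.to (proj₂ others)

  new-fresh : ∀ j a → core a ≢ new j
  new-fresh j = other⁻ (proj₂ (Inverse.to (proj₂ others) j))

  vertices : (Fin k ⊎ Fin extra) ↔ W
  vertices = mk↔ₛ′ to from to∘from from∘to
    where
    module O = Inverse (proj₂ others)

    to : Fin k ⊎ Fin extra → W
    to = [ core , new ]′

    locate : ∀ w → Dec (∃ λ a → core a ≡ w) → Fin k ⊎ Fin extra
    locate w (yes (a , _)) = inj₁ a
    locate w (no ¬a)       = inj₂ (O.from (w , fromWitnessFalse ¬a))

    from : W → Fin k ⊎ Fin extra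
    from w = locate w (isCore? w)

    to∘locate : ∀ w d → to (locate w d) ≡ w
    to∘locate w (yes (_ , p)) = p
    to∘locate w (no _)        = cong proj₁ (O.strictlyInverseˡ _)

    to∘from : ∀ w → to (from w) ≡ w
    to∘from w = to∘locate w (isCore? w)

    locate∘to : ∀ x d → locate (to x) d ≡ x
    locate∘to (inj₁ a) (yes (b , p)) = cong inj₁ (core-inj p)
    locate∘to (inj₁ a) (no ¬a)       = ⊥-elim (¬a (a , refl))
    locate∘to (inj₂ j) (yes (b , p)) = ⊥-elim (new-fresh j b p)
    locate∘to (inj₂ j) (no _)        =
      cong inj₂ (trans (cong O.from (∃-≡ T-irrelevant refl)) (O.strictlyInverseʳ j))

    from∘to : ∀ x → from (to x) ≡ x
    from∘to x = locate∘to x (isCore? (to x))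

-- A new vertex has some neighbour, and as the complement of the core is independent this neighbour
-- lies in the core.
fits⇒∈ᶠ : ∀ {W} {G : Graph W} {T apart} → Finite W → NoIsolatedVertices G → Fits G (T separating apart) → G ∈ᶠ T
fits⇒∈ᶠ {W} {G} {T} fin noIso F = record
  { extra         = extra
  ; vertices      = vertices
  ; core-required = core-required
  ; core-allowed  = core-allowed
  ; new-new       = λ i j → fresh-fresh (new-fresh i) (new-fresh j)
  ; new-core      = λ i → fresh-core (new-fresh i)
  ; new-joined    = new-joined
  }
  where
  open Graph G
  open Fits F
  open Complement fin core core-inj

  new-joined : ∀ i → ∃ λ a → new i ~ core a
  new-joined i with noIso (new i)
  ... | w , new~w with isCore? w
  ...   | yes (a , refl) = a , new~w
  ...   | no ¬a = ⊥-elim (fresh-fresh (new-fresh i) (λ a p → ¬a (a , p)) new~w)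

-- With nothing unfilled, a vertex off the core could have a neighbour neither in the core nor off
-- it. Hence the core is the whole graph, and without optional edges the graph is determined.
module Rigid {W} {G : Graph W} {T apart} (fin : Finite W) (noIso : NoIsolatedVertices G)
  (F : Fits G (T separating apart)) (no-optional : Template.optional T ≡ []) (no-unfilled : Template.unfilled T ≡ []) where
  open Graph G
  open Fits F
  open Template T

  core-onto : ∀ w → ∃ λ a → core a ≡ w
  core-onto w with Complement.isCore? fin core core-inj w
  ... | yes p = p
  ... | no ¬a with noIso w
  ...   | x , w~x with Complement.isCore? fin core core-inj x
  ...     | no ¬b = ⊥-elim (fresh-fresh (λ a p → ¬a (a , p)) (λ a p → ¬b (a , p)) w~x)
  ...     | yes (b , refl) with subst (b ∈_) no-unfilled (fresh-core (λ a p → ¬a (a , p)) b w~x)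
  ...       | ()

  required⁻ : ∀ a b → core a ~ core b → Joins required a b
  required⁻ a b a~b with core-allowed a b a~b
  ... | inj₁ p = p
  ... | inj₂ p with subst (λ es → Joins es a b) no-optional p
  ...   | inj₁ ()
  ...   | inj₂ ()

  bijection : W ↔ Fin order
  bijection = mk↔ₛ′ (proj₁ ∘ core-onto) core (λ a → core-inj (proj₂ (core-onto (core a)))) (proj₂ ∘ core-onto)

triangle-joins : ∀ a b → a ≢ b → Joins (Template.required triangleᵀ) a b
triangle-joins 0F 0F a≢b = ⊥-elim (a≢b refl)
triangle-joins 0F 1F _   = inj₁ (here refl)
triangle-joins 0F 2F _   = inj₁ (there (there (here refl)))
triangle-joins 1F 0F _   = inj₂ (here refl)
triangle-joins 1F 1F a≢b = ⊥-elim (a≢b refl)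
triangle-joins 1F 2F _   = inj₁ (there (here refl))
triangle-joins 2F 0F _   = inj₂ (there (there (here refl)))
triangle-joins 2F 1F _   = inj₂ (there (here refl))
triangle-joins 2F 2F a≢b = ⊥-elim (a≢b refl)

fits-triangle : ∀ {W} {G : Graph W} {apart} → Finite W → NoIsolatedVertices G → Fits G (triangleᵀ separating apart) → G ≅ K 3
fits-triangle {W} {G} fin noIso F = record
  { bijection = bijection
  ; adjacency = λ u v → mk⇔
      (λ u~v p → ~⇒≢ G u~v (trans (sym (proj₂ (core-onto u))) (trans (cong core p) (proj₂ (core-onto v)))))
      (λ p → subst₂ _~_ (proj₂ (core-onto u)) (proj₂ (core-onto v)) (core-required _ _ (triangle-joins _ _ p)))
  }
  where
  open Graph G
  open Fits F
  open Rigid fin noIso F refl refl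

-- `Fin.splitAt` puts the core before the new vertices, so the centre of the template becomes the
-- centre `zero` of `S (m + extra)`.
module StarNumbering {W} {G : Graph W} {m apart} (fin : Finite W) (noIso : NoIsolatedVertices G)
  (F : Fits G (starᵀ m separating apart)) where
  open Graph G
  open _∈ᶠ_ (fits⇒∈ᶠ fin noIso F)

  private
    place : Fin (suc m) ⊎ Fin extra → W
    place = Inverse.to vertices

    centre : W
    centre = place (inj₁ zero)

    spoke : ∀ x → x ≢ inj₁ zero → centre ~ place x
    spoke (inj₁ zero)    x≢ = ⊥-elim (x≢ refl)
    spoke (inj₁ (suc i)) _  = core-required zero (suc i) (inj₁ (∈.∈-map⁺ (λ i → zero , suc i) (∈.∈-allFin i)))
    spoke (inj₂ j)       _  with new-joined j
    ... | a , j~a with new-core j a j~a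
    ...   | here refl = ~-sym j~a

    joins-zero : ∀ {a b} → Joins (Template.required (starᵀ m)) (suc a) (suc b) → ⊥
    joins-zero (inj₁ p) with ∈.∈-map⁻ (λ i → zero , suc i) p
    ... | _ , _ , ()
    joins-zero (inj₂ p) with ∈.∈-map⁻ (λ i → zero , suc i) p
    ... | _ , _ , ()

    rim : ∀ x y → x ≢ inj₁ zero → y ≢ inj₁ zero → ¬ place x ~ place y
    rim (inj₁ zero) _ x≢ _ _ = x≢ refl
    rim _ (inj₁ zero) _ y≢ _ = y≢ refl
    rim (inj₁ (suc a)) (inj₁ (suc b)) _ _ p with core-allowed (suc a) (suc b) p
    ... | inj₁ q = joins-zero q
    ... | inj₂ (inj₁ ())
    ... | inj₂ (inj₂ ())
    rim (inj₂ i) (inj₁ (suc b)) _ _ p with new-core i (suc b) p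
    ... | here ()
    ... | there ()
    rim (inj₁ (suc a)) (inj₂ j) _ _ p with new-core j (suc a) (~-sym p)
    ... | here ()
    ... | there ()
    rim (inj₂ i) (inj₂ j) _ _ p = new-new i j p

  embed : Fin (suc (m + extra)) → W
  embed = place ∘ Fin.splitAt (suc m)

  numbering : Fin (suc m + extra) ↔ W
  numbering = ↔-trans Fin.+↔⊎ vertices

  private
    split-zero : ∀ (i : Fin (suc m + extra)) → Fin.splitAt (suc m) i ≡ inj₁ zero → i ≡ zero
    split-zero zero    _ = refl
    split-zero (suc i) p with Fin.splitAt m i
    split-zero (suc i) () | inj₁ _
    split-zero (suc i) () | inj₂ _

  embed-adjacent : ∀ i j → embed i ~ embed j ⇔ Graph._~_ (S (m + extra)) i j
  embed-adjacent zero zero = mk⇔ (λ p → ⊥-elim (~⇒≢ G p refl)) λ { (inj₁ (_ , p)) → ⊥-elim (p refl) ; (inj₂ (_ , p)) → ⊥-elim (p refl) }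
  embed-adjacent zero (suc j) = mk⇔ (λ _ → inj₁ (refl , λ ()))
    (λ _ → spoke (Fin.splitAt (suc m) (suc j)) (λ p → Fin.0≢1+n (sym (split-zero (suc j) p))))
  embed-adjacent (suc i) zero = mk⇔ (λ _ → inj₂ (refl , λ ()))
    (λ _ → ~-sym (spoke (Fin.splitAt (suc m) (suc i)) (λ p → Fin.0≢1+n (sym (split-zero (suc i) p)))))
  embed-adjacent (suc i) (suc j) = mk⇔
    (λ p → ⊥-elim (rim (Fin.splitAt (suc m) (suc i)) (Fin.splitAt (suc m) (suc j))
      (λ q → Fin.0≢1+n (sym (split-zero (suc i) q))) (λ q → Fin.0≢1+n (sym (split-zero (suc j) q))) p))
    λ { (inj₁ (() , _)) ; (inj₂ (() , _)) }

fits-star : ∀ {W} {G : Graph W} {m apart} → Finite W → NoIsolatedVertices G →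
            Fits G (starᵀ (suc m) separating apart) → ∃ λ n → 1 ≤ n × G ≅ S n
fits-star {W} {G} {m} fin noIso F = suc m + _∈ᶠ_.extra (fits⇒∈ᶠ fin noIso F) , s≤s z≤n , record
  { bijection = ↔-sym numbering
  ; adjacency = λ u v → mk⇔
      (λ u~v → Equivalence.to (embed-adjacent _ _)
        (subst₂ _~_ (sym (strictlyInverseˡ u)) (sym (strictlyInverseˡ v)) u~v))
      (λ p → subst₂ _~_ (strictlyInverseˡ u) (strictlyInverseˡ v) (Equivalence.from (embed-adjacent _ _) p))
  }
  where
  open Graph G
  open StarNumbering fin noIso F
  open Inverse numbering

-- Splitting a template into parts

joins? : ∀ {m} (es : List (Fin m × Fin m)) a b → Dec (Joins es a b)
joins? es a b = member? (Product.≡-dec Fin._≟_ Fin._≟_) (a , b) es ⊎-dec member? (Product.≡-dec Fin._≟_ Fin._≟_) (b , a) es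

-- Every field is a statement about finite lists, so the instances are settled by `isPart?`. The
-- field `neighbour` keeps the induced part free of isolated vertices.
record IsPart (T : Template) (Q : Pred (Fin (Template.order T)) 0ℓ) (S : Template) (sub : Fin (Template.order S) → Fin (Template.order T)) : Set where
  constructor isPart
  open Template
  field
    inside   : ∀ b → Q (sub b)
    covered  : ∀ a → Q a → ∃ λ b → sub b ≡ a
    sub-inj : ∀ a b → sub a ≡ sub b → a ≡ b
    edges    : All (λ (a , b) → Joins (required T) (sub a) (sub b)) (required S)
    no-more  : ∀ a b → Joins (required T) (sub a) (sub b) ⊎ Joins (optional T) (sub a) (sub b) →
               Joins (required S) a b ⊎ Joins (optional S) a b
    unfilled⁻ : ∀ a → sub a ∈ unfilled T → a ∈ unfilled S
    neighbour : ∀ b → ∃ λ c → Joins (required S) b c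

isPart? : ∀ T {Q} → Decidable Q → ∀ S sub → Dec (IsPart T Q S sub)
isPart? T Q? S sub = map′ (λ (a , b , c , d , e , f , g) → isPart a b c d e f g)
  (λ (isPart a b c d e f g) → a , b , c , d , e , f , g)
  (Fin.all? (λ b → Q? (sub b)) ×-dec
   Fin.all? (λ a → Q? a →-dec Fin.any? (λ b → sub b Fin.≟ a)) ×-dec
   Fin.all? (λ a → Fin.all? λ b → (sub a Fin.≟ sub b) →-dec (a Fin.≟ b)) ×-dec
   All.all? (λ (a , b) → joins? (required T) (sub a) (sub b)) (required S) ×-dec
   Fin.all? (λ a → Fin.all? λ b →
     (joins? (required T) (sub a) (sub b) ⊎-dec joins? (optional T) (sub a) (sub b)) →-dec
     (joins? (required S) a b ⊎-dec joins? (optional S) a b)) ×-dec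
   Fin.all? (λ a → member? Fin._≟_ (sub a) (unfilled T) →-dec member? Fin._≟_ a (unfilled S)) ×-dec
   Fin.all? (λ b → Fin.any? λ c → joins? (required S) b c))
  where open Template

-- The template is the union of the parts S i, which overlap in the vertices
-- satisfying Base; lab tells in which part the other vertices lie.
record Splits (𝓣 : Target) (Base : Pred (Fin (Template.order (Target.template 𝓣))) 0ℓ) (k : ℕ)
  (lab : Fin (Template.order (Target.template 𝓣)) → Fin k) (S : Fin k → Template)
  (sub : ∀ i → Fin (Template.order (S i)) → Fin (Template.order (Target.template 𝓣))) : Set where
  constructor splits
  open Target 𝓣
  open Template template
  field
    edges-within   : All (λ (a , b) → lab a ≡ lab b ⊎ Base a ⊎ Base b) (required ++ optional)
    unfilled-apart : All (λ a → ¬ Base a × All (λ b → lab a ≡ lab b ⊎ (a , b) ∈ apart ⊎ (b , a) ∈ apart) unfilled) unfilled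
    parts          : ∀ i → IsPart template (λ a → Base a ⊎ lab a ≡ i) (S i) (sub i)

splits? : ∀ 𝓣 {Base} → Decidable Base → ∀ k lab S sub → Dec (Splits 𝓣 Base k lab S sub)
splits? 𝓣 Base? k lab S sub = map′ (λ (a , b , c) → splits a b c) (λ (splits a b c) → a , b , c)
  (All.all? (λ (a , b) → (lab a Fin.≟ lab b) ⊎-dec (Base? a ⊎-dec Base? b)) (required ++ optional) ×-dec
   All.all? (λ a → ¬? (Base? a) ×-dec All.all? (λ b → (lab a Fin.≟ lab b) ⊎-dec
     (member? (Product.≡-dec Fin._≟_ Fin._≟_) (a , b) apart ⊎-dec
      member? (Product.≡-dec Fin._≟_ Fin._≟_) (b , a) apart)) unfilled) unfilled ×-dec
   Fin.all? (λ i → isPart? template (λ a → Base? a ⊎-dec (lab a Fin.≟ i)) (S i) (sub i)))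
  where
  open Target 𝓣
  open Template template

module Blocks {n} (G : Graph (Fin n)) (noIso : NoIsolatedVertices G) {𝓣 : Target} (F : Fits G 𝓣)
  {Base k lab S sub} (spl : Splits 𝓣 Base k lab S sub) where
  open Graph G
  open Target 𝓣
  open Template template
  open Fits F
  open Splits spl

  V : Set
  V = Fin n

  View : V → Set
  View w = (∃ λ a → core a ≡ w) ⊎ (∃ λ b → b ∈ unfilled × w ~ core b × Fresh w)

  view : ∀ w → View w
  view w with Complement.isCore? finite-Fin core core-inj w
  ... | yes p = inj₁ p
  ... | no ¬a with noIso w
  ...   | x , w~x with Complement.isCore? finite-Fin core core-inj x
  ...     | yes (b , refl) = inj₂ (b , fresh-core (λ a p → ¬a (a , p)) b w~x , w~x , λ a p → ¬a (a , p))
  ...     | no ¬b = ⊥-elim (fresh-fresh (λ a p → ¬a (a , p)) (λ a p → ¬b (a , p)) w~x)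

  -- A vertex off the core takes the label of the unfilled neighbour that `view` happens to find.
  -- The choice is immaterial by `lab-unfilled`: unfilled vertices with different labels are
  -- separated and have no common neighbour off the core.
  label : V → Fin k
  label w = [ lab ∘ proj₁ , lab ∘ proj₁ ]′ (view w)

  label-core : ∀ a → label (core a) ≡ lab a
  label-core a with view (core a)
  ... | inj₁ (b , p) = cong lab (core-inj p)
  ... | inj₂ (_ , _ , _ , fresh) = ⊥-elim (fresh a refl)

  lab-unfilled : ∀ {w a b} → Fresh w → a ∈ unfilled → b ∈ unfilled → w ~ core a → w ~ core b → lab a ≡ lab b
  lab-unfilled fresh a∈ b∈ w~a w~b with All.lookup (proj₂ (All.lookup unfilled-apart a∈)) b∈
  ... | inj₁ p = p
  ... | inj₂ (inj₁ ab∈) = ⊥-elim (All.lookup (separated fresh) ab∈ w~a w~b)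
  ... | inj₂ (inj₂ ba∈) = ⊥-elim (All.lookup (separated fresh) ba∈ w~b w~a)

  label-fresh : ∀ {w b} → Fresh w → w ~ core b → label w ≡ lab b
  label-fresh {w} {b} fresh w~b with view w
  ... | inj₁ (a , p) = ⊥-elim (fresh a p)
  ... | inj₂ (c , c∈ , w~c , _) = lab-unfilled fresh c∈ (fresh-core fresh b w~b) w~c w~b

  IsBase : V → Set
  IsBase v = ∃ λ a → Base a × core a ≡ v

  label-edge : ∀ {u v} → u ~ v → label u ≡ label v ⊎ IsBase u ⊎ IsBase v
  label-edge {u} {v} u~v with view u | view v
  ... | inj₂ (_ , _ , _ , fu) | inj₂ (_ , _ , _ , fv) = ⊥-elim (fresh-fresh fu fv u~v)
  ... | inj₂ (c , c∈ , u~c , fu) | inj₁ (b , refl) = inj₁ (lab-unfilled fu c∈ (fresh-core fu b u~v) u~c u~v)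
  ... | inj₁ (a , refl) | inj₂ (c , c∈ , v~c , fv) =
    inj₁ (sym (lab-unfilled fv c∈ (fresh-core fv a (~-sym u~v)) v~c (~-sym u~v)))
  ... | inj₁ (a , refl) | inj₁ (b , refl) with core-allowed a b u~v
  ...   | p = Sum.map id (Sum.map (λ q → a , q , refl) (λ q → b , q , refl)) (within p)
    where
    within-sym : ∀ {x y} → lab x ≡ lab y ⊎ Base x ⊎ Base y → lab y ≡ lab x ⊎ Base y ⊎ Base x
    within-sym = Sum.map sym Sum.swap
    within : Joins required a b ⊎ Joins optional a b → lab a ≡ lab b ⊎ Base a ⊎ Base b
    within (inj₁ (inj₁ e)) = All.lookup edges-within (∈.∈-++⁺ˡ e)
    within (inj₁ (inj₂ e)) = within-sym (All.lookup edges-within (∈.∈-++⁺ˡ e))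
    within (inj₂ (inj₁ e)) = All.lookup edges-within (∈.∈-++⁺ʳ required e)
    within (inj₂ (inj₂ e)) = within-sym (All.lookup edges-within (∈.∈-++⁺ʳ required e))

  -- The predicate stays abstract because components use `label v ≡ i` and petals a Boolean test;
  -- irrelevance makes `∃ P` a subset in both cases.
  module Part (i : Fin k) {P : Pred V 0ℓ} (irr : Irrelevant P)
    (P⁺ : ∀ {v} → IsBase v ⊎ label v ≡ i → P v) (P⁻ : ∀ {v} → P v → IsBase v ⊎ label v ≡ i) where
    open IsPart (parts i)

    core-P : ∀ {a} → Base a ⊎ lab a ≡ i → P (core a)
    core-P {a} (inj₁ b) = P⁺ (inj₁ (a , b , refl))
    core-P {a} (inj₂ p) = P⁺ (inj₂ (trans (label-core a) p))

    core-P⁻ : ∀ {a} → P (core a) → Base a ⊎ lab a ≡ i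
    core-P⁻ {a} p with P⁻ p
    ... | inj₁ (b , q , r) = inj₁ (subst Base (core-inj r) q)
    ... | inj₂ q = inj₂ (trans (sym (label-core a)) q)

    core′ : Fin (Template.order (S i)) → ∃ P
    core′ b = core (sub i b) , core-P (inside b)

    fresh′ : ∀ {w : ∃ P} → (∀ b → core′ b ≢ w) → Fresh (proj₁ w)
    fresh′ {w , p} f a refl with covered a (core-P⁻ p)
    ... | b , q = f b (∃-≡ irr (cong core q))

    part-fits : Fits (induced G P) (S i separating [])
    part-fits = record
      { core          = core′
      ; core-inj      = λ p → sub-inj _ _ (core-inj (cong proj₁ p))
      ; core-required = λ a b → λ { (inj₁ p) → core-required _ _ (All.lookup edges p)
                                  ; (inj₂ p) → ~-sym (core-required _ _ (All.lookup edges p)) }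
      ; core-allowed  = λ a b p → no-more a b (core-allowed _ _ p)
      ; fresh-core    = λ f a p → unfilled⁻ a (fresh-core (fresh′ f) (sub i a) p)
      ; fresh-fresh   = λ f g → fresh-fresh (fresh′ f) (fresh′ g)
      ; separated     = λ _ → []
      }

    part-noIso : NoIsolatedVertices (induced G P)
    part-noIso (v , p) with view v
    ... | inj₁ (a , refl) with covered a (core-P⁻ p)
    ...   | b , refl with neighbour b
    ...     | c , inj₁ bc = core′ c , core-required _ _ (All.lookup edges bc)
    ...     | c , inj₂ cb = core′ c , ~-sym (core-required _ _ (All.lookup edges cb))
    part-noIso (v , p) | inj₂ (b , b∈ , v~b , fresh) = (core b , core-P (inj₂ (lab-b (P⁻ p)))) , v~b
      where
      lab-b : IsBase v ⊎ label v ≡ i → lab b ≡ i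
      lab-b (inj₁ (a , _ , q)) = ⊥-elim (fresh a q)
      lab-b (inj₂ q) = trans (sym (label-fresh fresh v~b)) q

Classified : ∀ {n} → Graph (Fin n) → Set
Classified G =
    (𝓑-C₇ G ⊎ 𝓑-P G ⊎ (∃ λ i → G ∈ᶠ 𝓑 i))
  ⊎ (E₁ G ⊎ E₂ G)
  ⊎ (¬ Connected G × (ThreeSmallComponents G ⊎ SmallAndLargeComponent G))

-- Disconnected graphs

smallᵀ : Bool → Template
smallᵀ true  = triangleᵀ
smallᵀ false = starᵀ 1

fits-small : ∀ b {W} {G : Graph W} {apart} → Finite W → NoIsolatedVertices G →
             Fits G (smallᵀ b separating apart) → TriangleOrStar G
fits-small true  fin noIso F = inj₁ (fits-triangle fin noIso F)
fits-small false fin noIso F = inj₂ (fits-star fin noIso F)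

-- Two required edges are enough for well-chosen roots: `0F` in a triangle or a star, and the vertex
-- `x₃` in the bowtie and in the families `𝓖₁`, `𝓖₂`, `𝓖₃`.
Reaches : (T : Template) {k : ℕ} (lab : Fin (Template.order T) → Fin k) (rep : Fin k → Fin (Template.order T)) → Set
Reaches T lab rep = (∀ i → lab (rep i) ≡ i) × (∀ a → a ≡ rep (lab a) ⊎ Joins required a (rep (lab a)) ⊎
  ∃ λ c → Joins required a c × Joins required c (rep (lab a)))
  where open Template T

reaches? : ∀ T {k} (lab : Fin (Template.order T) → Fin k) rep → Dec (Reaches T lab rep)
reaches? T lab rep = Fin.all? (λ i → lab (rep i) Fin.≟ i) ×-dec Fin.all? (λ a →
  (a Fin.≟ rep (lab a)) ⊎-dec joins? required a (rep (lab a)) ⊎-dec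
  Fin.any? λ c → joins? required a c ×-dec joins? required c (rep (lab a)))
  where open Template T

module Union {n} (G : Graph (Fin n)) (noIso : NoIsolatedVertices G) {𝓣 : Target} (F : Fits G 𝓣)
  {k lab S sub} (spl : Splits 𝓣 (λ _ → ⊥) k lab S sub)
  {rep} (reach : Reaches (Target.template 𝓣) lab rep) where
  open Graph G
  open Target 𝓣
  open Template template
  open Fits F
  open Blocks G noIso F spl

  step : ∀ {a b} → Joins required a b → Star _~_ (core a) (core b)
  step p = core-required _ _ p ◅ ε

  core-reach : ∀ a → Star _~_ (core a) (core (rep (lab a)))
  core-reach a with proj₂ reach a
  ... | inj₁ p = subst (Star _~_ (core a) ∘ core) p ε
  ... | inj₂ (inj₁ p) = step p
  ... | inj₂ (inj₂ (c , p , q)) = step p ◅◅ step q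

  vertex-reach : ∀ v → Star _~_ v (core (rep (label v)))
  vertex-reach v with view v
  ... | inj₁ (a , refl) = core-reach a
  ... | inj₂ (b , _ , v~b , _) = v~b ◅ core-reach b

  label-step : ∀ {u v} → u ~ v → label u ≡ label v
  label-step u~v with label-edge u~v
  ... | inj₁ p = p
  ... | inj₂ (inj₁ (_ , () , _))
  ... | inj₂ (inj₂ (_ , () , _))

  label-path : ∀ {u v} → Star _~_ u v → label u ≡ label v
  label-path ε = refl
  label-path (s ◅ ss) = trans (label-step s) (label-path ss)

  components : Components G k
  components = record
    { label            = label
    ; label-surjective = λ i → core (rep i) , λ { refl → trans (label-core (rep i)) (proj₁ reach i) }
    ; label-reachable  = λ u v → mk⇔
        (λ p → subst (Star _~_ u ∘ core ∘ rep) p (vertex-reach u) ◅◅ Star.reverse ~-sym (vertex-reach v))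
        label-path
    }

  disconnected : ∀ {i j : Fin k} → i ≢ j → ¬ Connected G
  disconnected {i} {j} i≢j con = i≢j (trans (sym (proj₁ reach i)) (trans (sym (label-core (rep i)))
    (trans (label-path (con (core (rep i)) (core (rep j)))) (trans (label-core (rep j)) (proj₁ reach j)))))

  labelled : ∀ {i v} → IsBase v ⊎ label v ≡ i → label v ≡ i
  labelled (inj₁ (_ , () , _))
  labelled (inj₂ p) = p

  label-irrelevant : ∀ {i} → Irrelevant (λ v → label v ≡ i)
  label-irrelevant = Decidable⇒UIP.≡-irrelevant Fin._≟_

  module Component (i : Fin k) = Part i {P = λ v → label v ≡ i} label-irrelevant labelled inj₂

  component-finite : ∀ i → Finite (∃ λ v → label v ≡ i)
  component-finite i = finite-subset finite-Fin (λ v → label v Fin.≟ i) label-irrelevant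

small-root : ∀ b → Fin (Template.order (smallᵀ b))
small-root true  = 0F
small-root false = 0F

module Three (a b c : Bool) where
  𝓣 : Target
  𝓣 = smallᵀ a ⊎ᵀ smallᵀ b ⊎ᵀ (smallᵀ c separating [])

  private
    o₀ o₁ o₂ : ℕ
    o₀ = Template.order (smallᵀ a)
    o₁ = Template.order (smallᵀ b)
    o₂ = Template.order (smallᵀ c)

  kind : Fin 3 → Bool
  kind 0F = a
  kind 1F = b
  kind 2F = c

  sub : ∀ i → Fin (Template.order (smallᵀ (kind i))) → Fin (o₀ + (o₁ + o₂))
  sub 0F v = v ↑ˡ (o₁ + o₂)
  sub 1F v = o₀ ↑ʳ (v ↑ˡ o₂)
  sub 2F v = o₀ ↑ʳ (o₁ ↑ʳ v)

  lab : Fin (o₀ + (o₁ + o₂)) → Fin 3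
  lab v = [ (λ _ → 0F) , (λ v → [ (λ _ → 1F) , (λ _ → 2F) ]′ (Fin.splitAt o₁ v)) ]′ (Fin.splitAt o₀ v)

  splits-dec : Dec (Splits 𝓣 (λ _ → ⊥) 3 lab (smallᵀ ∘ kind) sub)
  splits-dec = splits? 𝓣 (λ _ → no λ ()) 3 lab (smallᵀ ∘ kind) sub

  reaches-dec : Dec (Reaches (Target.template 𝓣) lab (λ i → sub i (small-root (kind i))))
  reaches-dec = reaches? (Target.template 𝓣) lab (λ i → sub i (small-root (kind i)))

  -- For concrete Booleans the two implicit arguments evaluate to the unit type and are filled in
  -- without a written proof.
  classify : {_ : True splits-dec} {_ : True reaches-dec} → ∀ {n} (G : Graph (Fin n)) →
             NoIsolatedVertices G → Fits G 𝓣 → Classified G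
  classify {spl} {reach} G noIso F = inj₂ (inj₂ (U.disconnected {0F} {1F} (λ ()) ,
    inj₁ (U.components , λ i → fits-small (kind i) (U.component-finite i)
      (U.Component.part-noIso i) (U.Component.part-fits i))))
    where module U = Union G noIso F (toWitness {a? = splits-dec} spl) (toWitness {a? = reaches-dec} reach)

module Two (a : Bool) (L : Template) (root : Fin (Template.order L)) where
  𝓣 : Target
  𝓣 = smallᵀ a ⊎ᵀ (L separating [])

  private
    o₀ o₁ : ℕ
    o₀ = Template.order (smallᵀ a)
    o₁ = Template.order L

  part : Fin 2 → Template
  part 0F = smallᵀ a
  part 1F = L

  sub : ∀ i → Fin (Template.order (part i)) → Fin (o₀ + o₁)
  sub 0F v = v ↑ˡ o₁
  sub 1F v = o₀ ↑ʳ v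

  lab : Fin (o₀ + o₁) → Fin 2
  lab v = [ (λ _ → 0F) , (λ _ → 1F) ]′ (Fin.splitAt o₀ v)

  rep : Fin 2 → Fin (o₀ + o₁)
  rep 0F = sub 0F (small-root a)
  rep 1F = sub 1F root

  splits-dec : Dec (Splits 𝓣 (λ _ → ⊥) 2 lab part sub)
  splits-dec = splits? 𝓣 (λ _ → no λ ()) 2 lab part sub

  reaches-dec : Dec (Reaches (Target.template 𝓣) lab rep)
  reaches-dec = reaches? (Target.template 𝓣) lab rep

  classify : {_ : True splits-dec} {_ : True reaches-dec} →
             (∀ {W} {H : Graph W} → H ∈ᶠ L → BowtieOr𝓖 H) → ∀ {n} (G : Graph (Fin n)) →
             NoIsolatedVertices G → Fits G 𝓣 → Classified G
  classify {spl} {reach} large G noIso F = inj₂ (inj₂ (U.disconnected {0F} {1F} (λ ()) ,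
    inj₂ (U.components ,
      fits-small a (U.component-finite 0F) (U.Component.part-noIso 0F) (U.Component.part-fits 0F) ,
      large (fits⇒∈ᶠ (U.component-finite 1F) (U.Component.part-noIso 1F) (U.Component.part-fits 1F)))))
    where module U = Union G noIso F (toWitness {a? = splits-dec} spl) (toWitness {a? = reaches-dec} reach)

-- Graphs glued at a vertex

record Realises (H : PointedGraph) {W} (G : Graph W) (w : W) : Set where
  private module H = PointedGraph H
  field
    embed     : H.Vertex → W
    injective : Injective _≡_ _≡_ embed
    onto      : ∀ v → ∃ λ a → embed a ≡ v
    adjacent  : ∀ a b → Graph._~_ H.graph a b ⇔ Graph._~_ G (embed a) (embed b)
    point     : embed H.point ≡ w

IsGraphOf : (T : Template) → Graph (Fin (Template.order T)) → Set
IsGraphOf T H = ∀ a b → (Joins required a b → a ~ b) × (a ~ b → Joins required a b)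
  where
  open Template T
  open Graph H

isGraphOf? : ∀ T H → Dec (IsGraphOf T H)
isGraphOf? T H = Fin.all? λ a → Fin.all? λ b →
  (joins? required a b →-dec (a ~? b)) ×-dec ((a ~? b) →-dec joins? required a b)
  where
  open Template T
  open Graph H

realise-rigid : ∀ {T} (H : Graph (Fin (Template.order T))) → IsGraphOf T H →
  Template.optional T ≡ [] → Template.unfilled T ≡ [] →
  ∀ {W} {G : Graph W} {apart} → Finite W → NoIsolatedVertices G → (F : Fits G (T separating apart)) →
  ∀ a → Realises (pointed H a) G (Fits.core F a)
realise-rigid H isH no-optional no-unfilled fin noIso F a = record
  { embed     = core
  ; injective = core-inj
  ; onto      = core-onto
  ; adjacent  = λ a b → mk⇔ (λ p → core-required a b (proj₂ (isH a b) p)) (λ p → proj₁ (isH a b) (required⁻ a b p))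
  ; point     = refl
  }
  where
  open Fits F
  open Rigid fin noIso F no-optional no-unfilled

realise-star : ∀ {W} {G : Graph W} {apart} → Finite W → NoIsolatedVertices G → (F : Fits G (starᵀ 2 separating apart)) →
  ∃ λ p → Realises (petal p) G (Fits.core F 1F)
-- The leaf `zero` of the petal is the vertex `suc zero` of `S`, which the numbering sends to the
-- core vertex `1F`; this is why `point` holds by `refl`.
realise-star fin noIso F = star (2 + _∈ᶠ_.extra (fits⇒∈ᶠ fin noIso F)) (s≤s (s≤s z≤n)) zero , record
  { embed     = embed
  ; injective = λ {a} {b} p → trans (sym (strictlyInverseʳ a)) (trans (cong from p) (strictlyInverseʳ b))
  ; onto      = λ v → from v , strictlyInverseˡ v
  ; adjacent  = λ a b → mk⇔ (Equivalence.from (embed-adjacent a b)) (Equivalence.to (embed-adjacent a b))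
  ; point     = refl
  }
  where
  open StarNumbering fin noIso F
  open Inverse numbering

module Glue {n} (G : Graph (Fin n)) (noIso : NoIsolatedVertices G) {𝓣 : Target} (F : Fits G 𝓣)
  (basepoint : Fin (Template.order (Target.template 𝓣)))
  {k lab S sub} (spl : Splits 𝓣 (_≡ basepoint) (suc k) lab S sub) where
  open Graph G
  open Fits F
  open Blocks G noIso F spl

  base : V
  base = core basepoint

  -- The base vertex may satisfy both disjuncts, and a sum type would then have two proofs; `T` of a
  -- Boolean has at most one.
  On : Fin (suc k) → Pred V 0ℓ
  On i v = T (⌊ v Fin.≟ base ⌋ ∨ ⌊ label v Fin.≟ i ⌋)

  on⁺ : ∀ {i v} → IsBase v ⊎ label v ≡ i → On i v
  on⁺ {i} {v} (inj₁ (_ , refl , p)) = Equivalence.from (T-∨ {⌊ v Fin.≟ base ⌋}) (inj₁ (fromWitness {a? = v Fin.≟ base} (sym p)))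
  on⁺ {i} {v} (inj₂ p) = Equivalence.from (T-∨ {⌊ v Fin.≟ base ⌋}) (inj₂ (fromWitness {a? = label v Fin.≟ i} p))

  on⁻ : ∀ {i v} → On i v → IsBase v ⊎ label v ≡ i
  on⁻ {i} {v} t with Equivalence.to (T-∨ {⌊ v Fin.≟ base ⌋}) t
  ... | inj₁ p = inj₁ (basepoint , refl , sym (toWitness {a? = v Fin.≟ base} p))
  ... | inj₂ p = inj₂ (toWitness {a? = label v Fin.≟ i} p)

  block : ∀ i → Graph (∃ (On i))
  block i = induced G (On i)

  module Block (i : Fin (suc k)) = Part i {P = On i} T-irrelevant on⁺ on⁻

  on-finite : ∀ i → Finite (∃ (On i))
  on-finite i = finite-subset finite-Fin (λ v → T? _) T-irrelevant

  -- An edge at the base belongs to the block of its other end.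
  edge-on : ∀ {u v} → u ~ v → ∃ λ i → On i u × On i v
  edge-on {u} {v} u~v with label-edge u~v
  ... | inj₁ p        = label v , on⁺ (inj₂ p) , on⁺ (inj₂ refl)
  ... | inj₂ (inj₁ b) = label v , on⁺ (inj₁ b) , on⁺ (inj₂ refl)
  ... | inj₂ (inj₂ b) = label u , on⁺ (inj₂ refl) , on⁺ (inj₁ b)

  isGluing : (Hs : Vec PointedGraph (suc k)) →
    (∀ i → ∃ λ w → proj₁ w ≡ base × Realises (lookup Hs i) (block i) w) → IsGluing Hs G
  isGluing Hs real = record
    { base          = base
    ; embed         = λ i a → proj₁ (embed i a)
    ; embed-inj     = λ i p → injective i (∃-≡ T-irrelevant p)
    ; embed-point   = λ i → trans (cong proj₁ (point i)) (proj₁ (proj₂ (real i)))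
    ; embed-overlap = λ i j a b i≢j p → overlap-base i≢j (on⁻ (proj₂ (embed i a)))
                        (on⁻ (subst (On j) (sym p) (proj₂ (embed j b))))
    ; embed-cover   = λ v → label v , proj₁ (onto (label v) (v , on⁺ (inj₂ refl))) ,
                        cong proj₁ (proj₂ (onto (label v) (v , on⁺ (inj₂ refl))))
    ; adjacency     = λ u v → mk⇔ split join
    }
    where
    open module R (i : Fin (suc k)) = Realises (proj₂ (proj₂ (real i)))

    overlap-base : ∀ {i j v} → i ≢ j → IsBase v ⊎ label v ≡ i → IsBase v ⊎ label v ≡ j → v ≡ base
    overlap-base i≢j (inj₁ (_ , refl , p)) _ = sym p
    overlap-base i≢j _ (inj₁ (_ , refl , p)) = sym p
    overlap-base i≢j (inj₂ p) (inj₂ q) = ⊥-elim (i≢j (trans (sym p) q))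

    Split : V → V → Set
    Split u v = ∃ λ i → ∃ λ a → ∃ λ b → proj₁ (embed i a) ≡ u × proj₁ (embed i b) ≡ v ×
      Graph._~_ (PointedGraph.graph (lookup Hs i)) a b

    split : ∀ {u v} → u ~ v → Split u v
    split {u} {v} u~v with edge-on u~v
    ... | i , on-u , on-v with onto i (u , on-u) | onto i (v , on-v)
    ...   | a , p | b , q = i , a , b , cong proj₁ p , cong proj₁ q ,
      Equivalence.from (adjacent i a b) (subst₂ (Graph._~_ (block i)) (sym p) (sym q) u~v)

    join : ∀ {u v} → Split u v → u ~ v
    join (i , a , b , refl , refl , p) = Equivalence.to (adjacent i a b) p

petalᵀ : Bool → Template
petalᵀ true  = triangleᵀ
petalᵀ false = starᵀ 2

petal-point : ∀ b → Fin (Template.order (petalᵀ b))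
petal-point true  = 0F
petal-point false = 1F

realise-petal : ∀ b {W} {G : Graph W} {apart} → Finite W → NoIsolatedVertices G →
  (F : Fits G (petalᵀ b separating apart)) → ∃ λ p → Realises (petal p) G (Fits.core F (petal-point b))
realise-petal true fin noIso F =
  triangle 0F , realise-rigid (K 3) (toWitness {a? = isGraphOf? triangleᵀ (K 3)} tt) refl refl fin noIso F 0F
realise-petal false fin noIso F = realise-star fin noIso F

K₄ᵀ C₄ᵀ : Template
K₄ᵀ = record
  { order    = 4
  ; required = (0F , 1F) ∷ (0F , 2F) ∷ (0F , 3F) ∷ (1F , 2F) ∷ (1F , 3F) ∷ (2F , 3F) ∷ []
  ; optional = []
  ; unfilled = []
  }
C₄ᵀ = record
  { order    = 4
  ; required = (0F , 1F) ∷ (1F , 2F) ∷ (2F , 3F) ∷ (3F , 0F) ∷ []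
  ; optional = []
  ; unfilled = []
  }

realise-K₄ : ∀ {W} {G : Graph W} {apart} → Finite W → NoIsolatedVertices G → (F : Fits G (K₄ᵀ separating apart)) →
             Realises (pointed (K 4) 0F) G (Fits.core F 0F)
realise-K₄ fin noIso F = realise-rigid (K 4) (toWitness {a? = isGraphOf? K₄ᵀ (K 4)} tt) refl refl fin noIso F 0F

realise-C₄ : ∀ {W} {G : Graph W} {apart} → Finite W → NoIsolatedVertices G → (F : Fits G (C₄ᵀ separating apart)) →
             Realises (pointed C₄ 0F) G (Fits.core F 0F)
realise-C₄ fin noIso F = realise-rigid C₄ (toWitness {a? = isGraphOf? C₄ᵀ C₄} tt) refl refl fin noIso F 0F

module Petals (𝓣 : Target) (base : Fin (Template.order (Target.template 𝓣)))
  (lab : Fin (Template.order (Target.template 𝓣)) → Fin 3) (kind : Fin 3 → Bool)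
  (sub : ∀ i → Fin (Template.order (petalᵀ (kind i))) → Fin (Template.order (Target.template 𝓣)))
  (sub-point : ∀ i → sub i (petal-point (kind i)) ≡ base) where

  splits-dec : Dec (Splits 𝓣 (_≡ base) 3 lab (petalᵀ ∘ kind) sub)
  splits-dec = splits? 𝓣 (Fin._≟ base) 3 lab (petalᵀ ∘ kind) sub

  glued : {_ : True splits-dec} → ∀ {n} (G : Graph (Fin n)) → NoIsolatedVertices G → Fits G 𝓣 → 𝓑-P G
  glued {spl} G noIso F = proj₁ (at 0F) , proj₁ (at 1F) , proj₁ (at 2F) , isGluing _
    λ { 0F → _ , cong core (sub-point 0F) , proj₂ (at 0F)
      ; 1F → _ , cong core (sub-point 1F) , proj₂ (at 1F)
      ; 2F → _ , cong core (sub-point 2F) , proj₂ (at 2F) }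
    where
    open Fits F
    open Glue G noIso F base (toWitness {a? = splits-dec} spl)
    at : ∀ i → ∃ λ p → Realises (petal p) (block i) (Block.core′ i (petal-point (kind i)))
    at i = realise-petal (kind i) (on-finite i) (Block.part-noIso i) (Block.part-fits i)


petal-lab : Fin 7 → Fin 3
petal-lab = lookup (0F ∷ 0F ∷ 0F ∷ 1F ∷ 1F ∷ 2F ∷ 2F ∷ [])

star-kind₂ star-kind₁ : Fin 3 → Bool
star-kind₂ = lookup (false ∷ true ∷ true ∷ [])
star-kind₁ = lookup (false ∷ false ∷ true ∷ [])

petals₃-sub : ∀ (i : Fin 3) → Fin 3 → Fin 7
petals₃-sub 0F = lookup (0F ∷ 1F ∷ 2F ∷ [])
petals₃-sub 1F = lookup (0F ∷ 3F ∷ 4F ∷ [])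
petals₃-sub 2F = lookup (0F ∷ 5F ∷ 6F ∷ [])

-- In `starᵀ 2` the centre comes first and the gluing vertex is the leaf `1F`, hence the order `1F`,
-- `0F`, `2F`.
petals₂-sub : ∀ i → Fin (Template.order (petalᵀ (star-kind₂ i))) → Fin 7
petals₂-sub 0F = lookup (1F ∷ 0F ∷ 2F ∷ [])
petals₂-sub 1F = petals₃-sub 1F
petals₂-sub 2F = petals₃-sub 2F

petals₁-sub : ∀ i → Fin (Template.order (petalᵀ (star-kind₁ i))) → Fin 7
petals₁-sub 0F = lookup (1F ∷ 0F ∷ 2F ∷ [])
petals₁-sub 1F = lookup (3F ∷ 0F ∷ 4F ∷ [])
petals₁-sub 2F = petals₃-sub 2F

petals₃-point : ∀ i → petals₃-sub i 0F ≡ 0F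
petals₃-point 0F = refl
petals₃-point 1F = refl
petals₃-point 2F = refl

petals₂-point : ∀ i → petals₂-sub i (petal-point (star-kind₂ i)) ≡ 0F
petals₂-point 0F = refl
petals₂-point 1F = refl
petals₂-point 2F = refl

petals₁-point : ∀ i → petals₁-sub i (petal-point (star-kind₁ i)) ≡ 0F
petals₁-point 0F = refl
petals₁-point 1F = refl
petals₁-point 2F = refl

module Petals₃ = Petals (petals₃ᵀ separating []) 0F petal-lab (λ _ → true) petals₃-sub petals₃-point
module Petals₂ = Petals (petals₂ᵀ separating []) 0F petal-lab star-kind₂ petals₂-sub petals₂-point
module Petals₁ = Petals (petals₁ᵀ separating ((1F , 3F) ∷ [])) 0F petal-lab star-kind₁ petals₁-sub petals₁-point

exceptional-lab : Fin 7 → Fin 2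
exceptional-lab = lookup (0F ∷ 0F ∷ 0F ∷ 0F ∷ 1F ∷ 1F ∷ 1F ∷ [])

exceptional-sub : Fin 2 → Fin 4 → Fin 7
exceptional-sub 0F = lookup (0F ∷ 1F ∷ 2F ∷ 3F ∷ [])
exceptional-sub 1F = lookup (0F ∷ 4F ∷ 5F ∷ 6F ∷ [])

K₄-K₄ K₄-C₄ : Fin 2 → Template
K₄-K₄ _ = K₄ᵀ
K₄-C₄ 0F = K₄ᵀ
K₄-C₄ 1F = C₄ᵀ

E₁-splits : Splits (E₁ᵀ separating []) (_≡ 0F) 2 exceptional-lab K₄-K₄ (λ i → exceptional-sub i)
E₁-splits = toWitness {a? = splits? (E₁ᵀ separating []) (Fin._≟ 0F) 2 exceptional-lab K₄-K₄ λ i → exceptional-sub i} tt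

E₂-sub : ∀ i → Fin (Template.order (K₄-C₄ i)) → Fin 7
E₂-sub 0F = exceptional-sub 0F
E₂-sub 1F = exceptional-sub 1F

E₂-splits : Splits (E₂ᵀ separating []) (_≡ 0F) 2 exceptional-lab K₄-C₄ E₂-sub
E₂-splits = toWitness {a? = splits? (E₂ᵀ separating []) (Fin._≟ 0F) 2 exceptional-lab K₄-C₄ E₂-sub} tt

module _ {n} (G : Graph (Fin n)) (noIso : NoIsolatedVertices G) where

  fits-E₁ : Fits G (E₁ᵀ separating []) → E₁ G
  fits-E₁ F = isGluing _
    λ { 0F → _ , refl , realise-K₄ (on-finite 0F) (Block.part-noIso 0F) (Block.part-fits 0F)
      ; 1F → _ , refl , realise-K₄ (on-finite 1F) (Block.part-noIso 1F) (Block.part-fits 1F) }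
    where open Glue G noIso F 0F E₁-splits

  fits-E₂ : Fits G (E₂ᵀ separating []) → E₂ G
  fits-E₂ F = isGluing _
    λ { 0F → _ , refl , realise-K₄ (on-finite 0F) (Block.part-noIso 0F) (Block.part-fits 0F)
      ; 1F → _ , refl , realise-C₄ (on-finite 1F) (Block.part-noIso 1F) (Block.part-fits 1F) }
    where open Glue G noIso F 0F E₂-splits

  private
    family : ∀ i → Fits G (𝓑 i separating []) → Classified G
    family i F = inj₁ (inj₂ (inj₂ (i , fits⇒∈ᶠ finite-Fin noIso F)))

    petals : 𝓑-P G → Classified G
    petals = inj₁ ∘ inj₂ ∘ inj₁

  classify : All (λ 𝓣 → Fits G 𝓣 → Classified G) targets
  classify =
    family 0F ∷ family 1F ∷ family 2F ∷ family 3F ∷ family 4F ∷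
    family 5F ∷ family 6F ∷ family 7F ∷ family 8F ∷
    (inj₂ ∘ inj₁ ∘ inj₁ ∘ fits-E₁) ∷ (inj₂ ∘ inj₁ ∘ inj₂ ∘ fits-E₂) ∷
    (petals ∘ Petals₃.glued G noIso) ∷ (petals ∘ Petals₂.glued G noIso) ∷ (petals ∘ Petals₁.glued G noIso) ∷
    Three.classify true true true G noIso ∷
    Three.classify false true true G noIso ∷
    Three.classify false false true G noIso ∷
    Two.classify true bowtie 2F inj₁ G noIso ∷ Two.classify false bowtie 2F inj₁ G noIso ∷
    Two.classify true 𝓖₁ 2F (inj₂ ∘ inj₁) G noIso ∷ Two.classify false 𝓖₁ 2F (inj₂ ∘ inj₁) G noIso ∷
    Two.classify true 𝓖₂ 2F (inj₂ ∘ inj₂ ∘ inj₁) G noIso ∷ Two.classify false 𝓖₂ 2F (inj₂ ∘ inj₂ ∘ inj₁) G noIso ∷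
    Two.classify true 𝓖₃ 2F (inj₂ ∘ inj₂ ∘ inj₂) G noIso ∷ Two.classify false 𝓖₃ 2F (inj₂ ∘ inj₂ ∘ inj₂) G noIso ∷ []

-- Saturated templates

-- The trace of a vertex of a graph in a family: its number in the core, or
-- nothing for a new vertex.
Trace : ℕ → Set
Trace o = Maybe (Fin o)

module _ {o : ℕ} where

  -- Tests equality of the vertices, whereas `equal` compares traces: two new vertices have the same
  -- trace but may differ, so `nothing` is never the same as `nothing`. This can only leave too many
  -- possible edges. On required edges the test is exact, because their ends are in the core.
  same : Trace o → Trace o → Bool
  same (just a) (just b) = ⌊ a Fin.≟ b ⌋
  same _        _        = false

  clear : Trace o × Trace o → Trace o × Trace o → Bool
  clear (a , b) (c , d) = (not (same a c) ∧ not (same a d)) ∧ (not (same b c) ∧ not (same b d))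

  equal : Trace o → Trace o → Bool
  equal nothing  nothing  = true
  equal (just a) (just b) = ⌊ a Fin.≟ b ⌋
  equal _        _        = false

  connects : List (Trace o × Trace o) → Trace o → Trace o → Bool
  connects es x y = any (λ (a , b) → (equal a x ∧ equal b y) ∨ (equal a y ∧ equal b x)) es

  off : Trace o × Trace o → Trace o × Trace o → Trace o → Bool
  off (a , b) (c , d) x = (not (same x a) ∧ not (same x b)) ∧ (not (same x c) ∧ not (same x d))

  leaves : Trace o × Trace o → Trace o × Trace o → Trace o × Trace o → Bool
  leaves e f (u , v) = off e f u ∨ off e f v

  -- Either a required edge has an endpoint off the disjoint edges e and f, or
  -- e and f are not opposite edges of a 4-cycle.
  escapes : (al rq : List (Trace o × Trace o)) → Trace o × Trace o → Trace o × Trace o → Bool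
  escapes al rq (a , b) (c , d) = any (leaves (a , b) (c , d)) rq ∨
    (not (connects al b c ∧ connects al d a) ∧ not (connects al b d ∧ connects al c a))

  -- The argument is one less than the number of edges that may still be added: at 1 the link of the
  -- chosen edges is one-dimensional, and only then is connectedness at stake.
  squares : ℕ → (al rq : List (Trace o × Trace o)) → Bool
  squares (suc zero) al rq = all (λ e → all (escapes al rq e) (filterᵇ (clear e) al)) al
  squares _          al rq = true

  -- al and rq are the possible and the required edges disjoint from the chosen
  -- ones, of which d may still be added.
  saturated : (d : ℕ) (al rq : List (Trace o × Trace o)) → Bool
  saturated zero    []      rq = true
  saturated zero    (_ ∷ _) rq = false
  saturated (suc d) al      rq =
    any (λ _ → true) rq ∧
    squares d al rq ∧
    all (λ e → saturated d (filterᵇ (clear e) al) (filterᵇ (clear e) rq)) al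

saturated-zero : ∀ {o} (al : List (Trace o × Trace o)) {rq e} → T (saturated zero al rq) → e ∉ al
saturated-zero [] _ ()

-- One pair per unfilled vertex stands for its edges to all new vertices, however many there are.
possibleEdges requiredEdges : (𝓣 : Template) → List (Trace (Template.order 𝓣) × Trace (Template.order 𝓣))
requiredEdges 𝓣 = map (Product.map just just) (Template.required 𝓣)
possibleEdges 𝓣 = requiredEdges 𝓣 ++ map (Product.map just just) (Template.optional 𝓣) ++
                  map (λ g → just g , nothing) (Template.unfilled 𝓣)

saturatedTemplate : ℕ → Template → Bool
saturatedTemplate d 𝓣 = saturated d (possibleEdges 𝓣) (requiredEdges 𝓣)

all-filter : ∀ {A : Set} (p : A → Bool) {xs x} → x ∈ xs → T (p x) → x ∈ filterᵇ p xs
all-filter p x∈ px = ∈.∈-filter⁺ (T? ∘ p) x∈ px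

filter⁻ : ∀ {A : Set} (p : A → Bool) {xs x} → x ∈ filterᵇ p xs → x ∈ xs × T (p x)
filter⁻ p = ∈.∈-filter⁻ (T? ∘ p)

module Family {V : Set} (G : Graph V) {𝓣 : Template} (F : G ∈ᶠ 𝓣) where
  open Graph G
  open Template 𝓣
  open _∈ᶠ_ F

  private
    Edges : Set
    Edges = List (Trace order × Trace order)

    trace′ : Fin order ⊎ Fin extra → Trace order
    trace′ = [ just , (λ _ → nothing) ]′

  trace : V → Trace order
  trace v = trace′ (Inverse.from vertices v)

  trace-core : ∀ a → trace (core a) ≡ just a
  trace-core a = cong trace′ (Inverse.strictlyInverseʳ vertices (inj₁ a))

  trace⁻ : ∀ {v a} → trace v ≡ just a → core a ≡ v
  trace⁻ {v} p with Inverse.from vertices v | Inverse.strictlyInverseˡ vertices v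
  trace⁻ refl | inj₁ a | q = q

  traces : V × V → Trace order × Trace order
  traces = Product.map trace trace

  possible : ∀ {u v} → u ~ v → Joins (possibleEdges 𝓣) (trace u) (trace v)
  possible {u} {v} u~v with Inverse.from vertices u | Inverse.strictlyInverseˡ vertices u
                          | Inverse.from vertices v | Inverse.strictlyInverseˡ vertices v
  ... | inj₁ a | refl | inj₁ b | refl with core-allowed a b u~v
  ...   | inj₁ p = Sum.map (∈.∈-++⁺ˡ ∘ ∈.∈-map⁺ (Product.map just just)) (∈.∈-++⁺ˡ ∘ ∈.∈-map⁺ (Product.map just just)) p
  ...   | inj₂ p = Sum.map opt opt p
    where
    opt : ∀ {e} → e ∈ optional → Product.map just just e ∈ possibleEdges 𝓣
    opt = ∈.∈-++⁺ʳ (requiredEdges 𝓣) ∘ ∈.∈-++⁺ˡ ∘ ∈.∈-map⁺ (Product.map just just)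
  possible u~v | inj₁ a | refl | inj₂ j | refl = inj₁ (∈.∈-++⁺ʳ (requiredEdges 𝓣)
    (∈.∈-++⁺ʳ (map (Product.map just just) optional) (∈.∈-map⁺ (λ g → just g , nothing) (new-core j a (~-sym u~v)))))
  possible u~v | inj₂ i | refl | inj₁ b | refl = inj₂ (∈.∈-++⁺ʳ (requiredEdges 𝓣)
    (∈.∈-++⁺ʳ (map (Product.map just just) optional) (∈.∈-map⁺ (λ g → just g , nothing) (new-core i b u~v))))
  possible u~v | inj₂ i | refl | inj₂ j | refl = ⊥-elim (new-new i j u~v)

  same⁻ : ∀ {u v} → T (same (trace u) (trace v)) → u ≡ v
  same⁻ {u} {v} t with trace u in p | trace v in q
  ... | just a | just b with toWitness {a? = a Fin.≟ b} t
  ...   | refl = trans (sym (trace⁻ p)) (trace⁻ q)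

  ≢⇒not-same : ∀ {u v} → u ≢ v → T (not (same (trace u) (trace v)))
  ≢⇒not-same {u} {v} u≢v with same (trace u) (trace v) in p
  ... | false = tt
  ... | true  = u≢v (same⁻ (subst T (sym p) tt))

  ∧⁺ : ∀ {x y} → T x → T y → T (x ∧ y)
  ∧⁺ {true} _ q = q

  clear⁺ : ∀ {e f} → Disjoint e f → T (clear (traces e) (traces f))
  clear⁺ ((p , q) , (r , s)) =
    ∧⁺ (∧⁺ (≢⇒not-same p) (≢⇒not-same q)) (∧⁺ (≢⇒not-same r) (≢⇒not-same s))

  not-same⁻ : ∀ {a v} → T (not (same (just a) (trace v))) → core a ≢ v
  not-same⁻ {a} {v} t refl = not⁻ t (subst (T ∘ same (just a)) (sym (trace-core a)) (fromWitness {a? = a Fin.≟ a} refl))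

  equal-refl : ∀ (x : Trace order) → T (equal x x)
  equal-refl nothing  = tt
  equal-refl (just a) = fromWitness {a? = a Fin.≟ a} refl

  connects⁺ : ∀ (es : Edges) {x y} → Joins es x y → T (connects es x y)
  connects⁺ es {x} {y} p = any⁺ _ ([ Any.map forth , Any.map back ]′ p)
    where
    forth : ∀ {e} → (x , y) ≡ e → T ((equal (proj₁ e) x ∧ equal (proj₂ e) y) ∨ (equal (proj₁ e) y ∧ equal (proj₂ e) x))
    forth refl = Equivalence.from (T-∨ {equal x x ∧ equal y y})
      (inj₁ (∧⁺ {equal x x} (equal-refl x) (equal-refl y)))
    back : ∀ {e} → (y , x) ≡ e → T ((equal (proj₁ e) x ∧ equal (proj₂ e) y) ∨ (equal (proj₁ e) y ∧ equal (proj₂ e) x))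
    back refl = Equivalence.from (T-∨ {equal y x ∧ equal x y})
      (inj₂ (∧⁺ {equal y y} (equal-refl y) (equal-refl x)))

  -- The edges disjoint from `es` are enclosed between `rq` and `al`. The upper bound serves
  -- `bounded` and the detection of 4-cycles, the lower bound supplies the witnesses for `extend`
  -- and `escape`.
  record Inv (es : List (V × V)) (al rq : Edges) : Set where
    field
      available : ∀ {u v} → u ~ v → All (Disjoint (u , v)) es → Joins al (trace u) (trace v)
      present   : ∀ {e} → e ∈ rq → ∃ λ a → ∃ λ b → e ≡ (just a , just b) × core a ~ core b ×
                  All (Disjoint (core a , core b)) es

  open Inv

  start : Inv [] (possibleEdges 𝓣) (requiredEdges 𝓣)
  start .available u~v _ = possible u~v
  start .present e∈ with ∈.∈-map⁻ (Product.map just just) e∈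
  ... | (a , b) , ab∈ , refl = a , b , refl , core-required a b (inj₁ ab∈) , []

  clear⁻ : ∀ {e : V × V} {x y : V} {a b} → Ends x y e → T (clear (trace x , trace y) (just a , just b)) →
           Disjoint (core a , core b) e
  clear⁻ {e} {x} {y} {a} {b} en t = ends-disjoint fwd (ends-reverse en) (disjoint-sym ((p , q) , (r , s)))
    where
    ts = ∧⁻ {not (same (trace x) (just a)) ∧ not (same (trace x) (just b))} t
    ps = ∧⁻ {not (same (trace x) (just a))} (proj₁ ts)
    qs = ∧⁻ {not (same (trace y) (just a))} (proj₂ ts)
    away : ∀ {v a} → T (not (same (trace v) (just a))) → v ≢ core a
    away {v} {a} t refl = not⁻ t (subst (λ x → T (same x (just a))) (sym (trace-core a)) (fromWitness {a? = a Fin.≟ a} refl))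
    p = away (proj₁ ps)
    q = away (proj₂ ps)
    r = away (proj₁ qs)
    s = away (proj₂ qs)

  next : ∀ {es al rq e x y} → Inv es al rq → Ends x y e →
         Inv (e ∷ es) (filterᵇ (clear (trace x , trace y)) al) (filterᵇ (clear (trace x , trace y)) rq)
  next {e = e} inv en .available {u} {v} u~v (uv#e ∷ uv#es) =
    Sum.map (λ p → all-filter _ p (clear⁺ (ends-disjoint en fwd (disjoint-sym uv#e))))
            (λ p → all-filter _ p (clear⁺ (ends-disjoint en bwd (disjoint-sym uv#e))))
            (inv .available u~v uv#es)
  next inv en .present e∈ with filter⁻ _ e∈
  ... | e∈rq , t with inv .present e∈rq
  ...   | a , b , refl , a~b , ab# = a , b , refl , a~b , clear⁻ en t ∷ ab#

  module _ (D : ℕ) (check : T (saturatedTemplate D 𝓣)) where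

    record Reached (es : List (V × V)) : Set where
      field
        left : ℕ
        al rq : Edges
        size : left + length es ≡ D
        good : T (saturated left al rq)
        inv  : Inv es al rq

    reached : ∀ es → Matching G es → Reached es
    reached [] _ = record { size = ℕ.+-identityʳ D ; good = check ; inv = start }
    reached ((u , v) ∷ es) (u~v ∷ adj , uv# ∷ dis) with reached es (adj , dis)
    ... | record { left = left ; al = al ; rq = rq ; size = size ; good = good ; inv = inv } =
      advance left size good (oriented (inv .available u~v uv#))
      where
      oriented : Joins al (trace u) (trace v) → ∃ λ x → ∃ λ y → Ends x y (u , v) × (trace x , trace y) ∈ al
      oriented (inj₁ p) = _ , _ , fwd , p
      oriented (inj₂ p) = _ , _ , bwd , p

      advance : ∀ d → d + length es ≡ D → T (saturated d al rq) →
                (∃ λ x → ∃ λ y → Ends x y (u , v) × (trace x , trace y) ∈ al) → Reached ((u , v) ∷ es)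
      advance zero size good (_ , _ , _ , e∈) = ⊥-elim (saturated-zero al good e∈)
      advance (suc d) size good (x , y , en , e∈) = record
        { size = trans (ℕ.+-suc d (length es)) size
        ; good = All.lookup (all⁻ _ al (proj₂ (∧⁻ {squares d al rq} (proj₂ (∧⁻ {any (λ _ → true) rq} good))))) e∈
        ; inv  = next inv en
        }

    family-bounded : ∀ es → Matching G es → length es ≤ D
    family-bounded es m = subst (length es ≤_) (Reached.size r) (ℕ.m≤n+m (length es) (Reached.left r))
      where r = reached es m

    family-extend : ∀ es → Matching G es → length es < D → ∃ λ f → Matching G (f ∷ es)
    family-extend es m@(adj , dis) lt with reached es m
    ... | record { left = zero ; size = size } = ⊥-elim (ℕ.<-irrefl size lt)
    ... | record { left = suc d ; rq = rq ; good = good ; inv = inv }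
      with any⁻ (λ _ → true) rq (proj₁ (∧⁻ {any (λ _ → true) rq} good))
    ...   | some with inv .present (proj₁ (proj₂ (find some)))
    ...     | a , b , _ , a~b , ab# = (core a , core b) , a~b ∷ adj , ab# ∷ dis

    off⁻ : ∀ {e f x y z w a} → Ends x y e → Ends z w f → T (off (trace x , trace y) (trace z , trace w) (just a)) →
           (core a ≢ proj₁ e × core a ≢ proj₂ e) × (core a ≢ proj₁ f × core a ≢ proj₂ f)
    off⁻ {x = x} {y} {z} {w} {a} en em t = avoid-ends _ en (not-same⁻ (proj₁ ps)) (not-same⁻ (proj₂ ps)) ,
                               avoid-ends _ em (not-same⁻ (proj₁ qs)) (not-same⁻ (proj₂ qs))
      where
      ts = ∧⁻ {not (same (just a) (trace x)) ∧ not (same (just a) (trace y))} t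
      ps = ∧⁻ {not (same (just a) (trace x))} (proj₁ ts)
      qs = ∧⁻ {not (same (just a) (trace z))} (proj₂ ts)

    -- The edges `bc` and `da` avoid `es` as well, so they occur in `al` and the second alternative
    -- of `escapes` fails; the first gives a required edge leaving the cycle. The cases that follow
    -- arise because `al` lists each edge in one orientation only.
    family-escape : ∀ es → Matching G es → 2 + length es ≡ D → ∀ {a b c d} → FourCycle G a b c d →
      All (Disjoint (a , b)) es → All (Disjoint (c , d)) es →
      ∃ λ u → ∃ λ v → u ~ v × All (Disjoint (u , v)) es × (u ≢ a × u ≢ b) × (u ≢ c × u ≢ d)
    family-escape es m len {a} {b} {c} {d} cyc ab#es cd#es with reached es m
    ... | record { left = zero ; size = size } = ⊥-elim (ℕ.m≢1+n+m (length es) (trans size (sym len)))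
    ... | record { left = suc zero ; size = size } =
      ⊥-elim (ℕ.m≢1+n+m (length es) (ℕ.suc-injective (trans size (sym len))))
    ... | record { left = suc (suc (suc l)) ; size = size } = ⊥-elim (ℕ.m≢1+n+m (length es)
      (sym (ℕ.suc-injective (ℕ.suc-injective (trans size (sym len))))))
    ... | record { left = suc (suc zero) ; al = al ; rq = rq ; good = good ; inv = inv } =
      [ first , second ]′ (inv .available ab ab#es)
      where
      open FourCycle cyc

      sq : T (squares 1 al rq)
      sq = proj₁ (∧⁻ {squares 1 al rq} (proj₂ (∧⁻ {any (λ _ → true) rq} good)))

      bc#es : All (Disjoint (b , c)) es
      bc#es = All.zipWith (λ { ((_ , p) , (q , _)) → p , q }) (ab#es , cd#es)

      da#es : All (Disjoint (d , a)) es
      da#es = All.zipWith (λ { ((p , _) , (_ , q)) → q , p }) (ab#es , cd#es)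

      bc-connected : T (connects al (trace b) (trace c))
      bc-connected = connects⁺ al (inv .available bc bc#es)
      cb-connected : T (connects al (trace c) (trace b))
      cb-connected = connects⁺ al (Sum.swap (inv .available bc bc#es))
      da-connected : T (connects al (trace d) (trace a))
      da-connected = connects⁺ al (inv .available da da#es)
      ad-connected : T (connects al (trace a) (trace d))
      ad-connected = connects⁺ al (Sum.swap (inv .available da da#es))

      Goal : Set
      Goal = ∃ λ u → ∃ λ v → u ~ v × All (Disjoint (u , v)) es × (u ≢ a × u ≢ b) × (u ≢ c × u ≢ d)

      leave : ∀ {x y z w} → Ends x y (a , b) → Ends z w (c , d) →
              Any (T ∘ leaves (trace x , trace y) (trace z , trace w)) rq → Goal
      leave {x} {y} {z} {w} en em some with find some
      ... | _ , e∈ , t with inv .present e∈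
      ...  | p , q , eq , p~q , pq#
        with ∨⁻ {off (trace x , trace y) (trace z , trace w) (just p)}
               (subst (T ∘ leaves (trace x , trace y) (trace z , trace w)) eq t)
      ...   | inj₁ t′ = core p , core q , p~q , pq# , off⁻ en em t′
      ...   | inj₂ t′ = core q , core p , ~-sym p~q , All.map disjoint-swapˡ pq# , off⁻ en em t′

      from-pair : ∀ {x y z w} → Ends x y (a , b) → Ends z w (c , d) →
                  (trace x , trace y) ∈ al → (trace z , trace w) ∈ al → Goal
      from-pair {x} {y} {z} {w} en em e∈ f∈
        with ∨⁻ {any (leaves (trace x , trace y) (trace z , trace w)) rq}
               (All.lookup (all⁻ _ _ (All.lookup (all⁻ _ al sq) e∈))
                  (all-filter _ f∈ (clear⁺ (ends-disjoint en em ab#cd))))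
      ... | inj₁ t = leave en em (any⁻ _ rq t)
      ... | inj₂ t = ⊥-elim (opposite en em (∧⁻ {not (connects al (trace y) (trace z) ∧ connects al (trace w) (trace x))} t))
        where
        opposite : ∀ {x y z w} → Ends x y (a , b) → Ends z w (c , d) →
          T (not (connects al (trace y) (trace z) ∧ connects al (trace w) (trace x))) ×
          T (not (connects al (trace y) (trace w) ∧ connects al (trace z) (trace x))) → ⊥
        opposite fwd fwd (p , _) = not⁻ p (∧⁺ bc-connected da-connected)
        opposite fwd bwd (_ , p) = not⁻ p (∧⁺ bc-connected da-connected)
        opposite bwd fwd (_ , p) = not⁻ p (∧⁺ ad-connected cb-connected)
        opposite bwd bwd (p , _) = not⁻ p (∧⁺ ad-connected cb-connected)

      second-pair : ∀ {x y} → Ends x y (a , b) → (trace x , trace y) ∈ al → Goal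
      second-pair en e∈ = [ from-pair en fwd e∈ , from-pair en bwd e∈ ]′ (inv .available cd cd#es)

      first : (trace a , trace b) ∈ al → Goal
      first = second-pair fwd
      second : (trace b , trace a) ∈ al → Goal
      second = second-pair bwd

    family-buchsbaum : Buchsbaum G D
    family-buchsbaum = record { bounded = family-bounded ; extend = family-extend ; escape = family-escape }

-- Gluings and components

allPairs-lookup : ∀ {A : Set} {R : Rel A 0ℓ} {xs} → AllPairs R xs → ∀ {i j} → i Fin.< j → R (List.lookup xs i) (List.lookup xs j)
allPairs-lookup {xs = _ ∷ xs} (r ∷ _) {zero}  {suc j} _       = All.lookup r (∈.∈-lookup {xs = xs} j)
allPairs-lookup (_ ∷ rs)      {suc i} {suc j} (s≤s i<j) = allPairs-lookup rs i<j

third-label : ∀ (i j : Fin 3) → ∃ λ k → k ≢ i × k ≢ j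
third-label = toWitness {a? = Fin.all? λ i → Fin.all? λ j → Fin.any? λ k → ¬? (k Fin.≟ i) ×-dec ¬? (k Fin.≟ j)} tt

-- The common form of two situations: three components, where `Base` is empty, and three petals,
-- where it is the gluing vertex.
module ThreeBlocks {V : Set} (G : Graph V)
  (Block : Fin 3 → Pred V 0ℓ) (BlockEdge : Fin 3 → Rel V 0ℓ) (Base : Pred V 0ℓ) (base? : Decidable Base)
  (base-unique : ∀ {u v} → Base u → Base v → u ≡ v)
  (edge-block : ∀ {u v} → Graph._~_ G u v → ∃ λ i → BlockEdge i u v)
  (block-edge : ∀ i {u v} → BlockEdge i u v → Graph._~_ G u v × Block i u × Block i v)
  (block-overlap : ∀ {i j v} → i ≢ j → Block i v → Block j v → Base v)
  (intersecting : ∀ i {u v x y} → BlockEdge i u v → BlockEdge i x y → ¬ Disjoint (u , v) (x , y))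
  (off-base : ∀ i → ∃ λ u → ∃ λ v → BlockEdge i u v × ¬ Base u × ¬ Base v) where
  open Graph G

  Labelled : List (V × V) → Set
  Labelled = All (λ (u , v) → ∃ λ i → BlockEdge i u v)

  labels : ∀ {es} → All (Adjacent G) es → Labelled es
  labels = All.map edge-block

  -- By the pigeonhole principle two of four edges share a block, and edges of one block always
  -- meet.
  bounded : ∀ es → Matching G es → length es ≤ 3
  bounded es (adj , dis) with length es ℕ.≤? 3
  ... | yes p = p
  ... | no ¬p with Fin.pigeonhole (ℕ.≰⇒> ¬p) (λ i → proj₁ (All.lookup (labels adj) (∈.∈-lookup {xs = es} i)))
  ...   | i , j , i<j , eq = ⊥-elim (intersecting _ (nth-edge i) (subst (λ l → BlockEdge l _ _) (sym eq) (nth-edge j))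
                               (allPairs-lookup dis i<j))
    where
    nth-edge : ∀ i → BlockEdge _ (proj₁ (List.lookup es i)) (proj₂ (List.lookup es i))
    nth-edge i = proj₂ (All.lookup (labels adj) (∈.∈-lookup {xs = es} i))

  avoid : ∀ {i k u v x y} → k ≢ i → BlockEdge i u v → BlockEdge k x y → ¬ Base x → ¬ Base y → Disjoint (x , y) (u , v)
  avoid {i} {k} k≢i uv xy x∉ y∉ with block-edge i uv | block-edge k xy
  ... | _ , iu , iv | _ , kx , ky =
    ((λ { refl → x∉ (block-overlap k≢i kx iu) }) , (λ { refl → x∉ (block-overlap k≢i kx iv) })) ,
    ((λ { refl → y∉ (block-overlap k≢i ky iu) }) , (λ { refl → y∉ (block-overlap k≢i ky iv) }))

  extend : ∀ es → Matching G es → length es < 3 → ∃ λ f → Matching G (f ∷ es)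
  extend [] _ _ with off-base 0F
  ... | u , v , uv , _ = (u , v) , proj₁ (block-edge 0F uv) ∷ [] , [] ∷ []
  extend (e ∷ []) (adj , dis) _ with labels adj
  ... | (i , ie) ∷ [] with third-label i i
  ...   | k , k≢i , _ with off-base k
  ...     | u , v , uv , u∉ , v∉ = (u , v) , proj₁ (block-edge k uv) ∷ adj , (avoid k≢i ie uv u∉ v∉ ∷ []) ∷ dis
  extend (e ∷ f ∷ []) (adj , dis) _ with labels adj
  ... | (i , ie) ∷ (j , jf) ∷ [] with third-label i j
  ...   | k , k≢i , k≢j with off-base k
  ...     | u , v , uv , u∉ , v∉ = (u , v) , proj₁ (block-edge k uv) ∷ adj ,
    (avoid k≢i ie uv u∉ v∉ ∷ avoid k≢j jf uv u∉ v∉ ∷ []) ∷ dis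
  extend (_ ∷ _ ∷ _ ∷ _) _ (s≤s (s≤s (s≤s ())))

  transfer : ∀ {i j v} → Block i v → Block j v → ¬ Base v → j ≡ i
  transfer {i} {j} iv jv v∉ = decidable-stable (j Fin.≟ i) λ j≢i → v∉ (block-overlap j≢i jv iv)

  left : ∀ i {u v} → BlockEdge i u v → Block i u
  left i = proj₁ ∘ proj₂ ∘ block-edge i

  right : ∀ i {u v} → BlockEdge i u v → Block i v
  right i = proj₂ ∘ proj₂ ∘ block-edge i

  -- Opposite edges of a 4-cycle lie in different blocks, but the cycle passes
  -- through the base vertex at most once.
  no-fourCycle : ∀ {a b c d} → ¬ FourCycle G a b c d
  no-fourCycle {a} {b} {c} {d} cyc with edge-block ab | edge-block bc | edge-block cd | edge-block da
    where open FourCycle cyc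
  ... | i , iab | k , kbc | j , jcd | l , lda with base? b
  ...   | no b∉ with transfer (right i iab) (left k kbc) b∉
  ...     | refl with base? c
  ...       | no c∉ with transfer (right k kbc) (left j jcd) c∉
  ...         | refl = intersecting i iab jcd (FourCycle.ab#cd cyc)
  no-fourCycle cyc | i , iab | k , kbc | j , jcd | l , lda | no b∉ | refl | yes c∈
    with transfer (right j jcd) (left l lda)
           (λ d∈ → ~⇒≢ G (FourCycle.cd cyc) (base-unique c∈ d∈))
  ... | refl with transfer (right l lda) (left i iab)
                    (λ a∈ → proj₁ (proj₁ (FourCycle.ab#cd cyc)) (base-unique a∈ c∈))
  ...   | refl = intersecting i iab jcd (FourCycle.ab#cd cyc)
  no-fourCycle cyc | i , iab | k , kbc | j , jcd | l , lda | yes b∈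
    with transfer (right j jcd) (left l lda)
           (λ d∈ → proj₂ (proj₂ (FourCycle.ab#cd cyc)) (base-unique b∈ d∈))
  ... | refl with transfer (right l lda) (left i iab)
                    (λ a∈ → ~⇒≢ G (FourCycle.ab cyc) (base-unique a∈ b∈))
  ...   | refl = intersecting i iab jcd (FourCycle.ab#cd cyc)

  buchsbaum : Buchsbaum G 3
  buchsbaum = record
    { bounded = bounded ; extend = extend ; escape = λ _ _ _ cyc _ _ → ⊥-elim (no-fourCycle cyc) }

Intersecting : ∀ {V} → Graph V → Set
Intersecting G = ∀ {u v x y} → u ~ v → x ~ y → ¬ Disjoint (u , v) (x , y)
  where open Graph G

HasEdge : ∀ {V} → Graph V → Set
HasEdge G = ∃ λ u → ∃ λ v → Graph._~_ G u v

K₃-intersecting : Intersecting (K 3)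
K₃-intersecting {u} {v} {x} {y} u≢v x≢y d = toWitness {a? = Fin.all? λ u → Fin.all? λ v → Fin.all? λ x → Fin.all? λ y →
  ¬? (¬? (u Fin.≟ v) ×-dec ¬? (x Fin.≟ y) ×-dec disjoint? Fin._≟_ (u , v) (x , y))} tt u v x y (u≢v , x≢y , d)

star-intersecting : ∀ n → Intersecting (S n)
star-intersecting n (inj₁ (refl , _)) (inj₁ (refl , _)) ((p , _) , _) = p refl
star-intersecting n (inj₁ (refl , _)) (inj₂ (refl , _)) ((_ , p) , _) = p refl
star-intersecting n (inj₂ (refl , _)) (inj₁ (refl , _)) (_ , (p , _)) = p refl
star-intersecting n (inj₂ (refl , _)) (inj₂ (refl , _)) (_ , (_ , p)) = p refl

module _ {V W} {G : Graph V} {H : Graph W} (iso : G ≅ H) where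
  open _≅_ iso
  open Inverse bijection

  private
    to-injective : ∀ {u v} → to u ≡ to v → u ≡ v
    to-injective {u} {v} p = trans (sym (strictlyInverseʳ u)) (trans (cong from p) (strictlyInverseʳ v))

  ≅-intersecting : Intersecting H → Intersecting G
  ≅-intersecting int p q ((a , b) , (c , d)) = int (Equivalence.to (adjacency _ _) p) (Equivalence.to (adjacency _ _) q)
    ((a ∘ to-injective , b ∘ to-injective) , (c ∘ to-injective , d ∘ to-injective))

  ≅-hasEdge : HasEdge H → HasEdge G
  ≅-hasEdge (u , v , p) = from u , from v , Equivalence.from (adjacency _ _)
    (subst₂ (Graph._~_ H) (sym (strictlyInverseˡ u)) (sym (strictlyInverseˡ v)) p)

triangleOrStar-intersecting : ∀ {V} {G : Graph V} → TriangleOrStar G → Intersecting G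
triangleOrStar-intersecting (inj₁ iso)           = ≅-intersecting iso K₃-intersecting
triangleOrStar-intersecting (inj₂ (n , _ , iso)) = ≅-intersecting iso (star-intersecting n)

triangleOrStar-hasEdge : ∀ {V} {G : Graph V} → TriangleOrStar G → HasEdge G
triangleOrStar-hasEdge (inj₁ iso)                 = ≅-hasEdge iso (0F , 1F , λ ())
triangleOrStar-hasEdge (inj₂ (suc n , _ , iso)) = ≅-hasEdge iso (zero , suc zero , inj₁ (refl , λ ()))

module ComponentFacts {V} {G : Graph V} {k} (c : Components G k) where
  open Graph G
  open Components c

  label-edge : ∀ {u v} → u ~ v → label u ≡ label v
  label-edge u~v = Equivalence.from (label-reachable _ _) (u~v ◅ ε)

  component-intersecting : ∀ i → Intersecting (component i) → ∀ {u v x y} → label u ≡ i → label x ≡ i →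
    u ~ v → x ~ y → ¬ Disjoint (u , v) (x , y)
  component-intersecting i int {u} {v} {x} {y} p q u~v x~y ((a , b) , (c , d)) =
    int {u , p} {v , trans (sym (label-edge u~v)) p} {x , q} {y , trans (sym (label-edge x~y)) q} u~v x~y
      ((a ∘ cong proj₁ , b ∘ cong proj₁) , (c ∘ cong proj₁ , d ∘ cong proj₁))

threeSmall⇒buchsbaum : ∀ {V} {G : Graph V} → ThreeSmallComponents G → Buchsbaum G 3
threeSmall⇒buchsbaum {G = G} (c , small) = ThreeBlocks.buchsbaum G
  (λ i v → label v ≡ i) (λ i u v → u ~ v × label u ≡ i) (λ _ → ⊥) (λ _ → no λ ()) (λ ())
  (λ {u} u~v → label u , u~v , refl)
  (λ i (u~v , p) → u~v , p , trans (sym (label-edge u~v)) p)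
  (λ i≢j p q → i≢j (trans (sym p) q))
  (λ i (u~v , p) (x~y , q) → component-intersecting i (triangleOrStar-intersecting (small i)) p q u~v x~y)
  (λ i → base-free i (triangleOrStar-hasEdge (small i)))
  where
  open Graph G
  open Components c
  open ComponentFacts c
  base-free : ∀ i → HasEdge (component i) → ∃ λ u → ∃ λ v → (u ~ v × label u ≡ i) × ¬ ⊥ × ¬ ⊥
  base-free i ((u , p) , (v , _) , u~v) = u , v , (u~v , p) , (λ ()) , λ ()

petal-intersecting : ∀ p → Intersecting (PointedGraph.graph (petal p))
petal-intersecting (triangle _) = K₃-intersecting
petal-intersecting (star n _ _) = star-intersecting n

HasEdgeOffPoint : PointedGraph → Set
HasEdgeOffPoint (pointed H x) = ∃ λ u → ∃ λ v → Graph._~_ H u v × u ≢ x × v ≢ x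

-- For a star the edge goes from the centre to a second leaf, which exists by `2 ≤ n`.
petal-off-point : ∀ p → HasEdgeOffPoint (petal p)
petal-off-point (triangle 0F) = 1F , 2F , (λ ()) , (λ ()) , λ ()
petal-off-point (triangle 1F) = 0F , 2F , (λ ()) , (λ ()) , λ ()
petal-off-point (triangle 2F) = 0F , 1F , (λ ()) , (λ ()) , λ ()
petal-off-point (star (suc (suc n)) _ zero)    = zero , suc (suc zero) , inj₁ (refl , λ ()) , (λ ()) , λ ()
petal-off-point (star (suc (suc n)) _ (suc l)) = zero , suc zero , inj₁ (refl , λ ()) , (λ ()) , λ ()
petal-off-point (star (suc zero) (s≤s ()) _)

petals⇒buchsbaum : ∀ {V} {G : Graph V} → DecidableEquality V → 𝓑-P G → Buchsbaum G 3
petals⇒buchsbaum {V} {G} _≟_ (p , q , r , glue) = ThreeBlocks.buchsbaum G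
  (λ i v → ∃ λ a → embed i a ≡ v) BlockEdge (_≡ base) (_≟ base) (λ u≡ v≡ → trans u≡ (sym v≡))
  (Equivalence.to (adjacency _ _))
  (λ i (a , b , u≡ , v≡ , ab) → Equivalence.from (adjacency _ _) (i , a , b , u≡ , v≡ , ab) , (a , u≡) , (b , v≡))
  (λ { {i} {j} i≢j (a , refl) (b , q) → embed-overlap i j a b i≢j (sym q) })
  (λ i (a , b , u≡ , v≡ , ab) (c , d , x≡ , y≡ , cd) ((s , t) , (s′ , t′)) → graph-intersecting i ab cd
    ((apart u≡ x≡ s , apart u≡ y≡ t) , (apart v≡ x≡ s′ , apart v≡ y≡ t′)))
  (λ i → base-free i (off-point i))
  where
  open Graph G
  open IsGluing glue

  petal-at : Fin 3 → PointedGraph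
  petal-at = lookup (petal p ∷ petal q ∷ petal r ∷ [])

  BlockEdge : Fin 3 → Rel V 0ℓ
  BlockEdge i u v = ∃ λ a → ∃ λ b → embed i a ≡ u × embed i b ≡ v × Graph._~_ (PointedGraph.graph (petal-at i)) a b

  graph-intersecting : ∀ i → Intersecting (PointedGraph.graph (petal-at i))
  graph-intersecting 0F = petal-intersecting p
  graph-intersecting 1F = petal-intersecting q
  graph-intersecting 2F = petal-intersecting r

  apart : ∀ {i a b u v} → embed i a ≡ u → embed i b ≡ v → u ≢ v → a ≢ b
  apart refl refl u≢v refl = u≢v refl

  off-point : ∀ i → HasEdgeOffPoint (petal-at i)
  off-point 0F = petal-off-point p
  off-point 1F = petal-off-point q
  off-point 2F = petal-off-point r

  base-free : ∀ i → HasEdgeOffPoint (petal-at i) →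
        ∃ λ u → ∃ λ v → BlockEdge i u v × u ≢ base × v ≢ base
  base-free i (a , b , ab , a≢ , b≢) = embed i a , embed i b , (a , b , refl , refl , ab) ,
    (λ e → a≢ (embed-inj i (trans e (sym (embed-point i))))) , (λ e → b≢ (embed-inj i (trans e (sym (embed-point i)))))

-- The two exceptional graphs

module _ (H : Fin 2 → Graph (Fin 4)) (𝓣 : Template) where
  open Template 𝓣

  IsGluedPattern : (Fin 2 → Fin 4 → Fin order) → Set
  IsGluedPattern sub =
    (∀ i a b → Graph._~_ (H i) a b → Joins required (sub i a) (sub i b)) ×
    All (λ (a , b) → ∃ λ i → ∃ λ x → ∃ λ y → sub i x ≡ a × sub i y ≡ b × Graph._~_ (H i) x y) required

  isGluedPattern? : ∀ sub → Dec (IsGluedPattern sub)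
  isGluedPattern? sub =
    (Fin.all? λ i → Fin.all? λ a → Fin.all? λ b → Graph._~?_ (H i) a b →-dec joins? required (sub i a) (sub i b)) ×-dec
    All.all? (λ (a , b) → Fin.any? λ i → Fin.any? λ x → Fin.any? λ y →
      (sub i x Fin.≟ a) ×-dec (sub i y Fin.≟ b) ×-dec Graph._~?_ (H i) x y) required

exceptional-pos : Fin 7 → Fin 4
exceptional-pos = lookup (0F ∷ 1F ∷ 2F ∷ 3F ∷ 1F ∷ 2F ∷ 3F ∷ [])

exceptional-sub-lab : ∀ c → exceptional-sub (exceptional-lab c) (exceptional-pos c) ≡ c
exceptional-sub-lab = toWitness {a? = Fin.all? λ c → exceptional-sub (exceptional-lab c) (exceptional-pos c) Fin.≟ c} tt

exceptional-pos-zero : ∀ c → exceptional-pos c ≡ 0F → c ≡ 0F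
exceptional-pos-zero = toWitness {a? = Fin.all? λ c → (exceptional-pos c Fin.≟ 0F) →-dec (c Fin.≟ 0F)} tt

-- A gluing of two fixed graphs is a family without new vertices, so the evaluation used for the
-- families applies to it.
exceptional∈ᶠ : ∀ {V} {G : Graph V} (H₀ H₁ : Graph (Fin 4)) required → let H = lookup (H₀ ∷ H₁ ∷ []) ; 𝓣 = record { order = 7 ; required = required ; optional = [] ; unfilled = [] } in
  IsGluedPattern H 𝓣 exceptional-sub → IsGluing (pointed H₀ 0F ∷ pointed H₁ 0F ∷ []) G → G ∈ᶠ 𝓣
exceptional∈ᶠ {V} {G} H₀ H₁ required (pattern⁺ , pattern⁻) glue = record
  { extra         = 0
  ; vertices      = mk↔ₛ′ [ core , (λ ()) ]′ (inj₁ ∘ locate) core-locate λ { (inj₁ a) → cong inj₁ (core-inj _ _ (core-locate (core a))) ; (inj₂ ()) }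
  ; core-required = λ { a b (inj₁ p) → req (All.lookup pattern⁻ p) ; a b (inj₂ p) → ~-sym (req (All.lookup pattern⁻ p)) }
  ; core-allowed  = λ a b p → inj₁ (allowed a b (from-adjacency p))
  ; new-new       = λ ()
  ; new-core      = λ ()
  ; new-joined    = λ ()
  }
  where
  open Graph G
  open IsGluing glue

  H : Fin 2 → Graph (Fin 4)
  H = lookup (H₀ ∷ H₁ ∷ [])

  -- The vertex type in `embed` reduces to `Fin 4` only for a literal index, hence the two
  -- equations.
  place : Fin 2 → Fin 4 → V
  place 0F = embed 0F
  place 1F = embed 1F

  place-zero : ∀ i → place i 0F ≡ base
  place-zero 0F = embed-point 0F
  place-zero 1F = embed-point 1F

  place-inj : ∀ i {a b} → place i a ≡ place i b → a ≡ b
  place-inj 0F = embed-inj 0F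
  place-inj 1F = embed-inj 1F

  place-overlap : ∀ i j {a b} → i ≢ j → place i a ≡ place j b → place i a ≡ base
  place-overlap 0F 0F i≢j = ⊥-elim (i≢j refl)
  place-overlap 0F 1F i≢j = embed-overlap 0F 1F _ _ i≢j
  place-overlap 1F 0F i≢j = embed-overlap 1F 0F _ _ i≢j
  place-overlap 1F 1F i≢j = ⊥-elim (i≢j refl)

  core : Fin 7 → V
  core c = place (exceptional-lab c) (exceptional-pos c)

  core-sub : ∀ i a → core (exceptional-sub i a) ≡ place i a
  core-sub 0F 0F = refl
  core-sub 0F 1F = refl
  core-sub 0F 2F = refl
  core-sub 0F 3F = refl
  core-sub 1F 0F = trans (place-zero 0F) (sym (place-zero 1F))
  core-sub 1F 1F = refl
  core-sub 1F 2F = refl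
  core-sub 1F 3F = refl

  at-base : ∀ c → core c ≡ base → c ≡ 0F
  at-base c p = exceptional-pos-zero c (place-inj (exceptional-lab c) (trans p (sym (place-zero (exceptional-lab c)))))

  core-inj : ∀ c d → core c ≡ core d → c ≡ d
  core-inj c d p with exceptional-lab c Fin.≟ exceptional-lab d
  ... | yes eq = trans (sym (exceptional-sub-lab c)) (trans
    (cong₂ exceptional-sub eq (place-inj (exceptional-lab d) (trans (cong (λ i → place i (exceptional-pos c)) (sym eq)) p)))
    (exceptional-sub-lab d))
  ... | no neq with place-overlap (exceptional-lab c) (exceptional-lab d) neq p
  ...   | q = trans (at-base c q) (sym (at-base d (trans (sym p) q)))

  cover : ∀ v → ∃ λ i → ∃ λ a → place i a ≡ v
  cover v with embed-cover v
  ... | 0F , a , p = 0F , a , p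
  ... | 1F , a , p = 1F , a , p

  locate : V → Fin 7
  locate v = exceptional-sub (proj₁ (cover v)) (proj₁ (proj₂ (cover v)))

  core-locate : ∀ v → core (locate v) ≡ v
  core-locate v = trans (core-sub (proj₁ (cover v)) (proj₁ (proj₂ (cover v)))) (proj₂ (proj₂ (cover v)))

  to-adjacency : ∀ i a b → Graph._~_ (H i) a b → place i a ~ place i b
  to-adjacency 0F a b p = Equivalence.from (adjacency _ _) (0F , a , b , refl , refl , p)
  to-adjacency 1F a b p = Equivalence.from (adjacency _ _) (1F , a , b , refl , refl , p)

  from-adjacency : ∀ {u v} → u ~ v → ∃ λ i → ∃ λ a → ∃ λ b → place i a ≡ u × place i b ≡ v × Graph._~_ (H i) a b
  from-adjacency u~v with Equivalence.to (adjacency _ _) u~v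
  ... | 0F , a , b , p , q , r = 0F , a , b , p , q , r
  ... | 1F , a , b , p , q , r = 1F , a , b , p , q , r

  req : ∀ {a b} → (∃ λ i → ∃ λ x → ∃ λ y → exceptional-sub i x ≡ a × exceptional-sub i y ≡ b × Graph._~_ (H i) x y) →
        core a ~ core b
  req (i , x , y , refl , refl , p) = subst₂ _~_ (sym (core-sub i x)) (sym (core-sub i y)) (to-adjacency i x y p)

  allowed : ∀ a b → (∃ λ i → ∃ λ x → ∃ λ y → place i x ≡ core a × place i y ≡ core b × Graph._~_ (H i) x y) → Joins required a b
  allowed a b (i , x , y , p , q , r) = subst₂ (Joins required)
    (core-inj _ a (trans (core-sub i x) p)) (core-inj _ b (trans (core-sub i y) q)) (pattern⁺ i x y r)

E₁⇒buchsbaum : ∀ {V} {G : Graph V} → E₁ G → Buchsbaum G 3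
E₁⇒buchsbaum glue = Family.family-buchsbaum _ (exceptional∈ᶠ (K 4) (K 4) (Template.required E₁ᵀ)
  (toWitness {a? = isGluedPattern? (lookup (K 4 ∷ K 4 ∷ [])) E₁ᵀ exceptional-sub} tt) glue) 3 tt

E₂⇒buchsbaum : ∀ {V} {G : Graph V} → E₂ G → Buchsbaum G 3
E₂⇒buchsbaum glue = Family.family-buchsbaum _ (exceptional∈ᶠ (K 4) C₄ (Template.required E₂ᵀ)
  (toWitness {a? = isGluedPattern? (lookup (K 4 ∷ C₄ ∷ [])) E₂ᵀ exceptional-sub} tt) glue) 3 tt

-- Literal indices let `saturatedTemplate 3 (𝓑 i)` evaluate to `true`, which is what `tt` certifies.
𝓑⇒buchsbaum : ∀ {V} {G : Graph V} i → G ∈ᶠ 𝓑 i → Buchsbaum G 3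
𝓑⇒buchsbaum 0F F = Family.family-buchsbaum _ F 3 tt
𝓑⇒buchsbaum 1F F = Family.family-buchsbaum _ F 3 tt
𝓑⇒buchsbaum 2F F = Family.family-buchsbaum _ F 3 tt
𝓑⇒buchsbaum 3F F = Family.family-buchsbaum _ F 3 tt
𝓑⇒buchsbaum 4F F = Family.family-buchsbaum _ F 3 tt
𝓑⇒buchsbaum 5F F = Family.family-buchsbaum _ F 3 tt
𝓑⇒buchsbaum 6F F = Family.family-buchsbaum _ F 3 tt
𝓑⇒buchsbaum 7F F = Family.family-buchsbaum _ F 3 tt
𝓑⇒buchsbaum 8F F = Family.family-buchsbaum _ F 3 tt

-- The large component plays the part of the link of an edge of the small one, hence 2 instead of 3.
bowtieOr𝓖⇒buchsbaum : ∀ {V} {G : Graph V} → BowtieOr𝓖 G → Buchsbaum G 2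
bowtieOr𝓖⇒buchsbaum (inj₁ F)               = Family.family-buchsbaum _ F 2 tt
bowtieOr𝓖⇒buchsbaum (inj₂ (inj₁ F))        = Family.family-buchsbaum _ F 2 tt
bowtieOr𝓖⇒buchsbaum (inj₂ (inj₂ (inj₁ F))) = Family.family-buchsbaum _ F 2 tt
bowtieOr𝓖⇒buchsbaum (inj₂ (inj₂ (inj₂ F))) = Family.family-buchsbaum _ F 2 tt

-- Edges of the small component pairwise meet, so a matching is a matching of the large component
-- together with at most one small edge.
module SmallAndLarge {V} {G : Graph V} (c : Components G 2)
  (small : TriangleOrStar (Components.component c 0F)) (large : Buchsbaum (Components.component c 1F) 2) where
  open Graph G
  open Components c
  open ComponentFacts c

  Large : Set
  Large = ∃ λ v → label v ≡ 1F

  forget : Large × Large → V × V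
  forget = Product.map proj₁ proj₁

  small-disjoint : ∀ {u v x y} → label u ≡ 0F → label x ≡ 0F → u ~ v → x ~ y → ¬ Disjoint (u , v) (x , y)
  small-disjoint = component-intersecting 0F (triangleOrStar-intersecting small)

  small-edge : ∃ λ u → ∃ λ v → label u ≡ 0F × u ~ v
  small-edge with triangleOrStar-hasEdge small
  ... | (u , p) , (v , _) , u~v = u , v , p , u~v

  labels-disjoint : ∀ {i j u v x y} → i ≢ j → label u ≡ i → u ~ v → label x ≡ j → x ~ y → Disjoint (u , v) (x , y)
  labels-disjoint {i} {j} {u} {v} {x} {y} i≢j p u~v q x~y =
    (differ p q , differ p q′) , (differ p′ q , differ p′ q′)
    where
    p′ = trans (sym (label-edge u~v)) p
    q′ = trans (sym (label-edge x~y)) q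
    differ : ∀ {w z} → label w ≡ i → label z ≡ j → w ≢ z
    differ p q refl = i≢j (trans (sym p) q)

  0≢1 : (Fin 2 ∋ 0F) ≢ 1F
  0≢1 ()

  -- The Boolean records whether there is an edge in the small component.
  data Parts : List (V × V) → List (Large × Large) → Bool → Set where
    none  : Parts [] [] false
    on-small : ∀ {u v es ls} → label u ≡ 0F → u ~ v → Parts es ls false → Parts ((u , v) ∷ es) ls true
    on-large : ∀ {e es ls b} → Graph._~_ (component 1F) (proj₁ e) (proj₂ e) → Parts es ls b → Parts (forget e ∷ es) (e ∷ ls) b

  two-labels : ∀ v → label v ≡ 0F ⊎ label v ≡ 1F
  two-labels v with label v
  ... | 0F = inj₁ refl
  ... | 1F = inj₂ refl

  Small : V × V → Set
  Small (u , v) = label u ≡ 0F × u ~ v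

  no-second : ∀ {es ls f} → Small f → All (Disjoint f) es → ¬ Parts es ls true
  no-second (p , u~v) (d ∷ _) (on-small q x~y _) = small-disjoint p q u~v x~y d
  no-second s (_ ∷ ds) (on-large _ ps) = no-second s ds ps

  parts : ∀ es → Matching G es → ∃ λ ls → ∃ λ b → Parts es ls b
  parts [] _ = [] , false , none
  parts ((u , v) ∷ es) (u~v ∷ adj , d ∷ dis) with parts es (adj , dis) | two-labels u
  ... | ls , b     , ps | inj₂ p = _ , b , on-large {(u , p) , (v , trans (sym (label-edge u~v)) p)} u~v ps
  ... | ls , false , ps | inj₁ p = ls , true , on-small p u~v ps
  ... | ls , true  , ps | inj₁ p = ⊥-elim (no-second (p , u~v) d ps)

  large-disjoint : ∀ {es ls b f} → Parts es ls b → All (Disjoint (forget f)) es → All (Disjoint f) ls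
  large-disjoint none _ = []
  large-disjoint (on-small _ _ ps) (_ ∷ ds) = large-disjoint ps ds
  large-disjoint (on-large _ ps) (((p , q) , (r , s)) ∷ ds) =
    ((p ∘ cong proj₁ , q ∘ cong proj₁) , (r ∘ cong proj₁ , s ∘ cong proj₁)) ∷ large-disjoint ps ds

  large-matching : ∀ {es ls b} → Parts es ls b → AllPairs Disjoint es → Matching (component 1F) ls
  large-matching none _ = [] , []
  large-matching (on-small _ _ ps) (_ ∷ dis) = large-matching ps dis
  large-matching (on-large a ps) (d ∷ dis) with large-matching ps dis
  ... | adj , dis′ = a ∷ adj , large-disjoint ps d ∷ dis′

  count : Bool → ℕ
  count true  = 1
  count false = 0

  parts-length : ∀ {es ls b} → Parts es ls b → length es ≡ count b + length ls
  parts-length none = refl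
  parts-length (on-small _ _ ps) = cong suc (parts-length ps)
  parts-length {b = b} (on-large {ls = ls} _ ps) = trans (cong suc (parts-length ps)) (sym (ℕ.+-suc (count b) (length ls)))

  bounded : ∀ es → Matching G es → length es ≤ 3
  bounded es m with parts es m
  ... | ls , b , ps = subst (_≤ 3) (sym (parts-length ps))
    (ℕ.+-mono-≤ (count≤1 b) (Buchsbaum.bounded large ls (large-matching ps (proj₂ m))))
    where
    count≤1 : ∀ b → count b ≤ 1
    count≤1 true  = s≤s z≤n
    count≤1 false = z≤n

  lift-disjoint : ∀ {e f : Large × Large} → Disjoint e f → Disjoint (forget e) (forget f)
  lift-disjoint ((p , q) , (r , s)) = ((lift p , lift q) , (lift r , lift s))
    where
    lift : ∀ {x y : Large} → x ≢ y → proj₁ x ≢ proj₁ y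
    lift x≢y eq = x≢y (∃-≡ (Decidable⇒UIP.≡-irrelevant Fin._≟_) eq)

  beside-large : ∀ {es ls b f} → Parts es ls b → Graph._~_ (component 1F) (proj₁ f) (proj₂ f) →
    All (Disjoint f) ls → All (Disjoint (forget f)) es
  beside-large none _ _ = []
  beside-large {f = (_ , p) , _} (on-small q u~v ps) x~y ds = labels-disjoint (≢-sym 0≢1) p x~y q u~v ∷ beside-large ps x~y ds
  beside-large (on-large _ ps) x~y (d ∷ ds) = lift-disjoint d ∷ beside-large ps x~y ds

  beside-small : ∀ {es ls f} → Parts es ls false → Small f → All (Disjoint f) es
  beside-small none _ = []
  beside-small (on-large {(_ , p) , _} a ps) (q , x~y) = labels-disjoint 0≢1 q x~y p a ∷ beside-small ps (q , x~y)

  extend : ∀ es → Matching G es → length es < 3 → ∃ λ f → Matching G (f ∷ es)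
  extend es m@(adj , dis) lt with parts es m
  ... | ls , false , ps with small-edge
  ...   | u , v , p , u~v = (u , v) , u~v ∷ adj , beside-small ps (p , u~v) ∷ dis
  extend es m@(adj , dis) lt | ls , true , ps
    with Buchsbaum.extend large ls (large-matching ps dis) (ℕ.≤-pred (subst (_< 3) (parts-length ps) lt))
  ...   | f , a ∷ _ , d ∷ _ = forget f , a ∷ adj , beside-large ps a d ∷ dis

  -- A 4-cycle cannot lie in the small component, where its opposite edges would meet. If `es` is a
  -- large edge, any small edge escapes. If it is a small edge, what is left is the condition for
  -- the large component with no edge chosen.
  escape : ∀ es → Matching G es → 2 + length es ≡ 3 → ∀ {a b c d} → FourCycle G a b c d →
           All (Disjoint (a , b)) es → All (Disjoint (c , d)) es →
           ∃ λ u → ∃ λ v → u ~ v × All (Disjoint (u , v)) es × (u ≢ a × u ≢ b) × (u ≢ c × u ≢ d)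
  escape es m len {a} {b} {c} {d} cyc ab# cd# with two-labels a
  ... | inj₁ p = ⊥-elim (small-disjoint p (trans (sym (trans (label-edge ab) (label-edge bc))) p) ab cd ab#cd)
    where open FourCycle cyc
  ... | inj₂ a₁ with parts es m
  ...   | ls , false , ps with small-edge
  ...     | u , v , p , u~v = u , v , u~v , beside-small ps (p , u~v) , (away a₁ , away b₁) , (away c₁ , away d₁)
    where
    open FourCycle cyc
    b₁ = trans (sym (label-edge ab)) a₁
    c₁ = trans (sym (label-edge bc)) b₁
    d₁ = trans (sym (label-edge cd)) c₁
    away : ∀ {w} → label w ≡ 1F → u ≢ w
    away q refl = 0≢1 (trans (sym p) q)
  escape es m len {a} {b} {c} {d} cyc ab# cd# | inj₂ a₁ | ls , true , ps
    with Buchsbaum.escape large ls (large-matching ps (proj₂ m))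
           (ℕ.suc-injective (trans (cong (2 +_) (sym (parts-length ps))) len))
           {a , a₁} {b , b₁} {c , c₁} {d , d₁} (fourCycle ab bc cd da (drop ab#cd) (drop bc#da))
           (large-disjoint ps ab#) (large-disjoint ps cd#)
    where
    open FourCycle cyc
    b₁ = trans (sym (label-edge ab)) a₁
    c₁ = trans (sym (label-edge bc)) b₁
    d₁ = trans (sym (label-edge cd)) c₁
    drop : ∀ {e f : Large × Large} → Disjoint (forget e) (forget f) → Disjoint e f
    drop ((p , q) , (r , s)) = ((p ∘ cong proj₁ , q ∘ cong proj₁) , (r ∘ cong proj₁ , s ∘ cong proj₁))
  ...   | (u , u₁) , v , u~v , ds , (ua , ub) , (uc , ud) = u , proj₁ v , u~v , beside-large ps u~v ds ,
    (lift ua , lift ub) , (lift uc , lift ud)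
    where
    lift : ∀ {x y : Large} → x ≢ y → proj₁ x ≢ proj₁ y
    lift x≢y eq = x≢y (∃-≡ (Decidable⇒UIP.≡-irrelevant Fin._≟_) eq)

  buchsbaum : Buchsbaum G 3
  buchsbaum = record { bounded = bounded ; extend = extend ; escape = escape }

-- The derivation

-- Hexadecimal digits encode names, after a leading 1.  In stop and quad the default
-- 3-matching is 01, 23, 45.
digits : ℕ → List ℕ
digits n = go n n []
  where
  go : (fuel n : ℕ) → List ℕ → List ℕ
  go zero    _             ds = ds
  go (suc _) 0             ds = ds
  go (suc _) 1             ds = ds
  go (suc f) n@(suc (suc _)) ds = go f (n / 16) (n % 16 ∷ ds)

pairs : List ℕ → List (ℕ × ℕ)
pairs (u ∷ v ∷ ds) = (u , v) ∷ pairs ds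
pairs _            = []

initial : List (ℕ × ℕ)
initial = (0 , 1) ∷ (2 , 3) ∷ (4 , 5) ∷ []

four seven stop quad : ℕ → Tree
four n  = matching₄ (pairs (digits n))
seven n = cycle₇ (digits n)
stop n with pairs (digits n)
... | e ∷ f ∷ [] = stuck e f initial
... | e ∷ f ∷ m  = stuck e f m
-- With fewer than two pairs this leaf is one that `check` rejects.
... | m          = matching₄ m
quad n with pairs (digits n)
... | e ∷ (a , b) ∷ (c , d) ∷ [] = square e a b c d initial
... | e ∷ (a , b) ∷ (c , d) ∷ m  = square e a b c d m
... | m                          = matching₄ m

fit : (t names m : ℕ) → Tree
fit t names m = fits t (digits names) (pairs (digits m))

by : (i names : ℕ) → Tree
by i names = lemma i (digits names)

-- An empty group is written `0x1`, the bare leading digit.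
known : (edges nonedges closeds separates : ℕ) → List Fact
known es ns cs ss =
  List.map (uncurry edge) (pairs (digits es)) ++ List.map (uncurry nonedge) (pairs (digits ns)) ++
  List.map closed (digits cs) ++ List.map (uncurry separate) (pairs (digits ss))

-- In `fit` the first number is a position in `targets`, counted from 0. In `by` it counts backwards
-- from the lemma being proved, so a derivation can appeal only to lemmas above it and no circle
-- arises.
lemmas : List Lemma
lemmas =
  ⟨ 7 , known 0x1010206131523344556 0x1121416242646 0x11246 0x1 ⟩⊢
    (edge? 3 5 (stop 0x10135) (edge? 0 3 (stop 0x10315) (edge? 0 5 (stop 0x10513)
   (fit 2 0x10351246 0x1013254)))) ∷
  ⟨ 7 , known 0x1010406132325344556 0x1162646 0x11246 0x1 ⟩⊢
    (edge? 1 2 (seven 0x11065432) (edge? 1 4 (seven 0x11065234) (edge? 2 4 (seven 0x12310654)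
   (by 0 0x10413256)))) ∷
  ⟨ 8 , known 0x1010206131523344557 0x1071214161724262746475667 0x112467 0x1 ⟩⊢
    (edge? 0 3 (stop 0x10315) (edge? 3 5 (stop 0x10135) (edge? 0 5 (stop 0x10513)
   (fit 4 0x103526174 0x1023157)))) ∷
  ⟨ 8 , known 0x1010406132325344557 0x11617262746475667 0x11246 0x1 ⟩⊢
    (outer? 7 (four 0x178012345) (edge? 1 2 (four 0x112063457) (edge? 1 4 (four 0x114062357)
   (edge? 2 4 (four 0x124061357) (edge? 0 7 (by 1 0x10725431) (by 0 0x104132567)))))) ∷
  ⟨ 6 , known 0x1010413232545 0x1 0x11234 0x1 ⟩⊢
    (edge? 3 4 (outer? 0 (outer? 6 (four 0x167012345) (edge? 5 6 (by 2 0x10123456) (outer? 5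
   (by 0 0x101234567) (quad 0x1012345)))) (quad 0x1250134)) (stop 0x10125)) ∷
  ⟨ 6 , known 0x1010413232545 0x1 0x1123 0x1 ⟩⊢
    (outer? 4 (outer? 0 (four 0x107132546) (outer? 5 (four 0x157012346) (edge? 0 6
   (seven 0x10132546) (edge? 5 6 (seven 0x15231046) (by 0 0x1135204))))) (by 0 0x1012345)) ∷
  ⟨ 6 , known 0x1010413232545 0x1 0x123 0x1 ⟩⊢
    (outer? 1 (outer? 0 (four 0x107162345) (outer? 5 (four 0x157041623) (outer? 6
   (four 0x167012345) (edge? 0 6 (seven 0x10452316) (edge? 0 2 (edge? 5 6 (seven 0x15402316)
   (by 0 0x1135204)) (stop 0x11345)))))) (by 0 0x1012345)) ∷
  ⟨ 8 , known 0x101041317232526454647 0x1030506071516353637565767 0x103567 0x1 ⟩⊢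
    (edge? 2 7 (by 3 0x145327160) (edge? 0 2 (by 3 0x125740163) (edge? 1 2 (stop 0x10412)
   (edge? 1 4 (stop 0x11423) (edge? 2 4 (stop 0x10124) (fit 1 0x11420576 0x1104526)))))) ∷
  ⟨ 7 , known 0x10104132325264546 0x1063656 0x10356 0x1 ⟩⊢
    (edge? 0 5 (seven 0x10132645) (edge? 3 5 (seven 0x13104625) (edge? 0 3 (outer? 1
   (four 0x117032546) (edge? 1 5 (seven 0x11032645) (by 1 0x1230164))) (edge? 1 5
   (by 6 0x11362540) (edge? 1 6 (by 6 0x11352640) (outer? 1 (outer? 7 (four 0x178012345)
   (edge? 4 7 (by 0 0x101234567) (edge? 2 7 (by 0 0x131402567) (edge? 1 2 (stop 0x10412)
   (edge? 1 4 (stop 0x11423) (edge? 2 4 (stop 0x10124) (fit 3 0x114250637 0x1104526)))))))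
   (stop 0x10423))))))) ∷
  ⟨ 6 , known 0x1010413232545 0x1 0x13 0x1 ⟩⊢
    (outer? 2 (outer? 0 (four 0x107132645) (outer? 5 (four 0x157041326) (outer? 6
   (four 0x167012345) (edge? 5 6 (seven 0x15401326) (edge? 0 6 (outer? 1 (four 0x117062345)
   (edge? 1 5 (seven 0x11326045) (edge? 1 6 (seven 0x11325406) (stop 0x10423)))) (edge? 4 6
   (by 0 0x10123456) (edge? 1 6 (by 0 0x15410236) (outer? 1 (outer? 7 (four 0x178012345)
   (edge? 0 3 (four 0x103172645) (edge? 3 5 (four 0x135041726) (edge? 4 7 (by 0 0x15213407)
   (edge? 3 4 (by 5 0x125043167) (outer? 4 (outer? 8 (four 0x189012345) (edge? 0 5
   (four 0x105132648) (edge? 1 8 (by 0 0x15213480) (edge? 2 8 (by 0 0x10123485) (edge? 2 7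
   (by 0 0x15410273) (edge? 2 4 (stop 0x10124) (edge? 1 2 (stop 0x10412) (edge? 1 4 (stop 0x11423)
   (fit 0 0x1124768 0x1172648))))))))) (stop 0x10125))))))) (by 2 0x1230154)))))))))
   (by 2 0x1012345)) ∷
  -- The 3-matching lies on the 6-cycle 0, 1, 3, 2, 5, 4.
  ⟨ 6 , known 0x1010413232545 0x1 0x1 0x1 ⟩⊢
    (outer? 3 (outer? 1 (four 0x117042536) (edge? 1 6 (seven 0x11045236) (by 0 0x1230154)))
   (by 0 0x1012345)) ∷
  ⟨ 8 , known 0x1010414152325263657 0x1030607131617273437464767 0x10123467 0x1 ⟩⊢
    (edge? 0 2 (four 0x102143657) (edge? 1 2 (four 0x112043657) (edge? 2 4 (four 0x124013657)
   (fit 6 0x151042367 0x1510423)))) ∷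
  ⟨ 8 , known 0x1010415232526364557 0x1030613141617273437464767 0x112346 0x1 ⟩⊢
    (outer? 7 (four 0x178012345) (edge? 1 2 (four 0x112043657) (edge? 2 4 (four 0x124013657)
   (edge? 0 2 (edge? 3 5 (stop 0x10235) (edge? 5 6 (stop 0x10256) (edge? 0 5 (stop 0x10523)
   (fit 8 0x105236471 0x1025736)))) (edge? 0 5 (stop 0x10523) (fit 7 0x150236174 0x1520136)))))) ∷
  ⟨ 7 , known 0x10104152325263645 0x11314163446 0x1012346 0x1 ⟩⊢
    (edge? 0 3 (stop 0x10325) (edge? 0 6 (stop 0x10625) (outer? 5 (by 0 0x101234567) (edge? 3 5
   (edge? 1 2 (seven 0x11045362) (edge? 2 4 (seven 0x12635104) (edge? 5 6 (edge? 0 2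
   (stop 0x10235) (edge? 0 5 (stop 0x10523) (fit 10 0x15236104 0x1523610))) (quad 0x1230154))))
   (quad 0x1260154))))) ∷
  ⟨ 8 , known 0x10107152325263645 0x1020306121314161724273437464767 0x1123467 0x1 ⟩⊢
    (edge? 0 5 (stop 0x10523) (fit 7 0x150236147 0x1520136)) ∷
  ⟨ 8 , known 0x1010715232526353645 0x1121314161724273437464767 0x1123467 0x1 ⟩⊢
    (edge? 0 6 (stop 0x10625) (edge? 0 3 (stop 0x10325) (edge? 0 2 (stop 0x10235)
   (by 0 0x101234567)))) ∷
  ⟨ 7 , known 0x10104152325263645 0x1131646 0x11246 0x1 ⟩⊢
    (outer? 3 (four 0x137012645) (edge? 3 4 (seven 0x13625104) (edge? 1 4 (outer? 0
   (four 0x107142536) (edge? 0 3 (seven 0x10145263) (edge? 0 6 (seven 0x10145236) (outer? 5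
   (outer? 7 (four 0x178012345) (by 4 0x101234567)) (edge? 3 5 (edge? 0 2 (seven 0x10145362)
   (edge? 1 2 (seven 0x11045362) (edge? 2 4 (seven 0x12635104) (edge? 0 5 (edge? 5 6
   (fit 9 0x15014236 0x1501423) (quad 0x1230145)) (quad 0x1142536))))) (quad 0x1260154))))))
   (outer? 0 (outer? 7 (four 0x178012345) (edge? 1 2 (four 0x112073645) (edge? 2 4
   (four 0x124071536) (edge? 5 7 (edge? 0 6 (stop 0x10625) (edge? 0 3 (stop 0x10325)
   (by 3 0x104237561))) (edge? 0 3 (stop 0x10325) (edge? 0 6 (stop 0x10625) (outer? 5
   (by 3 0x101234568) (edge? 0 2 (by 2 0x15123406) (by 1 0x101234567)))))))))
   (by 2 0x10123456))))) ∷
  ⟨ 7 , known 0x10104152325364556 0x10613162646 0x11246 0x1 ⟩⊢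
    (edge? 1 2 (seven 0x11045632) (edge? 2 4 (seven 0x12365104) (edge? 1 4 (by 0 0x13610254)
   (edge? 0 2 (by 6 0x1016523) (edge? 3 4 (by 6 0x1012543) (edge? 0 3 (stop 0x10315) (edge? 0 5
   (stop 0x10523) (edge? 3 5 (stop 0x10135) (fit 1 0x10531246 0x1015236))))))))) ∷
  ⟨ 7 , known 0x101041215233645 0x106164656 0x1146 0x1 ⟩⊢
    (outer? 0 (four 0x107123645) (outer? 5 (four 0x157041236) (quad 0x1230154))) ∷
  ⟨ 8 , known 0x10102041523364557 0x1061213141617242627343746475667 0x11246 0x1 ⟩⊢
    (outer? 7 (four 0x178012345) (edge? 0 3 (stop 0x10315) (edge? 3 5 (stop 0x10135) (edge? 0 5
   (stop 0x10523) (fit 5 0x130562471 0x1360257))))) ∷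
  ⟨ 7 , known 0x101041523253645 0x11316 0x11246 0x1 ⟩⊢
    (edge? 4 6 (seven 0x14015236) (edge? 2 6 (by 3 0x10123456) (edge? 0 6 (by 9 0x1012563)
   (edge? 5 6 (by 2 0x10123456) (edge? 1 4 (outer? 0 (four 0x107142536) (outer? 5 (outer? 7
   (four 0x178012345) (edge? 0 2 (four 0x102143657) (edge? 1 2 (four 0x112043657) (edge? 2 4
   (four 0x124013657) (by 4 0x132147506))))) (quad 0x1230154))) (edge? 1 2 (by 1 0x10123456)
   (edge? 2 4 (by 1 0x10423156) (edge? 3 4 (by 9 0x1012543) (edge? 0 2 (outer? 3 (outer? 7
   (four 0x178012345) (edge? 0 7 (by 9 0x1012573) (edge? 5 7 (by 2 0x13740251) (outer? 0
   (edge? 3 8 (by 9 0x1012583) (by 0 0x151234068)) (outer? 5 (outer? 8 (four 0x189012345)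
   (edge? 3 8 (by 2 0x13840251) (by 0 0x101234568))) (quad 0x1230154)))))) (outer? 0
   (by 0 0x151234067) (outer? 5 (by 0 0x101234567) (quad 0x1230154)))) (edge? 0 3 (stop 0x10315)
   (outer? 0 (edge? 3 7 (by 9 0x1012573) (by 0 0x151234067)) (outer? 5 (outer? 7
   (four 0x178012345) (edge? 3 7 (by 2 0x13240751) (edge? 3 5 (stop 0x10135) (edge? 0 5
   (stop 0x10523) (fit 5 0x135062741 0x1365204))))) (quad 0x1230154))))))))))))) ∷
  ⟨ 7 , known 0x101041423253645 0x112131516 0x11246 0x1 ⟩⊢
    (outer? 0 (four 0x107142536) (edge? 0 6 (seven 0x10145236) (edge? 2 6 (outer? 3
   (four 0x137012645) (edge? 0 3 (seven 0x10145263) (edge? 3 5 (by 0 0x16340251) (outer? 5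
   (outer? 7 (four 0x178012345) (edge? 0 2 (four 0x102143657) (by 9 0x132406517)))
   (stop 0x10426))))) (edge? 5 6 (by 0 0x13640251) (outer? 5 (outer? 7 (four 0x178012345)
   (edge? 0 2 (four 0x102143657) (edge? 2 4 (four 0x124013657) (edge? 4 6 (four 0x146012357)
   (edge? 0 3 (stop 0x10345) (edge? 3 4 (edge? 0 5 (stop 0x10534) (edge? 3 5 (stop 0x10135)
   (fit 8 0x135401672 0x1345701))) (by 6 0x132407516))))))) (stop 0x10423)))))) ∷
  ⟨ 7 , known 0x101042325343656 0x116 0x11246 0x1 ⟩⊢
    (edge? 0 6 (by 11 0x1042365) (by 1 0x15640231)) ∷
  ⟨ 6 , known 0x10104232545 0x113 0x11 0x1 ⟩⊢
    (outer? 3 (outer? 2 (four 0x127013645) (outer? 4 (four 0x147012536) (outer? 6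
   (four 0x167012345) (edge? 1 5 (by 2 0x10123456) (edge? 1 2 (outer? 5 (four 0x157041236)
   (edge? 5 6 (seven 0x15401236) (stop 0x10423))) (edge? 1 4 (by 1 0x10123456) (edge? 4 6
   (outer? 3 (four 0x137012546) (outer? 5 (four 0x157012346) (edge? 5 6 (quad 0x1042365)
   (stop 0x10423)))) (edge? 5 6 (by 0 0x10165432) (outer? 5 (outer? 7 (four 0x178012345)
   (edge? 2 4 (four 0x124013657) (edge? 2 6 (outer? 3 (four 0x138012645) (edge? 3 4
   (four 0x134012657) (edge? 3 7 (four 0x137012645) (edge? 0 6 (stop 0x10625)
   (by 1 0x13640251))))) (edge? 0 6 (by 12 0x1042563) (edge? 3 7 (by 0 0x10175432) (edge? 0 7
   (by 0 0x13675204) (edge? 3 5 (stop 0x10135) (edge? 0 5 (stop 0x10523) (edge? 0 3 (stop 0x10325)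
   (fit 0 0x1035167 0x1013657)))))))))) (stop 0x10423)))))))))) (stop 0x10425)) ∷
  -- The 3-matching lies on the path 1, 0, 4, 5, 2, 3; an edge between its ends gives the 6-cycle.
  ⟨ 6 , known 0x10104232545 0x1 0x1 0x1 ⟩⊢
    (edge? 1 3 (by 13 0x1012345) (outer? 1 (outer? 3 (four 0x137041625) (edge? 3 6
   (seven 0x13254016) (by 0 0x1230154))) (by 0 0x1012345))) ∷
  ⟨ 7 , known 0x1012324253546 0x102030405061213141516263656 0x112356 0x1 ⟩⊢
    (common? 0 4 (by 0 0x1012374) (fit 22 0x10135246 0x1013524)) ∷
  ⟨ 7 , known 0x101232425354546 0x102030405061213141516263656 0x11235 0x1 ⟩⊢
    (outer? 6 (four 0x167012345) (by 0 0x10123456)) ∷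
  ⟨ 6 , known 0x101232425343545 0x10203040512131415 0x101235 0x1 ⟩⊢
    (outer? 4 (by 0 0x10123456) (quad 0x1012345)) ∷
  ⟨ 7 , known 0x1012325344656 0x102030405061213141516 0x112346 0x1 ⟩⊢
    (outer? 5 (four 0x157012346) (fit 24 0x10123465 0x1012346)) ∷
  ⟨ 6 , known 0x101232425343545 0x10203040512131415 0x10123 0x1 ⟩⊢
    (outer? 5 (outer? 4 (four 0x147012356) (outer? 6 (four 0x167012345) (edge? 4 6
   (by 0 0x10123456) (by 1 0x1012354)))) (by 1 0x1012345)) ∷
  ⟨ 6 , known 0x101232425343545 0x10203040512131415 0x1013 0x1 ⟩⊢
    (outer? 2 (outer? 4 (four 0x147012635) (outer? 5 (four 0x157012634) (outer? 6
   (four 0x167012345) (edge? 5 6 (by 1 0x10134526) (by 0 0x1013524))))) (by 0 0x1012345)) ∷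
  ⟨ 7 , known 0x101232425343645 0x10203040506121314151656 0x115 0x1 ⟩⊢
    (outer? 2 (four 0x127013645) (outer? 4 (four 0x147012536) (outer? 6 (four 0x167012345)
   (edge? 2 6 (by 2 0x10145236) (edge? 4 6 (by 2 0x10125436) (by 4 0x10125346)))))) ∷
  ⟨ 6 , known 0x1012324253445 0x1020304051213141535 0x1015 0x1 ⟩⊢
    (outer? 3 (by 0 0x10123456) (stop 0x10124)) ∷
  -- The edge 01 is a component of its own, and 2, 3, 4, 5 span a complete graph with or without the
  -- edge 35.
  ⟨ 6 , known 0x1012324253445 0x10203040512131415 0x101 0x1 ⟩⊢
    (edge? 3 5 (outer? 3 (outer? 2 (four 0x127013645) (outer? 4 (four 0x147012536) (outer? 5
   (four 0x157012436) (outer? 6 (four 0x167012345) (edge? 4 6 (by 4 0x10125436)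
   (by 2 0x1012435)))))) (by 2 0x1012345)) (outer? 5 (outer? 2 (four 0x127013456) (outer? 3
   (four 0x137012456) (outer? 4 (four 0x147012356) (outer? 6 (four 0x167012345) (edge? 3 6
   (by 4 0x10124356) (by 0 0x1012543)))))) (by 0 0x1012345))) ∷
  ⟨ 7 , known 0x1012325344556 0x10203040506121314151624263546 0x1124 0x1 ⟩⊢
    (outer? 6 (four 0x167012345) (common? 0 3 (by 9 0x1012573) (common? 0 5 (by 9 0x1012375)
   (fit 20 0x10143256 0x1014325)))) ∷
  ⟨ 6 , known 0x10123253445 0x102030405121314152435 0x101234 0x1 ⟩⊢
    (outer? 5 (by 0 0x10123456) (quad 0x1012345)) ∷
  ⟨ 7 , known 0x1012325344656 0x102030405061213141516 0x11356 0x1 ⟩⊢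
    (outer? 2 (four 0x127013456) (by 7 0x10132546)) ∷
  ⟨ 7 , known 0x1012325344546 0x102030405061213141516243536 0x113 0x1 ⟩⊢
    (outer? 5 (four 0x157012346) (outer? 6 (four 0x167012345) (edge? 5 6 (by 0 0x10123456)
   (by 2 0x10132546)))) ∷
  ⟨ 6 , known 0x10123253445 0x102030405121314152435 0x1013 0x1 ⟩⊢
    (outer? 4 (by 0 0x10123456) (outer? 2 (outer? 5 (four 0x157012634) (outer? 6
   (four 0x167012345) (edge? 5 6 (by 9 0x10134526) (by 2 0x1013452)))) (by 2 0x1012345))) ∷
  ⟨ 7 , known 0x101232425343545 0x102030405121314151626364656 0x10126 0x1 ⟩⊢
    (outer? 3 (by 7 0x10143527) (outer? 5 (by 7 0x10125437) (outer? 4 (by 7 0x10124357)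
   (quad 0x1012345)))) ∷
  ⟨ 9 , known 0x101232428343545 0x10203040512131415161718565758 0x115 0x1 ⟩⊢
    (edge? 0 8 (by 15 0x1013482) (by 8 0x10132458)) ∷
  ⟨ 8 , known 0x101232425343545 0x102030405121314151617262736374647565767 0x11367 0x1 ⟩⊢
    (outer? 4 (by 0 0x1014253678) (outer? 5 (by 0 0x1015234678) (outer? 2 (by 0 0x1012345678)
   (quad 0x1012345)))) ∷
  ⟨ 7 , known 0x1012324253445 0x1020304051213141516353656 0x1136 0x1 ⟩⊢
    (outer? 5 (edge? 0 7 (by 17 0x1012375) (by 10 0x10125437)) (stop 0x10124)) ∷
  ⟨ 7 , known 0x1012324253445 0x102030405121314151626364656 0x116 0x1 ⟩⊢
    (edge? 3 5 (outer? 0 (outer? 7 (four 0x178012345) (edge? 2 7 (by 18 0x1013472) (edge? 5 7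
   (by 18 0x1012375) (edge? 3 7 (by 18 0x1012473) (edge? 4 7 (by 18 0x1012374) (outer? 3 (outer? 2
   (four 0x129013845) (outer? 4 (four 0x149012538) (outer? 5 (four 0x159012438) (outer? 8
   (four 0x189012345) (edge? 4 8 (outer? 3 (four 0x139012548) (edge? 0 8 (quad 0x1082345)
   (fit 24 0x10123845 0x1012384))) (by 1 0x101243567)))))) (by 1 0x101234567))))))) (outer? 2
   (outer? 3 (four 0x138012745) (outer? 4 (four 0x148012735) (outer? 7 (four 0x178012345)
   (edge? 3 7 (by 6 0x10124573) (by 3 0x10132456))))) (by 3 0x10123456))) (outer? 3 (outer? 4
   (four 0x148012537) (outer? 5 (four 0x158012437) (outer? 7 (four 0x178012345) (edge? 0 7
   (by 18 0x1012473) (edge? 5 7 (by 6 0x10124357) (by 0 0x10125436)))))) (by 0 0x10123456))) ∷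
  ⟨ 9 , known 0x1012325344558 0x102030405121314151617182426272835 0x112 0x1 ⟩⊢
    (edge? 0 8 (by 19 0x1012385) (by 6 0x10132548)) ∷
  ⟨ 8 , known 0x101232534374547 0x1020304051213141516172636465667 0x112467 0x1 ⟩⊢
    (outer? 3 (four 0x138012547) (outer? 5 (four 0x158012347) (edge? 0 7 (quad 0x1072345)
   (fit 24 0x10123745 0x1012374)))) ∷
  ⟨ 7 , known 0x10123253445 0x1020304051213141516242635364656 0x1126 0x1 ⟩⊢
    (outer? 3 (edge? 0 7 (by 21 0x1012573) (by 8 0x10152347)) (outer? 0 (outer? 7
   (four 0x178012345) (edge? 5 7 (by 21 0x1012375) (edge? 4 7 (by 21 0x1013274) (outer? 4
   (by 1 0x1013254678) (outer? 5 (by 1 0x1012345678) (quad 0x1012345)))))) (outer? 4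
   (by 8 0x10123457) (outer? 5 (by 8 0x10132547) (quad 0x1012345))))) ∷
  ⟨ 6 , known 0x10123253445 0x102030405 0x11 0x1 ⟩⊢
    (outer? 0 (outer? 6 (four 0x167012345) (edge? 1 3 (by 22 0x1062513) (edge? 3 6
   (by 22 0x1012563) (edge? 1 5 (by 22 0x1062315) (edge? 1 2 (by 22 0x1063412) (edge? 1 4
   (by 22 0x1063214) (edge? 4 6 (by 22 0x1013264) (edge? 5 6 (by 22 0x1012365) (edge? 2 6
   (by 22 0x1013462) (edge? 2 4 (by 3 0x10123456) (edge? 3 5 (by 3 0x10132546) (outer? 2 (outer? 3
   (four 0x138012745) (outer? 5 (four 0x158012734) (outer? 7 (four 0x178012345) (edge? 3 7
   (by 1 0x101523467) (by 0 0x10132546))))) (by 0 0x10123456))))))))))))) (edge? 1 3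
   (by 22 0x1105432) (edge? 1 4 (by 22 0x1102543) (edge? 1 2 (by 22 0x1104523) (edge? 1 5
   (by 22 0x1103452) (edge? 2 4 (by 13 0x1012345) (edge? 3 5 (by 13 0x1013254) (outer? 3 (outer? 2
   (four 0x127013645) (outer? 4 (four 0x147012536) (outer? 6 (four 0x167012345) (edge? 4 6
   (by 10 0x10132564) (by 8 0x1013452))))) (by 8 0x1012345))))))))) ∷
  ⟨ 8 , known 0x101061623253745 0x10203040507121417242627464767 0x1012467 0x1 ⟩⊢
    (edge? 5 6 (by 23 0x1012365) (edge? 1 5 (by 23 0x1062315) (edge? 3 6 (by 23 0x1012563)
   (edge? 3 5 (stop 0x10135) (edge? 1 3 (fit 7 0x135106274 0x1315206)
   (fit 19 0x101673254 0x1017325)))))) ∷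
  ⟨ 8 , known 0x101061623253745 0x102030405071727475767 0x1012456 0x1 ⟩⊢
    (outer? 7 (four 0x178012345) (edge? 1 2 (four 0x112063745) (edge? 1 4 (four 0x114062537)
   (edge? 2 6 (four 0x126013745) (edge? 4 6 (four 0x146012537) (edge? 2 4 (edge? 1 5
   (four 0x115062437) (edge? 5 6 (four 0x156012437) (edge? 3 6 (fit 6 0x132456017 0x1324560)
   (edge? 1 3 (fit 6 0x131062457 0x1310624) (fit 21 0x101645237 0x1014523)))))
   (by 0 0x101234567))))))) ∷
  ⟨ 7 , known 0x101061623253445 0x102030405 0x1012456 0x1 ⟩⊢
    (outer? 3 (by 0 0x101234567) (quad 0x1162345)) ∷
  ⟨ 8 , known 0x10106162324374557 0x10203040507121417264667 0x1012467 0x1 ⟩⊢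
    (outer? 3 (four 0x138012457) (outer? 5 (four 0x158012437) (edge? 1 3 (four 0x113062457)
   (edge? 1 5 (four 0x115062437) (edge? 3 6 (four 0x136012457) (edge? 5 6 (four 0x156012437)
   (fit 23 0x101623754 0x1012375))))))) ∷
  ⟨ 7 , known 0x101061623253445 0x102030405 0x101246 0x1 ⟩⊢
    (outer? 5 (outer? 7 (four 0x178012345) (edge? 1 2 (four 0x112063457) (edge? 1 4
   (four 0x114062357) (edge? 2 6 (four 0x126013457) (edge? 4 6 (four 0x146012357) (edge? 3 7
   (edge? 2 4 (by 0 0x101234567) (by 3 0x101237564)) (edge? 2 4 (outer? 3 (four 0x138012457)
   (by 1 0x10125436)) (by 3 0x101237564)))))))) (by 1 0x10123456)) ∷
  ⟨ 8 , known 0x10106162325273445 0x102030405071767 0x1016 0x1 ⟩⊢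
    (outer? 3 (four 0x138012745) (outer? 5 (four 0x158012734) (outer? 7 (four 0x178012345)
   (edge? 1 3 (four 0x113062745) (edge? 1 5 (four 0x115062734) (edge? 3 6 (four 0x136012745)
   (edge? 5 6 (four 0x156012734) (edge? 5 7 (by 1 0x101547263) (edge? 3 7 (by 1 0x101347265)
   (by 0 0x10132546)))))))))) ∷
  ⟨ 7 , known 0x10123253445 0x106 0x10 0x1 ⟩⊢
    (edge? 1 4 (by 29 0x1102543) (edge? 1 2 (by 29 0x1104523) (edge? 1 3 (by 29 0x1105432)
   (edge? 1 5 (by 29 0x1103452) (by 6 0x1102345))))) ∷
  -- A 4-cycle 2, 3, 4, 5 beside the edge 01.
  ⟨ 6 , known 0x10123253445 0x10304 0x1 0x1 ⟩⊢
    (edge? 0 2 (by 30 0x1014523) (edge? 0 5 (by 30 0x1013452) (outer? 1 (outer? 0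
   (four 0x107162345) (outer? 6 (four 0x167012345) (edge? 0 6 (outer? 1 (four 0x117062345)
   (outer? 4 (by 1 0x101432567) (outer? 2 (by 1 0x101234567) (by 2 0x10123456))))
   (by 0 0x10123456)))) (by 7 0x1012345)))) ∷
  ⟨ 6 , known 0x1012324253545 0x134 0x10 0x1 ⟩⊢
    (outer? 3 (by 1 0x10123546) (outer? 4 (by 1 0x10123546) (stop 0x10125))) ∷
  ⟨ 8 , known 0x101162324354547 0x103 0x1 0x1 ⟩⊢
    (edge? 0 2 (four 0x102163547) (by 1 0x1014235)) ∷
  ⟨ 7 , known 0x1012324254656 0x114 0x1 0x1 ⟩⊢
    (edge? 1 6 (by 33 0x1102364) (by 2 0x1102465)) ∷
  ⟨ 6 , known 0x10123242545 0x1143435 0x13 0x1 ⟩⊢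
    (outer? 4 (outer? 5 (four 0x157012346) (outer? 6 (four 0x167012345) (edge? 5 6
   (by 0 0x10123456) (stop 0x10124)))) (stop 0x10125)) ∷
  ⟨ 7 , known 0x101232425263645 0x1030405061314151634354656 0x1123456 0x1 ⟩⊢
    (outer? 0 (edge? 1 2 (four 0x112073645) (edge? 0 2 (fit 12 0x12013645 0x1203645)
   (fit 18 0x10136245 0x1013624))) (edge? 0 2 (edge? 1 2 (fit 11 0x12013645 0x1203645)
   (fit 12 0x12013645 0x1203645)) (edge? 1 2 (fit 12 0x12103645 0x1213645)
   (fit 18 0x10136245 0x1013624)))) ∷
  ⟨ 7 , known 0x101232425263645 0x1030405061314151634354656 0x12456 0x1 ⟩⊢
    (outer? 3 (four 0x137012645) (outer? 1 (outer? 0 (four 0x108172345) (outer? 7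
   (four 0x178012345) (edge? 0 2 (four 0x102173645) (edge? 0 7 (outer? 1 (four 0x118072345)
   (edge? 1 2 (four 0x112073645) (fit 17 0x101736245 0x1013624))) (by 0 0x11023456)))))
   (by 0 0x10123456))) ∷
  ⟨ 7 , known 0x101022324253645 0x103040506131415162634354656 0x12456 0x1 ⟩⊢
    (outer? 1 (four 0x117023645) (edge? 1 2 (by 0 0x13620451) (common? 0 3 (by 3 0x15401723)
   (fit 13 0x12013645 0x1203645)))) ∷
  -- A triangle 2, 4, 5 with 3 joined to 2, beside the edge 01.
  ⟨ 6 , known 0x10123242545 0x10304131434 0x1 0x1 ⟩⊢
    (edge? 3 5 (outer? 0 (outer? 1 (four 0x117062345) (outer? 6 (four 0x167012345) (edge? 1 6
   (edge? 4 6 (by 38 0x1012364) (edge? 3 6 (by 38 0x1012463) (outer? 3 (by 5 0x101243567)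
   (outer? 4 (by 5 0x101234567) (stop 0x10125))))) (by 6 0x1102345)))) (by 6 0x1012345))
   (edge? 0 5 (by 38 0x1012354) (edge? 1 5 (by 38 0x1102354) (outer? 3 (outer? 2
   (four 0x127013645) (outer? 4 (four 0x147012536) (outer? 5 (four 0x157012436) (outer? 6
   (four 0x167012345) (edge? 1 6 (by 38 0x1102463) (edge? 0 6 (by 38 0x1012463) (edge? 5 6
   (by 4 0x11024356) (edge? 4 6 (by 4 0x11025346) (edge? 2 6 (by 1 0x10123456) (edge? 0 2
   (by 0 0x10123456) (edge? 1 2 (by 0 0x11023456) (outer? 1 (outer? 0 (four 0x108172345) (outer? 7
   (four 0x178012345) (edge? 0 7 (outer? 1 (four 0x118072345) (by 13 0x101235476))
   (by 37 0x11024356)))) (by 37 0x10124356))))))))))))) (by 3 0x1012345))))) ∷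
  -- A spider with centre 5, two legs 5, 0, 1 and 5, 2, 3 of length two and a leg 5, 4 of length
  -- one.
  ⟨ 6 , known 0x10105232545 0x103041314243435 0x1 0x1 ⟩⊢
    (edge? 1 2 (by 39 0x1235410) (edge? 1 5 (by 0 0x1235410) (edge? 0 2 (outer? 4
   (by 39 0x1014625) (outer? 1 (by 4 0x1615420) (stop 0x10523))) (outer? 3 (by 39 0x1013652)
   (outer? 4 (outer? 1 (four 0x117052346) (outer? 6 (four 0x167012345) (edge? 1 6
   (by 39 0x1162305) (edge? 2 6 (by 5 0x10123564) (edge? 0 6 (by 5 0x12301564) (edge? 5 6
   (by 0 0x1235046) (fit 0 0x1024136 0x1012346))))))) (stop 0x10125)))))) ∷
  ⟨ 6 , known 0x101232545 0x10203040512131415243435 0x13 0x1 ⟩⊢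
    (outer? 4 (outer? 5 (four 0x157012346) (outer? 6 (four 0x167012345) (edge? 0 6
   (by 40 0x1015264) (edge? 1 6 (by 40 0x1105264) (edge? 5 6 (by 1 0x1015246) (edge? 2 6
   (by 6 0x11023564) (outer? 0 (outer? 1 (four 0x118072345) (outer? 7 (four 0x178012345)
   (edge? 1 7 (outer? 0 (four 0x108172345) (by 16 0x101526473)) (fit 0 0x1024136 0x1012346))))
   (fit 0 0x1124036 0x1102346)))))))) (stop 0x10125)) ∷
  -- A path 3, 2, 5, 4 beside the edge 01. Each of the other eleven pairs between different matching
  -- edges, if adjacent, yields a path on six vertices, a 4-cycle beside an edge, a triangle with a
  -- further edge beside an edge, or a spider.
  ⟨ 6 , known 0x101232545 0x1 0x1 0x1 ⟩⊢
    (edge? 0 4 (by 41 0x1012345) (edge? 0 3 (by 41 0x1015432) (edge? 3 4 (by 10 0x1012345)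
   (edge? 1 3 (by 41 0x1105432) (edge? 1 4 (by 41 0x1102345) (edge? 2 4 (by 2 0x1012345)
   (edge? 3 5 (by 2 0x1015432) (edge? 0 5 (by 1 0x1012345) (edge? 1 5 (by 1 0x1102345) (edge? 1 2
   (by 1 0x1105432) (edge? 0 2 (by 1 0x1015432) (outer? 3 (outer? 2 (four 0x127013645) (outer? 4
   (four 0x147012536) (outer? 6 (four 0x167012345) (edge? 0 6 (by 41 0x1012563) (edge? 4 6
   (outer? 3 (four 0x137012546) (outer? 5 (four 0x157012346) (edge? 1 6 (by 1 0x1321046) (outer? 0
   (outer? 1 (four 0x118072345) (outer? 7 (four 0x178012345) (edge? 1 7 (outer? 0
   (four 0x108172345) (fit 23 0x101723645 0x1012364)) (fit 24 0x10123645 0x1012364))))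
   (fit 24 0x11023645 0x1102364))))) (by 0 0x1015432)))))) (by 0 0x1012345))))))))))))) ∷
  ⟨ 7 , known 0x101232645 0x1020304050612131415162425343556 0x115 0x1 ⟩⊢
    (outer? 3 (four 0x137012645) (outer? 6 (four 0x167012345) (edge? 4 6 (by 0 0x1012346)
   (edge? 3 6 (outer? 2 (four 0x127013645) (common? 0 4 (by 0 0x1230147)
   (fit 16 0x10145236 0x1014523))) (fit 0 0x1024135 0x1012345))))) ∷
  ⟨ 6 , known 0x1012345 0x1020304051213141524253435 0x115 0x1 ⟩⊢
    (outer? 0 (edge? 2 6 (by 1 0x1450126) (outer? 2 (edge? 4 7 (by 1 0x1012347) (by 0 0x14523017))
   (fit 0 0x1034125 0x1013245))) (outer? 2 (by 0 0x10123456) (fit 0 0x1034125 0x1013245))) ∷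
  ⟨ 8 , known 0x1010616232745 0x1020304050712131415172425263435364647565767 0x10156 0x1 ⟩⊢
    (outer? 3 (four 0x138012745) (outer? 7 (four 0x178012345) (edge? 3 7 (outer? 2
   (four 0x128013745) (fit 15 0x145016237 0x1450123)) (by 0 0x1230145)))) ∷
  -- An induced 3-matching in which 4 is the only neighbour of 5.
  ⟨ 6 , known 0x1012345 0x1020304051213141524253435 0x15 0x1 ⟩⊢
    (outer? 1 (outer? 0 (four 0x107162345) (outer? 6 (four 0x167012345) (edge? 0 6 (outer? 1
   (four 0x117062345) (edge? 3 6 (by 3 0x1450136) (edge? 2 6 (by 3 0x1450126) (edge? 4 6
   (by 3 0x1230146) (outer? 4 (outer? 7 (four 0x178012345) (edge? 3 7 (by 3 0x1013247) (edge? 2 7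
   (by 3 0x1012347) (outer? 2 (outer? 3 (four 0x139012845) (outer? 8 (four 0x189012345) (edge? 3 8
   (outer? 2 (four 0x129013845) (edge? 4 8 (fit 21 0x101623845 0x1012384)
   (fit 15 0x145016238 0x1450123))) (by 0 0x101452367)))) (by 0 0x101453267))))) (outer? 2
   (by 0 0x101234567) (by 1 0x1320145))))))) (by 1 0x1102345)))) (by 1 0x1012345)) ∷
  []

root : Tree
root =
  -- The twelve pairs joining two edges of the matching are equivalent under its symmetries, so one
  -- lemma serves all twelve yes-branches; what follows concerns an induced 3-matching. There,
  -- different outer neighbours of the two ends of a matching edge would enlarge the matching, as
  -- the first `four` leaf records.
  (edge? 2 5 (by 4 0x1012345) (edge? 1 2 (by 4 0x1451032) (edge? 2 4 (by 4 0x1012354) (edge? 0 2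
   (by 4 0x1450132) (edge? 1 4 (by 4 0x1231054) (edge? 0 4 (by 4 0x1230154) (edge? 1 5
   (by 4 0x1231045) (edge? 0 5 (by 4 0x1230145) (edge? 3 4 (by 4 0x1013254) (edge? 0 3
   (by 4 0x1450123) (edge? 3 5 (by 4 0x1013245) (edge? 1 3 (by 4 0x1451023) (outer? 5 (outer? 4
   (four 0x147012356) (outer? 6 (four 0x167012345) (edge? 0 6 (by 4 0x1230156) (edge? 4 6
   (outer? 5 (four 0x157012346) (edge? 3 6 (by 4 0x1013246) (edge? 1 6 (by 4 0x1231046) (edge? 2 6
   (by 4 0x1012346) (outer? 3 (outer? 2 (four 0x128013745) (outer? 7 (four 0x178012345) (edge? 1 7
   (by 4 0x1451037) (edge? 0 7 (by 4 0x1450137) (edge? 2 7 (outer? 3 (four 0x138012745) (outer? 1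
   (outer? 0 (four 0x109182345) (outer? 8 (four 0x189012345) (edge? 0 8 (outer? 1
   (four 0x119082345) (fit 14 0x1018237456 0x1012345)) (fit 15 0x110237456 0x1102345))))
   (fit 15 0x101237456 0x1012345))) (by 0 0x1014532)))))) (by 0 0x1014523))))))
   (by 0 0x1012354))))) (by 0 0x1012345))))))))))))))

-- The classification

matched : List Fact
matched = map (uncurry edge) initial

matched-valid : ∀ {n} (G : Graph (Fin n)) (B : Buchsbaum G 3) → Soundness.Valid G B targets 6 matched
matched-valid G B = Soundness.verify-sound G B targets [] lemmas 6 matched root tt

buchsbaum⇒conclusion : ∀ {n} (G : Graph (Fin n)) (B : Buchsbaum G 3) → G Contains C₇ ⊎ Any (Fits G) targets
buchsbaum⇒conclusion G B with extend [] ([] , []) (s≤s z≤n)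
  where open Buchsbaum B
... | (a , b) , m₁ with Buchsbaum.extend B _ m₁ (s≤s (s≤s z≤n))
...   | (c , d) , m₂ with Buchsbaum.extend B _ m₂ (s≤s (s≤s (s≤s z≤n)))
...     | (e , f) , (e~f ∷ c~d ∷ a~b ∷ []) ,
          ((((e≢c , e≢d) , (f≢c , f≢d)) ∷ ((e≢a , e≢b) , (f≢a , f≢b)) ∷ []) ∷ (((c≢a , c≢b) , (d≢a , d≢b)) ∷ []) ∷ _) =
  matched-valid G B
    -- Beyond the six names the assignment takes the default value `e`, which no fact mentions.
    (nth e (e ∷ f ∷ c ∷ d ∷ a ∷ b ∷ []))
    (nth-injective ((~⇒≢ G e~f ∷ e≢c ∷ e≢d ∷ e≢a ∷ e≢b ∷ []) ∷ (f≢c ∷ f≢d ∷ f≢a ∷ f≢b ∷ []) ∷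
      (~⇒≢ G c~d ∷ c≢a ∷ c≢b ∷ []) ∷ (d≢a ∷ d≢b ∷ []) ∷ (~⇒≢ G a~b ∷ []) ∷ [] ∷ []))
    (((ℕ.<ᵇ⇒< 0 6 tt , ℕ.<ᵇ⇒< 1 6 tt) , e~f) ∷ ((ℕ.<ᵇ⇒< 2 6 tt , ℕ.<ᵇ⇒< 3 6 tt) , c~d) ∷
     ((ℕ.<ᵇ⇒< 4 6 tt , ℕ.<ᵇ⇒< 5 6 tt) , a~b) ∷ [])

classified⇒buchsbaum : ∀ {n} (G : Graph (Fin n)) → Classified G → TwoDimensionalBuchsbaum (M G)
classified⇒buchsbaum G (inj₁ (inj₁ (_ , _ , Δ)))        = Δ
classified⇒buchsbaum G (inj₁ (inj₂ (inj₁ petals)))      = ToComplex.twoDimensionalBuchsbaum G (petals⇒buchsbaum Fin._≟_ petals)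
classified⇒buchsbaum G (inj₁ (inj₂ (inj₂ (i , F))))     = ToComplex.twoDimensionalBuchsbaum G (𝓑⇒buchsbaum i F)
classified⇒buchsbaum G (inj₂ (inj₁ (inj₁ glue)))        = ToComplex.twoDimensionalBuchsbaum G (E₁⇒buchsbaum glue)
classified⇒buchsbaum G (inj₂ (inj₁ (inj₂ glue)))        = ToComplex.twoDimensionalBuchsbaum G (E₂⇒buchsbaum glue)
classified⇒buchsbaum G (inj₂ (inj₂ (_ , inj₁ three)))   = ToComplex.twoDimensionalBuchsbaum G (threeSmall⇒buchsbaum three)
classified⇒buchsbaum G (inj₂ (inj₂ (_ , inj₂ (c , small , large)))) =
  ToComplex.twoDimensionalBuchsbaum G (SmallAndLarge.buchsbaum c small (bowtieOr𝓖⇒buchsbaum large))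

eliminate : ∀ {A : Set} {P : A → Set} {C : Set} {xs} → All (λ x → P x → C) xs → Any P xs → C
eliminate (f ∷ _)  (here p)  = f p
eliminate (_ ∷ fs) (there p) = eliminate fs p

-- Once a 7-cycle is found, the other two conditions of `𝓑-C₇` are the hypotheses themselves.
buchsbaum⇒classified : ∀ {n} (G : Graph (Fin n)) → NoIsolatedVertices G → TwoDimensionalBuchsbaum (M G) → Classified G
buchsbaum⇒classified G noIso Δ = [ (λ c₇ → inj₁ (inj₁ (noIso , c₇ , Δ))) , eliminate (classify G noIso) ]′
  (buchsbaum⇒conclusion G (FromComplex.buchsbaum G Δ))

theorem4p1 : (n : ℕ) .{{_ : NonZero n}} (G : Graph (Fin n)) → NoIsolatedVertices G →
    TwoDimensionalBuchsbaum (M G) ⇔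
    ( (𝓑-C₇ G ⊎ 𝓑-P G ⊎ (∃ λ i → G ∈ᶠ 𝓑 i))
    ⊎ (E₁ G ⊎ E₂ G)
    ⊎ (¬ Connected G × (ThreeSmallComponents G ⊎ SmallAndLargeComponent G)) )
theorem4p1 n G noIso = mk⇔ (buchsbaum⇒classified G noIso) (classified⇒buchsbaum G)
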